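{- Let $p,q,r,s\ge 3$ be four pairwise coprime prime powers. Then ${\cal C}(\Phi^*_{pqr})$ is a set of consecutive integers. Moreover, if $r,s>\max(p,q)$, then ${\cal C}(\Phi^*_{pqr})={\cal C}(\Phi^*_{pqs})$ if $r\equiv s\pmod{pq}$, and ${\cal C}(\Phi^*_{pqr})=-{\cal C}(\Phi^*_{pqs})$ if $r\equiv -s\pmod{pq}$. If $r\equiv \pm s\pmod{pq}$ and $r>\max(p,q)>s\ge 3$, then $$H(\Phi^*_{pqs})\le H(\Phi^*_{pqr})\le H(\Phi^*_{pqs})+1.$$
   Context: A divisor $d$ of $n$ is unitary, $d\,\|\,n$, if $\gcd(d,n/d)=1$; $\mu^*(n)=(-1)^{\omega(n)}$ with $\omega(n)$ the number of distinct prime factors of $n$; $\Phi^*_n(x)=\prod_{d\,\|\,n}(x^d-1)^{\mu^*(n/d)}$ is the unitary cyclotomic polynomial (an integer polynomial). For a polynomial $f$, ${\cal C}(f)$ is the set of all its coefficients (coefficients of $x^j$ for $0\le j\le\deg f$), $-{\cal C}(f)=\{ -c:c\in{\cal C}(f)\}$, and $H(f)=\max\{|c|:c\in{\cal C}(f)\}$. -}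

module Defs where

open import Data.Nat as ℕ using (ℕ; zero; suc; _+_; _*_; _∸_; _^_; _≤_; _<_; _⊔_)
open import Data.Nat.DivMod using (_/_; _%_)
open import Data.Nat.Divisibility using (_∣_; _∣?_)
open import Data.Nat.GCD using (gcd)
open import Data.Nat.Primality using (Prime; prime?)
open import Data.Nat.Coprimality using (Coprime)
open import Data.Integer as ℤ using (ℤ; +_; -_)
open import Data.List using (List; []; _∷_; [_]; _++_; map; foldr; foldl; filter; length; upTo; replicate; reverse; dropWhile)
open import Data.List.Membership.Propositional using (_∈_)
open import Data.Product using (Σ; ∃; _×_; _,_)
open import Data.Bool using (Bool; true; false; if_then_else_)
open import Relation.Nullary.Decidable using (_×-dec_; ⌊_⌋)
open import Relation.Binary.PropositionalEquality using (_≡_)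

IsPrimePower : ℕ → Set
IsPrimePower n = Σ ℕ λ ℓ → Σ ℕ λ k → Prime ℓ × 1 ≤ k × n ≡ ℓ ^ k

isUnitary : ℕ → ℕ → Bool
isUnitary n i = ⌊ (suc i ∣? n) ×-dec (gcd (suc i) (n / suc i) ℕ.≟ 1) ⌋

unitaryDivisors : ℕ → List ℕ
unitaryDivisors n = map suc (filter (λ i → isUnitary n i Data.Bool.≟ true) (upTo n))

ω : ℕ → ℕ
ω n = length (filter (λ ℓ → prime? ℓ ×-dec (ℓ ∣? n)) (upTo (suc n)))

-- μ*(m) = (-1)^ω(m); we record only whether it is +1 (true) or -1 (false)
μ*IsPlus : ℕ → Bool
μ*IsPlus m = ⌊ (ω m % 2) ℕ.≟ 0 ⌋

-- Integer polynomials as coefficient lists (constant term first)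

Poly : Set
Poly = List ℤ

sumℤ : List ℤ → ℤ
sumℤ = foldr ℤ._+_ (+ 0)

coeff : Poly → ℕ → ℤ
coeff []       _       = + 0
coeff (c ∷ _)  zero    = c
coeff (_ ∷ cs) (suc k) = coeff cs k

_·_ : Poly → Poly → Poly
[] · g = []
f · [] = []
f · g  = map (λ k → sumℤ (map (λ i → coeff f i ℤ.* coeff g (k ∸ i)) (upTo (suc k))))
             (upTo (length f + length g ∸ 1))

xPow-1 : ℕ → Poly
xPow-1 d = - + 1 ∷ (replicate (d ∸ 1) (+ 0) ++ [ + 1 ])

-- exact division by x^(suc e) - 1:  if f = (x^d - 1) g then
-- g_j = - Σ_{t ≤ j/d} f_{j - t d}
divXPow-1 : Poly → ℕ → Poly
divXPow-1 f e = map (λ j → - sumℤ (map (λ t → coeff f (j ∸ t * suc e)) (upTo (suc (j / suc e)))))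
                    (upTo (length f ∸ suc e))

normalize : Poly → Poly
normalize f = reverse (dropWhile (λ c → c ℤ.≟ + 0) (reverse f))

-- Unitary cyclotomic polynomial
-- Φ*_n = ∏_{d ‖ n} (x^d - 1)^{μ*(n/d)}
--      = (∏_{d‖n, μ*(n/d)=1} (x^d-1)) / (∏_{d‖n, μ*(n/d)=-1} (x^d-1))

plusDivs : ℕ → List ℕ
plusDivs n = filter (λ d → μ*IsPlus (n / suc (d ∸ 1)) Data.Bool.≟ true) (unitaryDivisors n)

minusDivs : ℕ → List ℕ
minusDivs n = filter (λ d → μ*IsPlus (n / suc (d ∸ 1)) Data.Bool.≟ false) (unitaryDivisors n)

Φ* : ℕ → Poly
Φ* n = normalize (foldl (λ f d → divXPow-1 f (d ∸ 1))
                        (foldr (λ d f → xPow-1 d · f) [ + 1 ] (plusDivs n))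
                        (minusDivs n))

-- c ∈ C(f)  (f normalized: its entries are exactly the coefficients of x^j, 0 ≤ j ≤ deg f)
_∈C_ : ℤ → Poly → Set
c ∈C f = c ∈ normalize f

Consecutive : Poly → Set
Consecutive f = ∀ a b c → a ∈C f → b ∈C f → a ℤ.≤ c → c ℤ.≤ b → c ∈C f

SameCoeffs : Poly → Poly → Set
SameCoeffs f g = ∀ c → (c ∈C f → c ∈C g) × (c ∈C g → c ∈C f)

NegCoeffs : Poly → Poly → Set
NegCoeffs f g = ∀ c → (c ∈C f → (- c) ∈C g) × ((- c) ∈C g → c ∈C f)

H : Poly → ℕ
H f = foldr (λ c m → ℤ.∣ c ∣ ⊔ m) 0 f

-- Write Φ*_{pqr} = Φ*_{pq}(x^r) (1 − x^p)(1 − x^q) / ((1 − x)(1 − x^{pq})) with p < q.  The last factor has coefficients W,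
-- periodic mod pq, equal to 1 on [0, p), to −1 on [q, q + p) and to 0 elsewhere; hence the coefficient of x^n is
-- A(⌊n/r⌋ + 1, n), where A(N, t) = Σ_{i<N} c(i) W(t − r i), c(i) are the coefficients of Φ*_{pq}, and A depends only on
-- r and t mod pq.  Replacing (r, t) by (−r, p + q − 1 − t) changes the sign of A.
--
-- The difference A(N, t) − A(N, t − 1) is an alternating sum over the corners of a rectangle in the coordinates
-- i ≡ αp + βq (mod pq), which is at most 1 in absolute value: neighbouring coefficients differ by at most one, and the
-- coefficients are consecutive.  Without cutoff the rectangle sums vanish, and with them all A(N, t) for N ≥ pq.
--
-- The partial sums of c take only the values 0 and 1, being the indicator of the semigroup generated by p and q.  For
-- r > q, induction on N therefore shows that every A(N, t) is a coefficient, so the set of coefficients is determined by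
-- r mod pq.  For arbitrary r it shows that every A(N, t) differs by at most one from a coefficient or from 0.

module Submission where

open import Defs
open import Data.Nat as ℕ using (ℕ; zero; suc; _*_; _≤_; _<_; _⊔_; _+_; _∸_; NonZero; z≤n; s≤s)
import Data.Nat.Properties as ℕₚ
import Data.Nat.DivMod as DM
import Data.Nat.Divisibility as ℕ∣
open import Data.Nat.GCD as GCD using (gcd)
open import Data.Nat.Coprimality using (Coprime; coprime-Bézout; coprime-divisor; coprime⇒gcd≡1; gcd≡1⇒coprime)
open import Data.Nat.ListAction using (sum)
open import Data.Nat.ListAction.Properties using (sum-↭)
open import Data.Nat.Primality using (Prime; prime?; euclidsLemma; prime⇒irreducible; prime⇒nonTrivial)
open import Data.Integer as ℤ using (ℤ; +_; -[1+_]; -_; 0ℤ; 1ℤ; ∣_∣)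
  renaming (_+_ to _+ᶻ_; _-_ to _-ᶻ_; _*_ to _*ᶻ_)
import Data.Integer.Properties as ℤₚ
open import Data.Integer.DivMod using (_%ℕ_; _/ℕ_; n%ℕd<d; a≡a%ℕn+[a/ℕn]*n)
open import Data.Integer.Divisibility using (_∣_)
open import Data.Integer.Divisibility.Signed as ∣ᶻ using (divides) renaming (_∣_ to _∣ᶻ_; _∣?_ to _∣ᶻ?_)
open import Data.Integer.Tactic.RingSolver using (solve-∀)
open import Data.Bool as Bool using (Bool; true; false; not; if_then_else_)
import Data.Bool.Properties as Boolₚ
open import Data.Empty using (⊥-elim)
open import Data.List using (List; []; _∷_; [_]; _++_; map; filter; foldr; foldl; length; upTo; applyUpTo; replicate; reverse; dropWhile; takeWhile)
import Data.List.Properties as L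
open import Data.List.Membership.Propositional using (_∈_; _∉_)
import Data.List.Membership.Propositional.Properties as ∈ₚ
open import Data.List.Membership.Propositional.Properties.WithK using (unique∧set⇒bag)
open import Data.List.Relation.Binary.BagAndSetEquality using (∼bag⇒↭)
open import Data.List.Relation.Binary.Permutation.Propositional as Perm using (_↭_)
import Data.List.Relation.Binary.Permutation.Propositional.Properties as Permₚ
open import Data.List.Relation.Unary.All as All using (All; []; _∷_)
import Data.List.Relation.Unary.All.Properties as Allₚ
open import Data.List.Relation.Unary.Any using (here; there)
open import Data.List.Relation.Unary.Unique.Propositional using (Unique; []; _∷_)
import Data.List.Relation.Unary.Unique.Propositional.Properties as Uniqueₚ
open import Data.Product using (Σ; _×_; _,_; proj₁; proj₂)
open import Data.Sum using (_⊎_; inj₁; inj₂; [_,_]′)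
open import Function using (_∘_)
open import Function.Bundles using (mk⇔)
open import Relation.Binary.Definitions using (Tri; tri<; tri≈; tri>)
open import Relation.Binary.PropositionalEquality using (_≡_; _≢_; refl; sym; trans; cong; cong₂; subst; subst₂; module ≡-Reasoning)
open import Relation.Nullary using (¬_; Dec; yes; no; does)
open import Relation.Nullary.Decidable using (_×-dec_; ⌊_⌋)
import Algebra.Properties.CommutativeSemigroup ℕₚ.+-commutativeSemigroup as CS
import Algebra.Properties.CommutativeSemigroup ℕₚ.*-commutativeSemigroup as CS*
open ≡-Reasoning

-- In a coefficient the cutoff and the argument are tied by `N = ⌊t/r⌋ + 1`, and exchanging `r` for
-- `s` destroys this tie. Freed from it, the sums for `r` and for `s` are the same numbers up to
-- sign, so the task is to show that freeing the cutoff produces no new value, or only values that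
-- are off by one. For `r > q` a free sum can escape the obvious matches only when its last index
-- meets the negative block of `W` and the following index the positive block; the two changes then
-- have the same sign, and neighbouring coefficients fill the gap. For small `r` many indices may be
-- met at once, but they meet at most one of the two blocks, and a sum of `c` over an interval of
-- indices is a difference of two semigroup indicators. The rectangle arises because a shift of `t`
-- by `p` alters the solution `i` of `ri ≡ t` only mod `q`, that is, only `α`, and a shift by `q`
-- alters only `β`. The polynomial identity is proved for sequences on all of ℤ, where
-- multiplication by `x^d − 1` is `∇ d`; lists enter only through exact division, which recovers a
-- sequence that vanishes on the negative integers.

-- Finite integer sums.

∑ : ℕ → (ℕ → ℤ) → ℤ
∑ zero    f = 0ℤ
∑ (suc n) f = ∑ n f +ᶻ f n

∑-cong : ∀ n {f g : ℕ → ℤ} → (∀ i → i < n → f i ≡ g i) → ∑ n f ≡ ∑ n g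
∑-cong zero    h = refl
∑-cong (suc n) h = cong₂ _+ᶻ_ (∑-cong n λ i i<n → h i (ℕₚ.m<n⇒m<1+n i<n)) (h n ℕₚ.≤-refl)

∑-zero : ∀ n {f : ℕ → ℤ} → (∀ i → i < n → f i ≡ 0ℤ) → ∑ n f ≡ 0ℤ
∑-zero zero    h = refl
∑-zero (suc n) h = cong₂ _+ᶻ_ (∑-zero n λ i i<n → h i (ℕₚ.m<n⇒m<1+n i<n)) (h n ℕₚ.≤-refl)

∑-sub : ∀ n (f g : ℕ → ℤ) → ∑ n (λ i → f i -ᶻ g i) ≡ ∑ n f -ᶻ ∑ n g
∑-sub zero    f g = refl
∑-sub (suc n) f g = trans (cong (_+ᶻ (f n -ᶻ g n)) (∑-sub n f g)) (lem (∑ n f) (∑ n g) (f n) (g n))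
  where
  lem : ∀ a b c d → a -ᶻ b +ᶻ (c -ᶻ d) ≡ a +ᶻ c -ᶻ (b +ᶻ d)
  lem = solve-∀

∑-neg : ∀ n (f : ℕ → ℤ) → ∑ n (λ i → - f i) ≡ - ∑ n f
∑-neg zero    f = refl
∑-neg (suc n) f = trans (cong (_+ᶻ - f n) (∑-neg n f)) (sym (ℤₚ.neg-distrib-+ (∑ n f) (f n)))

∑-extend : ∀ n k {f : ℕ → ℤ} → (∀ i → n ≤ i → i < k + n → f i ≡ 0ℤ) → ∑ (k + n) f ≡ ∑ n f
∑-extend n zero    h = refl
∑-extend n (suc k) h = trans (cong₂ _+ᶻ_ (∑-extend n k λ i n≤i i<k+n → h i n≤i (ℕₚ.m<n⇒m<1+n i<k+n))
                                         (h (k + n) (ℕₚ.m≤n+m n k) ℕₚ.≤-refl))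
                             (ℤₚ.+-identityʳ _)

∑-single : ∀ n k {f : ℕ → ℤ} → k < n → (∀ i → i < n → i ≢ k → f i ≡ 0ℤ) → ∑ n f ≡ f k
∑-single (suc n) k {f} k<1+n h with k ℕ.≟ n
... | yes refl = trans (cong (_+ᶻ f n) (∑-zero n λ i i<n → h i (ℕₚ.m<n⇒m<1+n i<n) (ℕₚ.<⇒≢ i<n)))
                       (ℤₚ.+-identityˡ (f n))
... | no  k≢n  = trans (cong₂ _+ᶻ_ (∑-single n k (ℕₚ.≤∧≢⇒< (ℕₚ.≤-pred k<1+n) k≢n)
                                      λ i i<n → h i (ℕₚ.m<n⇒m<1+n i<n))
                                   (h n ℕₚ.≤-refl (k≢n ∘ sym)))
                       (ℤₚ.+-identityʳ (f k))

∑-telescope : ∀ n (f : ℕ → ℤ) → ∑ n (λ i → f (suc i) -ᶻ f i) ≡ f n -ᶻ f 0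
∑-telescope zero    f = sym (ℤₚ.+-inverseʳ (f 0))
∑-telescope (suc n) f = trans (cong (_+ᶻ (f (suc n) -ᶻ f n)) (∑-telescope n f)) (lem (f n) (f 0) (f (suc n)))
  where
  lem : ∀ a b c → a -ᶻ b +ᶻ (c -ᶻ a) ≡ c -ᶻ b
  lem = solve-∀

∑-head : ∀ n (g : ℕ → ℤ) → ∑ (suc n) g ≡ g 0 +ᶻ ∑ n (g ∘ suc)
∑-head zero    g = ℤₚ.+-comm 0ℤ (g 0)
∑-head (suc n) g = trans (cong (_+ᶻ g (suc n)) (∑-head n g)) (ℤₚ.+-assoc (g 0) (∑ n (g ∘ suc)) (g (suc n)))

∑-reverse : ∀ n (f : ℕ → ℤ) → ∑ n f ≡ ∑ n (λ i → f (n ∸ suc i))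
∑-reverse zero    f = refl
∑-reverse (suc n) f = trans (ℤₚ.+-comm (∑ n f) (f n))
                     (trans (cong (f n +ᶻ_) (∑-reverse n f)) (sym (∑-head n (λ i → f (suc n ∸ suc i)))))

-- Indicators, shifted differences and congruences.

⟦_⟧ : {P : Set} → Dec P → ℤ
⟦ d ⟧ = if does d then 1ℤ else 0ℤ

⟦⟧-yes : {P : Set} (d : Dec P) → P → ⟦ d ⟧ ≡ 1ℤ
⟦⟧-yes (yes _) _ = refl
⟦⟧-yes (no ¬p) p = ⊥-elim (¬p p)

⟦⟧-no : {P : Set} (d : Dec P) → ¬ P → ⟦ d ⟧ ≡ 0ℤ
⟦⟧-no (yes p) ¬p = ⊥-elim (¬p p)
⟦⟧-no (no _)  _  = refl

⟦⟧-cong : {P Q : Set} (d : Dec P) (e : Dec Q) → (P → Q) → (Q → P) → ⟦ d ⟧ ≡ ⟦ e ⟧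
⟦⟧-cong (yes p) e f g = sym (⟦⟧-yes e (f p))
⟦⟧-cong (no ¬p) e f g = sym (⟦⟧-no e (¬p ∘ g))

δ : ℤ → ℤ
δ u = ⟦ u ℤ.≟ 0ℤ ⟧

-- Multiplication by x^d − 1 on coefficient sequences.
∇ : ℕ → (ℤ → ℤ) → ℤ → ℤ
∇ d g n = g (n -ᶻ + d) -ᶻ g n

∇-cong : ∀ d {g h : ℤ → ℤ} → (∀ n → g n ≡ h n) → ∀ n → ∇ d g n ≡ ∇ d h n
∇-cong d e n = cong₂ _-ᶻ_ (e (n -ᶻ + d)) (e n)

∇-comm : ∀ d e (g : ℤ → ℤ) n → ∇ d (∇ e g) n ≡ ∇ e (∇ d g) n
∇-comm d e g n = trans (cong (λ x → g x -ᶻ g (n -ᶻ + d) -ᶻ (g (n -ᶻ + e) -ᶻ g n)) (swap n (+ d) (+ e)))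
                       (lem (g (n -ᶻ + e -ᶻ + d)) (g (n -ᶻ + d)) (g (n -ᶻ + e)) (g n))
  where
  swap : ∀ n d e → n -ᶻ d -ᶻ e ≡ n -ᶻ e -ᶻ d
  swap = solve-∀
  lem : ∀ a b c x → a -ᶻ b -ᶻ (c -ᶻ x) ≡ a -ᶻ c -ᶻ (b -ᶻ x)
  lem = solve-∀

∇-neg : ∀ d (g : ℤ → ℤ) n → ∇ d (λ m → - g m) n ≡ - ∇ d g n
∇-neg d g n = lem (g (n -ᶻ + d)) (g n)
  where
  lem : ∀ a b → - a -ᶻ - b ≡ - (a -ᶻ b)
  lem = solve-∀

multiple : ℕ → ℤ → ℤ
multiple m u = ⟦ + m ∣ᶻ? u ⟧

-- The coefficients of 1/(1 − x^m).
multiple⁺ : ℕ → ℤ → ℤ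
multiple⁺ m (+ n)    = multiple m (+ n)
multiple⁺ m -[1+ n ] = 0ℤ

∣ᶻ-small : ∀ {m} {a b : ℕ} → a < m → b < m → + m ∣ᶻ + a -ᶻ + b → a ≡ b
∣ᶻ-small {m} {a} {b} a<m b<m m∣ = ℤₚ.+-injective (ℤₚ.i-j≡0⇒i≡j (+ a) (+ b) (ℤₚ.∣i∣≡0⇒i≡0
  (small (∣ᶻ.∣⇒∣ᵤ m∣))))
  where
  bound : ∣ + a -ᶻ + b ∣ < m
  bound = ℕₚ.≤-<-trans (ℕₚ.≤-trans (ℕₚ.≤-reflexive (cong ∣_∣ (ℤₚ.[+m]-[+n]≡m⊖n a b))) (ℤₚ.∣m⊝n∣≤m⊔n a b))
                       (ℕₚ.⊔-pres-<m a<m b<m)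
  small : m ℕ∣.∣ ∣ + a -ᶻ + b ∣ → ∣ + a -ᶻ + b ∣ ≡ 0
  small m∣x with ∣ + a -ᶻ + b ∣ | bound
  ... | zero  | _   = refl
  ... | suc x | x<m = ⊥-elim (ℕₚ.<⇒≱ x<m (ℕ∣.∣⇒≤ m∣x))

coprime-∣ᶻ : ∀ {m a} {u : ℤ} → Coprime m a → + m ∣ᶻ + a *ᶻ u → + m ∣ᶻ u
coprime-∣ᶻ {m} {a} {u} cop m∣ = ∣ᶻ.∣ᵤ⇒∣ (coprime-divisor cop
  (subst (m ℕ∣.∣_) (ℤₚ.abs-* (+ a) u) (∣ᶻ.∣⇒∣ᵤ m∣)))

∣ᶻ-+⁻ : ∀ {m u v} → m ∣ᶻ u → m ∣ᶻ v -ᶻ u → m ∣ᶻ v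
∣ᶻ-+⁻ {m} {u} {v} m∣u m∣v-u = subst (m ∣ᶻ_) (lem u v) (∣ᶻ.∣m∣n⇒∣m+n m∣u m∣v-u)
  where
  lem : ∀ u v → u +ᶻ (v -ᶻ u) ≡ v
  lem = solve-∀

∣ᶻ-via : ∀ {m u v} → u ≡ v → m ∣ᶻ u → m ∣ᶻ v
∣ᶻ-via refl m∣u = m∣u

abstract
  -- A Bézout inverse of `a` is scaled by `t` and reduced mod `m`. This both solves `ri ≡ t` and
  -- supplies the coordinates `α`, `β` of an index.
  solve-mod : ∀ {a m} .{{_ : NonZero m}} → Coprime a m → ∀ t → Σ ℕ λ x → x < m × + m ∣ᶻ t -ᶻ + a *ᶻ + x
  solve-mod {a} {m} cop t = go (inverse (coprime-Bézout cop))
    where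
    inverse : GCD.Bézout.Identity 1 a m → Σ ℤ λ R → + m ∣ᶻ 1ℤ -ᶻ + a *ᶻ R
    inverse (GCD.Bézout.+- x y eq) = + x , divides (- + y) (begin
      1ℤ -ᶻ + a *ᶻ + x              ≡⟨ cong (1ℤ -ᶻ_) (trans (ℤₚ.*-comm (+ a) (+ x)) (sym (ℤₚ.pos-* x a))) ⟩
      1ℤ -ᶻ + (x * a)               ≡⟨ cong (λ z → 1ℤ -ᶻ + z) eq ⟨
      1ℤ -ᶻ (1ℤ +ᶻ + (y * m))       ≡⟨ cong (λ z → 1ℤ -ᶻ (1ℤ +ᶻ z)) (ℤₚ.pos-* y m) ⟩
      1ℤ -ᶻ (1ℤ +ᶻ + y *ᶻ + m)      ≡⟨ lem (+ y) (+ m) ⟩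
      - + y *ᶻ + m                  ∎)
      where
      lem : ∀ y m → 1ℤ -ᶻ (1ℤ +ᶻ y *ᶻ m) ≡ - y *ᶻ m
      lem = solve-∀
    inverse (GCD.Bézout.-+ x y eq) = - + x , divides (+ y) (begin
      1ℤ -ᶻ + a *ᶻ - + x            ≡⟨ lem (+ a) (+ x) ⟩
      1ℤ +ᶻ + x *ᶻ + a              ≡⟨ cong (1ℤ +ᶻ_) (ℤₚ.pos-* x a) ⟨
      1ℤ +ᶻ + (x * a)               ≡⟨ cong +_ eq ⟩
      + (y * m)                     ≡⟨ ℤₚ.pos-* y m ⟩
      + y *ᶻ + m                    ∎)
      where
      lem : ∀ a x → 1ℤ -ᶻ a *ᶻ - x ≡ 1ℤ +ᶻ x *ᶻ a
      lem = solve-∀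
    go : (Σ ℤ λ R → + m ∣ᶻ 1ℤ -ᶻ + a *ᶻ R) → Σ ℕ λ x → x < m × + m ∣ᶻ t -ᶻ + a *ᶻ + x
    go (R , divides k eq) = x , n%ℕd<d (t *ᶻ R) m , divides (t *ᶻ k +ᶻ + a *ᶻ y) (begin
      t -ᶻ + a *ᶻ + x                                 ≡⟨ lem₁ t (+ a) R (+ x) ⟩
      t *ᶻ (1ℤ -ᶻ + a *ᶻ R) +ᶻ + a *ᶻ (t *ᶻ R -ᶻ + x) ≡⟨ cong₂ (λ u v → t *ᶻ u +ᶻ + a *ᶻ (v -ᶻ + x)) eq
                                                             (a≡a%ℕn+[a/ℕn]*n (t *ᶻ R) m) ⟩
      t *ᶻ (k *ᶻ + m) +ᶻ + a *ᶻ (+ x +ᶻ y *ᶻ + m -ᶻ + x) ≡⟨ lem₂ t k (+ m) (+ a) (+ x) y ⟩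
      (t *ᶻ k +ᶻ + a *ᶻ y) *ᶻ + m ∎)
      where
      x : ℕ
      x = (t *ᶻ R) %ℕ m
      y : ℤ
      y = (t *ᶻ R) /ℕ m
      lem₁ : ∀ t a R x → t -ᶻ a *ᶻ x ≡ t *ᶻ (1ℤ -ᶻ a *ᶻ R) +ᶻ a *ᶻ (t *ᶻ R -ᶻ x)
      lem₁ = solve-∀
      lem₂ : ∀ t k m a x y → t *ᶻ (k *ᶻ m) +ᶻ a *ᶻ (x +ᶻ y *ᶻ m -ᶻ x) ≡ (t *ᶻ k +ᶻ a *ᶻ y) *ᶻ m
      lem₂ = solve-∀

multiple-cong : ∀ m u v → + m ∣ᶻ u -ᶻ v → multiple m u ≡ multiple m v
multiple-cong m u v m∣ = ⟦⟧-cong (+ m ∣ᶻ? u) (+ m ∣ᶻ? v)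
  (λ m∣u → ∣ᶻ-via (lem₁ u v) (∣ᶻ.∣m∣n⇒∣m-n m∣u m∣)) (λ m∣v → ∣ᶻ-+⁻ m∣v m∣)
  where
  lem₁ : ∀ u v → u -ᶻ (u -ᶻ v) ≡ v
  lem₁ = solve-∀

multiple⁺-zero : ∀ m {u} → ¬ (+ m ∣ᶻ u) → multiple⁺ m u ≡ 0ℤ
multiple⁺-zero m {+ n}      ¬m∣u = ⟦⟧-no (+ m ∣ᶻ? + n) ¬m∣u
multiple⁺-zero m { -[1+ n ]} ¬m∣u = refl

-- This is `(x^m − 1) · 1/(1 − x^m) = −1`. By periodicity the difference can survive only where the
-- shift crosses zero, for `0 ≤ n < m`, and there the only multiple of `m` is 0.
∇-multiple⁺ : ∀ m .{{_ : NonZero m}} u → ∇ m (multiple⁺ m) u ≡ - δ u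
∇-multiple⁺ m@(suc _) -[1+ n ] = refl
∇-multiple⁺ m@(suc m-1) (+ n) with m ℕ.≤? n
... | yes m≤n = begin
  multiple⁺ m (+ n -ᶻ + m) -ᶻ multiple m (+ n)
    ≡⟨ cong (λ z → multiple⁺ m z -ᶻ multiple m (+ n)) (trans (ℤₚ.[+m]-[+n]≡m⊖n n m) (ℤₚ.⊖-≥ m≤n)) ⟩
  multiple m (+ (n ∸ m)) -ᶻ multiple m (+ n)
    ≡⟨ cong (_-ᶻ multiple m (+ n)) (multiple-cong m (+ (n ∸ m)) (+ n) m∣) ⟩
  multiple m (+ n) -ᶻ multiple m (+ n)
    ≡⟨ ℤₚ.+-inverseʳ (multiple m (+ n)) ⟩
  0ℤ
    ≡⟨ cong -_ (⟦⟧-no (+ n ℤ.≟ 0ℤ) n≢0) ⟨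
  - δ (+ n) ∎
  where
  n≢0 : + n ≢ 0ℤ
  n≢0 refl = ⊥-elim (ℕₚ.<⇒≱ (s≤s z≤n) m≤n)
  lem : ∀ x m → x -ᶻ (x +ᶻ m) ≡ - 1ℤ *ᶻ m
  lem = solve-∀
  m∣ : + m ∣ᶻ + (n ∸ m) -ᶻ + n
  m∣ = divides (- 1ℤ) (trans (cong (λ z → + (n ∸ m) -ᶻ + z) (sym (ℕₚ.m∸n+n≡m m≤n))) (lem (+ (n ∸ m)) (+ m)))
... | no m≰n = begin
  multiple⁺ m (+ n -ᶻ + m) -ᶻ multiple m (+ n)
    ≡⟨ cong (λ z → multiple⁺ m z -ᶻ multiple m (+ n)) (trans (ℤₚ.[+m]-[+n]≡m⊖n n m) (ℤₚ.⊖-≰ m≰n)) ⟩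
  multiple⁺ m (- + (m ∸ n)) -ᶻ multiple m (+ n)
    ≡⟨ cong (_-ᶻ multiple m (+ n)) (negative (m ∸ n) (ℕₚ.m<n⇒0<n∸m n<m)) ⟩
  0ℤ -ᶻ multiple m (+ n)
    ≡⟨ ℤₚ.+-identityˡ (- multiple m (+ n)) ⟩
  - multiple m (+ n)
    ≡⟨ cong -_ (⟦⟧-cong (+ m ∣ᶻ? + n) (+ n ℤ.≟ 0ℤ)
         (λ m∣n → cong +_ (∣ᶻ-small n<m (s≤s z≤n) (∣ᶻ-via (sym (ℤₚ.+-identityʳ (+ n))) m∣n)))
         (λ n≡0 → ∣ᶻ-via (sym n≡0) (divides 0ℤ refl))) ⟩
  - δ (+ n) ∎
  where
  n<m = ℕₚ.≰⇒> m≰n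
  negative : ∀ k → 0 < k → multiple⁺ m (- + k) ≡ 0ℤ
  negative (suc k) _ = refl

infixl 6 _⊞_
infix 7 _⊛_

_⊛_ : ∀ (x : ℤ) {h h′} → h ≡ h′ → x *ᶻ (h -ᶻ h′) ≡ 0ℤ
_⊛_ x {h} refl = trans (cong (x *ᶻ_) (ℤₚ.+-inverseʳ h)) (ℤₚ.*-zeroʳ x)

_⊞_ : ∀ {x y : ℤ} → x ≡ 0ℤ → y ≡ 0ℤ → x +ᶻ y ≡ 0ℤ
refl ⊞ refl = refl

-- Linear arithmetic: z is a combination of equations h ≡ h′ built with _⊛_ and _⊞_, and the last hypothesis is a ring identity.
linear : ∀ (a b : ℤ) {z} → z ≡ 0ℤ → a -ᶻ b ≡ z → a ≡ b
linear a b z≡0 eq = ℤₚ.i-j≡0⇒i≡j a b (trans eq z≡0)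

Bit : ℤ → Set
Bit x = x ≡ 0ℤ ⊎ x ≡ 1ℤ

Trit : ℤ → Set
Trit x = ∣ x ∣ ≤ 1

bit-sub : ∀ {x y} → Bit x → Bit y → Trit (x -ᶻ y)
bit-sub (inj₁ refl) (inj₁ refl) = z≤n
bit-sub (inj₁ refl) (inj₂ refl) = ℕₚ.≤-refl
bit-sub (inj₂ refl) (inj₁ refl) = ℕₚ.≤-refl
bit-sub (inj₂ refl) (inj₂ refl) = z≤n

trit-neg : ∀ {x} → Trit x → Trit (- x)
trit-neg {x} = subst (_≤ 1) (sym (ℤₚ.∣-i∣≡∣i∣ x))

⟦⟧-bit : {P : Set} (d : Dec P) → Bit ⟦ d ⟧
⟦⟧-bit (yes _) = inj₂ refl
⟦⟧-bit (no _)  = inj₁ refl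

δ-cong : ∀ x y → (x ≡ 0ℤ → y ≡ 0ℤ) → (y ≡ 0ℤ → x ≡ 0ℤ) → δ x ≡ δ y
δ-cong x y = ⟦⟧-cong (x ℤ.≟ 0ℤ) (y ℤ.≟ 0ℤ)

∣ᶻ-coprime-* : ∀ {m n} {u : ℤ} → Coprime m n → + m ∣ᶻ u → + n ∣ᶻ u → + (m * n) ∣ᶻ u
∣ᶻ-coprime-* {m} {n} {u} m⊥n (divides x u≡xm) n∣u = divides y (begin
  u                  ≡⟨ u≡xm ⟩
  x *ᶻ + m           ≡⟨ cong (_*ᶻ + m) x≡yn ⟩
  y *ᶻ + n *ᶻ + m    ≡⟨ lem y (+ n) (+ m) ⟩
  y *ᶻ (+ m *ᶻ + n)  ≡⟨ cong (y *ᶻ_) (ℤₚ.pos-* m n) ⟨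
  y *ᶻ + (m * n)     ∎)
  where
  n∣x : + n ∣ᶻ x
  n∣x = coprime-∣ᶻ (λ (d∣n , d∣m) → m⊥n (d∣m , d∣n)) (∣ᶻ-via (trans u≡xm (ℤₚ.*-comm x (+ m))) n∣u)
  y = ∣ᶻ.quotient n∣x
  x≡yn : x ≡ y *ᶻ + n
  x≡yn = ∣ᶻ._∣_.equality n∣x
  lem : ∀ y n m → y *ᶻ n *ᶻ m ≡ y *ᶻ (m *ᶻ n)
  lem = solve-∀

-- The polynomial Φ*_{pq}

module Binary (p q : ℕ) .{{_ : NonZero p}} .{{_ : NonZero q}} (p≥2 : 2 ≤ p) (p⊥q : Coprime p q) where

  private
    q⊥p : Coprime q p
    q⊥p (d∣q , d∣p) = p⊥q (d∣p , d∣q)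

  -- The indicator function of the numerical semigroup generated by p and q.
  B : ℤ → ℤ
  B n = ∑ p λ j → multiple⁺ p (n -ᶻ + j *ᶻ + q)

  -- The coefficients of Φ*_{pq} = (x^{pq} − 1)(x − 1) / ((x^p − 1)(x^q − 1)).
  c : ℤ → ℤ
  c n = B n -ᶻ B (n -ᶻ 1ℤ)

  private
    -- As `q` is invertible mod `p`, the only `j < p` with `n ≡ jq (mod p)` is `β`. Hence the sign
    -- of `z` decides `B n`.
    B-single : ∀ β z n → β < p → n ≡ + β *ᶻ + q +ᶻ z *ᶻ + p → B n ≡ multiple⁺ p (z *ᶻ + p)
    B-single β z n β<p refl = trans
      (∑-single p β β<p λ j j<p j≢β → multiple⁺-zero p λ p∣ → j≢β
        (sym (∣ᶻ-small β<p j<p (coprime-∣ᶻ {p} {q} p⊥q (∣ᶻ-via (lem₂ (+ β) (+ q) z (+ p) (+ j))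
          (∣ᶻ.∣m∣n⇒∣m-n {+ p} {+ β *ᶻ + q +ᶻ z *ᶻ + p -ᶻ + j *ᶻ + q} {z *ᶻ + p} p∣ (divides z refl)))))))
      (cong (multiple⁺ p) (lem₁ (+ β) (+ q) z (+ p)))
      where
      lem₁ : ∀ b q z p → b *ᶻ q +ᶻ z *ᶻ p -ᶻ b *ᶻ q ≡ z *ᶻ p
      lem₁ = solve-∀
      lem₂ : ∀ b q z p j → b *ᶻ q +ᶻ z *ᶻ p -ᶻ j *ᶻ q -ᶻ z *ᶻ p ≡ q *ᶻ (b -ᶻ j)
      lem₂ = solve-∀

    Coordinate : ℤ → Set
    Coordinate n = Σ ℕ λ β → β < p × Σ ℕ λ k → n ≡ + β *ᶻ + q +ᶻ + k *ᶻ + p ⊎ n ≡ + β *ᶻ + q -ᶻ + suc k *ᶻ + p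

    coordinate : ∀ n → Coordinate n
    coordinate n = let β , β<p , divides z eq = solve-mod {q} {p} q⊥p n in β , β<p ,
      split β z (linear n (+ β *ᶻ + q +ᶻ z *ᶻ + p) (1ℤ ⊛ eq) (lem n (+ β) (+ q) z (+ p)))
      where
      lem : ∀ n b q z p → n -ᶻ (b *ᶻ q +ᶻ z *ᶻ p) ≡ 1ℤ *ᶻ (n -ᶻ q *ᶻ b -ᶻ z *ᶻ p)
      lem = solve-∀
      split : ∀ β z → n ≡ + β *ᶻ + q +ᶻ z *ᶻ + p →
              Σ ℕ λ k → n ≡ + β *ᶻ + q +ᶻ + k *ᶻ + p ⊎ n ≡ + β *ᶻ + q -ᶻ + suc k *ᶻ + p
      split β (+ k)      eq = k , inj₁ eq
      split β (-[1+ k ]) eq = k , inj₂ (trans eq (cong (+ β *ᶻ + q +ᶻ_) (sym (ℤₚ.neg-distribˡ-* (+ suc k) (+ p)))))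

  B-one : ∀ β k n → β < p → n ≡ + β *ᶻ + q +ᶻ + k *ᶻ + p → B n ≡ 1ℤ
  B-one β k n β<p eq = trans (B-single β (+ k) n β<p eq) (trans (cong (multiple⁺ p) (sym (ℤₚ.pos-* k p)))
    (⟦⟧-yes (+ p ∣ᶻ? + (k * p)) (divides (+ k) (ℤₚ.pos-* k p))))

  B-zero : ∀ β k n → β < p → n ≡ + β *ᶻ + q -ᶻ + suc k *ᶻ + p → B n ≡ 0ℤ
  B-zero β k n β<p eq = trans
    (B-single β (-[1+ k ]) n β<p (trans eq (cong (+ β *ᶻ + q +ᶻ_) (ℤₚ.neg-distribˡ-* (+ suc k) (+ p)))))
    (negative p)
    where
    negative : ∀ m .{{_ : NonZero m}} → multiple⁺ m (-[1+ k ] *ᶻ + m) ≡ 0ℤ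
    negative (suc m) = refl

  B-bit : ∀ n → Bit (B n)
  B-bit n = go (coordinate n)
    where
    go : Coordinate n → Bit (B n)
    go (β , β<p , k , inj₁ eq) = inj₂ (B-one β k n β<p eq)
    go (β , β<p , k , inj₂ eq) = inj₁ (B-zero β k n β<p eq)

  -- A negative coefficient of `p` would force `n < βq ≤ (p − 1)q`.
  B-large : ∀ n → p * q ≤ n + q → B (+ n) ≡ 1ℤ
  B-large n pq≤n+q = go (coordinate (+ n))
    where
    lem : ∀ n b z p bq kp → n +ᶻ kp -ᶻ bq ≡ 1ℤ *ᶻ (n -ᶻ (b -ᶻ z *ᶻ p)) +ᶻ 1ℤ *ᶻ (b -ᶻ bq) +ᶻ 1ℤ *ᶻ (kp -ᶻ z *ᶻ p)
    lem = solve-∀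
    go : Coordinate (+ n) → B (+ n) ≡ 1ℤ
    go (β , β<p , k , inj₁ eq) = B-one β k (+ n) β<p eq
    go (β , β<p , k , inj₂ eq) = ⊥-elim (ℕₚ.<⇒≱ n<βq
      (ℕₚ.+-cancelʳ-≤ q (β * q) n (ℕₚ.≤-trans (ℕₚ.≤-reflexive (ℕₚ.+-comm (β * q) q))
        (ℕₚ.≤-trans (ℕₚ.*-monoˡ-≤ q β<p) pq≤n+q))))
      where
      eqℕ : n + suc k * p ≡ β * q
      eqℕ = ℤₚ.+-injective (linear (+ n +ᶻ + (suc k * p)) (+ (β * q))
        (1ℤ ⊛ eq ⊞ 1ℤ ⊛ sym (ℤₚ.pos-* β q) ⊞ 1ℤ ⊛ ℤₚ.pos-* (suc k) p)
        (lem (+ n) (+ β *ᶻ + q) (+ suc k) (+ p) (+ (β * q)) (+ (suc k * p))))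
      n<βq : n < β * q
      n<βq = subst (n <_) eqℕ (ℕₚ.m<m+n n (ℕₚ.*-mono-< {0} {suc k} {0} {p} (s≤s z≤n) (ℕₚ.<⇒≤ p≥2)))

  B-negative : ∀ n → B -[1+ n ] ≡ 0ℤ
  B-negative n = ∑-zero p λ j _ → trans (cong (multiple⁺ p ∘ (-[1+ n ] -ᶻ_)) (sym (ℤₚ.pos-* j q)))
                                        (negative (j * q))
    where
    negative : ∀ k → multiple⁺ p (-[1+ n ] -ᶻ + k) ≡ 0ℤ
    negative zero    = refl
    negative (suc k) = refl

  -- The generating function of `B` is `(1 − x^{pq}) / ((1 − x^p)(1 − x^q))`: clearing `1 − x^p`
  -- leaves the geometric sum of the `x^{jq}`, `j < p`, and clearing `1 − x^q` telescopes it.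
  ∇∇B : ∀ n → ∇ p (∇ q B) n ≡ - ∇ (p * q) δ n
  ∇∇B n = begin
    ∇ p (∇ q B) n                               ≡⟨ ∇-comm p q B n ⟩
    ∇ q (∇ p B) n                               ≡⟨ ∇-cong q ∇B n ⟩
    ∇ q (λ m → ∑ p (λ j → - δ (m -ᶻ + j *ᶻ + q))) n
      ≡⟨ ∑-sub p (λ j → - δ (n -ᶻ + q -ᶻ + j *ᶻ + q)) (λ j → - δ (n -ᶻ + j *ᶻ + q)) ⟨
    ∑ p (λ j → - δ (n -ᶻ + q -ᶻ + j *ᶻ + q) -ᶻ - δ (n -ᶻ + j *ᶻ + q))
      ≡⟨ ∑-cong p (λ j _ → cong (λ z → - δ z -ᶻ - δ (n -ᶻ + j *ᶻ + q)) (lem₂ n (+ q) (+ j))) ⟩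
    ∑ p (λ j → - δ (n -ᶻ + suc j *ᶻ + q) -ᶻ - δ (n -ᶻ + j *ᶻ + q))
      ≡⟨ ∑-telescope p (λ j → - δ (n -ᶻ + j *ᶻ + q)) ⟩
    - δ (n -ᶻ + p *ᶻ + q) -ᶻ - δ (n -ᶻ + 0 *ᶻ + q)
      ≡⟨ cong₂ (λ y z → - δ (n -ᶻ y) -ᶻ - δ z) (sym (ℤₚ.pos-* p q)) (lem₃ n (+ q)) ⟩
    - δ (n -ᶻ + (p * q)) -ᶻ - δ n               ≡⟨ lem₄ (δ (n -ᶻ + (p * q))) (δ n) ⟩
    - ∇ (p * q) δ n                             ∎
    where
    lem₁ : ∀ m p x → m -ᶻ p -ᶻ x ≡ m -ᶻ x -ᶻ p
    lem₁ = solve-∀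
    lem₂ : ∀ n q j → n -ᶻ q -ᶻ j *ᶻ q ≡ n -ᶻ (1ℤ +ᶻ j) *ᶻ q
    lem₂ = solve-∀
    lem₃ : ∀ n q → n -ᶻ 0ℤ *ᶻ q ≡ n
    lem₃ = solve-∀
    lem₄ : ∀ a b → - a -ᶻ - b ≡ - (a -ᶻ b)
    lem₄ = solve-∀
    ∇B : ∀ m → ∇ p B m ≡ ∑ p (λ j → - δ (m -ᶻ + j *ᶻ + q))
    ∇B m = trans (sym (∑-sub p (λ j → multiple⁺ p (m -ᶻ + p -ᶻ + j *ᶻ + q)) (λ j → multiple⁺ p (m -ᶻ + j *ᶻ + q))))
      (∑-cong p λ j _ → trans (cong (λ z → multiple⁺ p z -ᶻ multiple⁺ p (m -ᶻ + j *ᶻ + q)) (lem₁ m (+ p) (+ j *ᶻ + q)))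
                              (∇-multiple⁺ p (m -ᶻ + j *ᶻ + q)))

  ∇∇c : ∀ n → ∇ p (∇ q c) n ≡ ∇ 1 (∇ (p * q) δ) n
  ∇∇c n = begin
    ∇ p (∇ q c) n                   ≡⟨ ∇-cong p (∇-cong q c-∇) n ⟩
    ∇ p (∇ q (λ m → - ∇ 1 B m)) n   ≡⟨ ∇-cong p (∇-neg q (∇ 1 B)) n ⟩
    ∇ p (λ m → - ∇ q (∇ 1 B) m) n   ≡⟨ ∇-neg p (∇ q (∇ 1 B)) n ⟩
    - ∇ p (∇ q (∇ 1 B)) n           ≡⟨ cong -_ (∇-cong p (∇-comm q 1 B) n) ⟩
    - ∇ p (∇ 1 (∇ q B)) n           ≡⟨ cong -_ (∇-comm p 1 (∇ q B) n) ⟩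
    - ∇ 1 (∇ p (∇ q B)) n           ≡⟨ cong -_ (∇-cong 1 ∇∇B n) ⟩
    - ∇ 1 (λ m → - ∇ (p * q) δ m) n ≡⟨ cong -_ (∇-neg 1 (∇ (p * q) δ) n) ⟩
    - - ∇ 1 (∇ (p * q) δ) n         ≡⟨ ℤₚ.neg-involutive _ ⟩
    ∇ 1 (∇ (p * q) δ) n             ∎
    where
    c-∇ : ∀ m → c m ≡ - ∇ 1 B m
    c-∇ m = lem (B m) (B (m -ᶻ 1ℤ))
      where
      lem : ∀ a b → a -ᶻ b ≡ - (b -ᶻ a)
      lem = solve-∀

  c-negative : ∀ n → c -[1+ n ] ≡ 0ℤ
  c-negative n = cong₂ _-ᶻ_ (B-negative n) (B-negative (suc (n + 0)))

  c-large : ∀ i → p * q ≤ i → c (+ i) ≡ 0ℤ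
  c-large zero    pq≤0 = ⊥-elim (ℕₚ.<⇒≱ (ℕₚ.*-mono-< {0} {p} {0} {q} (ℕₚ.<⇒≤ p≥2) (ℕ.>-nonZero⁻¹ q)) pq≤0)
  c-large (suc i) pq≤  = cong₂ _-ᶻ_ (B-large (suc i) (ℕₚ.≤-trans pq≤ (ℕₚ.m≤m+n (suc i) q)))
    (B-large i (ℕₚ.≤-trans pq≤ (ℕₚ.≤-trans (ℕₚ.≤-reflexive (ℕₚ.+-comm 1 i)) (ℕₚ.+-monoʳ-≤ i (ℕ.>-nonZero⁻¹ q)))))

  -- `(μ, ν)` are the coordinates of 1: `ν` inverts `q` mod `p`, and `μ = q − κ` inverts `p` mod
  -- `q`. Passing from `i` to `i − 1` therefore subtracts `(μ, ν)` from `(α, β)`, which is how `c`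
  -- comes to depend on the comparisons of `α` with `μ` and of `β` with `ν`.
  record Unit : Set where
    field
      μ ν κ : ℕ
      ν<p   : ν < p
      μ+κ≡q : μ + κ ≡ q
      νq≡   : ν * q ≡ 1 + κ * p

    μp+νq≡ : μ * p + ν * q ≡ p * q + 1
    μp+νq≡ = begin
      μ * p + ν * q       ≡⟨ cong (λ x → μ * p + x) νq≡ ⟩
      μ * p + (1 + κ * p) ≡⟨ cong (λ x → μ * p + x) (ℕₚ.+-comm 1 (κ * p)) ⟩
      μ * p + (κ * p + 1) ≡⟨ ℕₚ.+-assoc (μ * p) (κ * p) 1 ⟨
      μ * p + κ * p + 1   ≡⟨ cong (_+ 1) (ℕₚ.*-distribʳ-+ p μ κ) ⟨
      (μ + κ) * p + 1     ≡⟨ cong (λ x → x * p + 1) μ+κ≡q ⟩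
      q * p + 1           ≡⟨ cong (_+ 1) (ℕₚ.*-comm q p) ⟩
      p * q + 1           ∎

  abstract
    unit : Unit
    unit = let ν , ν<p , divides z eq = solve-mod {q} {p} q⊥p 1ℤ in go ν ν<p z eq
      where
      lem₁ : ∀ a z p b → 1ℤ -ᶻ (a +ᶻ b) ≡ 1ℤ *ᶻ (1ℤ -ᶻ a -ᶻ z *ᶻ p) +ᶻ - 1ℤ *ᶻ (b -ᶻ z *ᶻ p)
      lem₁ = solve-∀
      lem₂ : ∀ x a z p b → x -ᶻ (1ℤ +ᶻ b) ≡ 1ℤ *ᶻ (x -ᶻ a) +ᶻ - 1ℤ *ᶻ (1ℤ -ᶻ a -ᶻ - z *ᶻ p) +ᶻ - 1ℤ *ᶻ (b -ᶻ z *ᶻ p)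
      lem₂ = solve-∀
      build : ∀ ν κ → ν < p → 1ℤ -ᶻ + q *ᶻ + ν ≡ - + κ *ᶻ + p → Unit
      build ν κ ν<p eq = record { μ = q ∸ κ ; ν = ν ; κ = κ ; ν<p = ν<p ; μ+κ≡q = ℕₚ.m∸n+n≡m κ≤q ; νq≡ = νq≡ }
        where
        νq≡ : ν * q ≡ 1 + κ * p
        νq≡ = ℤₚ.+-injective (linear (+ (ν * q)) (1ℤ +ᶻ + (κ * p))
          (1ℤ ⊛ trans (ℤₚ.pos-* ν q) (ℤₚ.*-comm (+ ν) (+ q)) ⊞ - 1ℤ ⊛ eq ⊞ - 1ℤ ⊛ ℤₚ.pos-* κ p)
          (lem₂ (+ (ν * q)) (+ q *ᶻ + ν) (+ κ) (+ p) (+ (κ * p))))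
        κ≤q : κ ≤ q
        κ≤q = ℕₚ.*-cancelʳ-≤ κ q p (ℕₚ.≤-trans (ℕₚ.n≤1+n (κ * p)) (ℕₚ.≤-trans (ℕₚ.≤-reflexive (sym νq≡))
          (ℕₚ.≤-trans (ℕₚ.*-monoˡ-≤ q (ℕₚ.<⇒≤ ν<p)) (ℕₚ.≤-reflexive (ℕₚ.*-comm p q)))))
      go : ∀ ν → ν < p → ∀ z → 1ℤ -ᶻ + q *ᶻ + ν ≡ z *ᶻ + p → Unit
      go ν ν<p (+ zero)  eq = build ν 0 ν<p eq
      go ν ν<p -[1+ k ]  eq = build ν (suc k) ν<p eq
      -- A positive quotient would give `1 = qν + (k + 1)p ≥ p`.
      go ν ν<p (+ suc k) eq = ⊥-elim (ℕₚ.<⇒≱ p≥2 (ℕₚ.≤-trans (ℕₚ.m≤m+n p (k * p))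
        (ℕₚ.≤-trans (ℕₚ.m≤n+m (suc k * p) (q * ν)) (ℕₚ.≤-reflexive (sym one)))))
        where
        one : 1 ≡ q * ν + suc k * p
        one = ℤₚ.+-injective (linear 1ℤ (+ (q * ν) +ᶻ + (suc k * p))
          (1ℤ ⊛ trans (cong (1ℤ -ᶻ_) (ℤₚ.pos-* q ν)) eq ⊞ - 1ℤ ⊛ ℤₚ.pos-* (suc k) p)
          (lem₁ (+ (q * ν)) (+ suc k) (+ p) (+ (suc k * p))))

  open Unit unit public

  -- In the coordinates i ≡ αp + βq (mod pq), the coefficient c i is [α < μ] + [β < ν] − 1.
  data View (i α β : ℕ) : Set where
    low    : α < μ → β < ν → i ≡ α * p + β * q → c (+ i) ≡ 1ℤ → View i α β
    high   : μ ≤ α → ν ≤ β → i + p * q ≡ α * p + β * q → c (+ i) ≡ - 1ℤ → View i α β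
    mixed₁ : α < μ → ν ≤ β → c (+ i) ≡ 0ℤ → View i α β
    mixed₂ : μ ≤ α → β < ν → c (+ i) ≡ 0ℤ → View i α β

  private
    relation : + μ *ᶻ + p +ᶻ + ν *ᶻ + q ≡ + p *ᶻ + q +ᶻ 1ℤ
    relation = trans (sym (cong₂ _+ᶻ_ (ℤₚ.pos-* μ p) (ℤₚ.pos-* ν q)))
      (trans (cong +_ μp+νq≡) (cong (_+ᶻ 1ℤ) (ℤₚ.pos-* p q)))

    castᶻ : ∀ {i α β} → i ≡ α * p + β * q → + i ≡ + α *ᶻ + p +ᶻ + β *ᶻ + q
    castᶻ {i} {α} {β} eq = trans (cong +_ eq) (cong₂ _+ᶻ_ (ℤₚ.pos-* α p) (ℤₚ.pos-* β q))

    castᶻ′ : ∀ {i α β} → i + p * q ≡ α * p + β * q → + i +ᶻ + p *ᶻ + q ≡ + α *ᶻ + p +ᶻ + β *ᶻ + q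
    castᶻ′ {i} {α} {β} eq = trans (cong (+ i +ᶻ_) (sym (ℤₚ.pos-* p q)))
      (trans (cong +_ eq) (cong₂ _+ᶻ_ (ℤₚ.pos-* α p) (ℤₚ.pos-* β q)))

    pos₁ : ∀ (a b : ℕ) {d : ℕ} → a + b ≡ d → + a +ᶻ + b ≡ + d
    pos₁ _ _ e = cong (λ z → + z) e

    pos₂ : ∀ (a b d e : ℕ) → a + b ≡ d + e → + a +ᶻ + b ≡ + d +ᶻ + e
    pos₂ _ _ _ _ e = cong (λ z → + z) e

    wrap : ∀ β → β < ν → Σ ℕ λ β′ → β′ < p × β′ + ν ≡ β + p
    wrap β β<ν = β + (p ∸ ν) , ℕₚ.+-cancelʳ-< ν (β + (p ∸ ν)) p
        (subst₂ _<_ (sym eq) (ℕₚ.+-comm ν p) (ℕₚ.+-monoˡ-< p β<ν)) , eq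
      where
      eq : β + (p ∸ ν) + ν ≡ β + p
      eq = trans (ℕₚ.+-assoc β (p ∸ ν) ν) (cong (λ x → β + x) (ℕₚ.m∸n+n≡m (ℕₚ.<⇒≤ ν<p)))

    gap : ∀ {a b} → a < b → Σ ℕ λ m → a + suc m ≡ b
    gap {a} {b} a<b = b ∸ suc a , trans (ℕₚ.+-suc a (b ∸ suc a)) (ℕₚ.m+[n∸m]≡n a<b)

    diff : ∀ {a b} → a ≤ b → Σ ℕ λ m → a + m ≡ b
    diff {a} {b} a≤b = b ∸ a , ℕₚ.m+[n∸m]≡n a≤b

    -- Here `B i = 1` and `i − 1 = (α − μ)p + (β − ν)q + pq`. The summand `pq` raises the
    -- `β`-coordinate by `p` if `β < ν` and the `α`-coordinate by `q` otherwise; the sign of the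
    -- remaining multiple of `p` is then `B (i − 1)`. Both coordinates large is impossible, since
    -- then `i ≥ μp + νq > pq`.
    view₀ : ∀ i α β → i < p * q → α < q → β < p → i ≡ α * p + β * q → View i α β
    view₀ i α β i<pq α<q β<p eq = go (β ℕ.<? ν) (α ℕ.<? μ)
      where
      eqᶻ = castᶻ {i} {α} {β} eq
      lem₁ : ∀ i a p b q → i -ᶻ (b *ᶻ q +ᶻ a *ᶻ p) ≡ 1ℤ *ᶻ (i -ᶻ (a *ᶻ p +ᶻ b *ᶻ q))
      lem₁ = solve-∀
      Bi : B (+ i) ≡ 1ℤ
      Bi = B-one β α (+ i) β<p (linear (+ i) (+ β *ᶻ + q +ᶻ + α *ᶻ + p) (1ℤ ⊛ eqᶻ) (lem₁ (+ i) (+ α) (+ p) (+ β) (+ q)))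
      lem₂ : ∀ i a p b q b′ m μ ν → i -ᶻ 1ℤ -ᶻ (b′ *ᶻ q -ᶻ m *ᶻ p) ≡
             1ℤ *ᶻ (i -ᶻ (a *ᶻ p +ᶻ b *ᶻ q)) +ᶻ p *ᶻ (a +ᶻ m -ᶻ μ) +ᶻ - q *ᶻ (b′ +ᶻ ν -ᶻ (b +ᶻ p))
             +ᶻ 1ℤ *ᶻ (μ *ᶻ p +ᶻ ν *ᶻ q -ᶻ (p *ᶻ q +ᶻ 1ℤ))
      lem₂ = solve-∀
      lem₃ : ∀ i a p b q b′ m μ ν → i -ᶻ 1ℤ -ᶻ (b′ *ᶻ q +ᶻ m *ᶻ p) ≡
             1ℤ *ᶻ (i -ᶻ (a *ᶻ p +ᶻ b *ᶻ q)) +ᶻ - p *ᶻ (μ +ᶻ m -ᶻ a) +ᶻ - q *ᶻ (b′ +ᶻ ν -ᶻ (b +ᶻ p))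
             +ᶻ 1ℤ *ᶻ (μ *ᶻ p +ᶻ ν *ᶻ q -ᶻ (p *ᶻ q +ᶻ 1ℤ))
      lem₃ = solve-∀
      lem₄ : ∀ i a p b q b′ μ ν κ → i -ᶻ 1ℤ -ᶻ (b′ *ᶻ q +ᶻ (a +ᶻ κ) *ᶻ p) ≡
             1ℤ *ᶻ (i -ᶻ (a *ᶻ p +ᶻ b *ᶻ q)) +ᶻ - p *ᶻ (μ +ᶻ κ -ᶻ q) +ᶻ - q *ᶻ (ν +ᶻ b′ -ᶻ b)
             +ᶻ 1ℤ *ᶻ (μ *ᶻ p +ᶻ ν *ᶻ q -ᶻ (p *ᶻ q +ᶻ 1ℤ))
      lem₄ = solve-∀
      go : Dec (β < ν) → Dec (α < μ) → View i α β
      go (yes β<ν) (yes α<μ) = low α<μ β<ν eq (cong₂ _-ᶻ_ Bi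
        (let β′ , β′<p , eβ = wrap β β<ν
             m , eα = gap α<μ
         in B-zero β′ m (+ i -ᶻ 1ℤ) β′<p (linear (+ i -ᶻ 1ℤ) (+ β′ *ᶻ + q -ᶻ + suc m *ᶻ + p)
              (1ℤ ⊛ eqᶻ ⊞ + p ⊛ pos₁ α (suc m) eα ⊞ - + q ⊛ pos₂ β′ ν β p eβ ⊞ 1ℤ ⊛ relation)
              (lem₂ (+ i) (+ α) (+ p) (+ β) (+ q) (+ β′) (+ suc m) (+ μ) (+ ν)))))
      go (yes β<ν) (no α≮μ) = mixed₂ (ℕₚ.≮⇒≥ α≮μ) β<ν (cong₂ _-ᶻ_ Bi
        (let β′ , β′<p , eβ = wrap β β<ν
             m , eα = diff (ℕₚ.≮⇒≥ α≮μ)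
         in B-one β′ m (+ i -ᶻ 1ℤ) β′<p (linear (+ i -ᶻ 1ℤ) (+ β′ *ᶻ + q +ᶻ + m *ᶻ + p)
              (1ℤ ⊛ eqᶻ ⊞ - + p ⊛ pos₁ μ m eα ⊞ - + q ⊛ pos₂ β′ ν β p eβ ⊞ 1ℤ ⊛ relation)
              (lem₃ (+ i) (+ α) (+ p) (+ β) (+ q) (+ β′) (+ m) (+ μ) (+ ν)))))
      go (no β≮ν) (yes α<μ) = mixed₁ α<μ (ℕₚ.≮⇒≥ β≮ν) (cong₂ _-ᶻ_ Bi
        (let b , eβ = diff (ℕₚ.≮⇒≥ β≮ν)
         in B-one b (α + κ) (+ i -ᶻ 1ℤ) (ℕₚ.≤-<-trans (ℕₚ.≤-trans (ℕₚ.m≤n+m b ν) (ℕₚ.≤-reflexive eβ)) β<p)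
              (linear (+ i -ᶻ 1ℤ) (+ b *ᶻ + q +ᶻ (+ α +ᶻ + κ) *ᶻ + p)
              (1ℤ ⊛ eqᶻ ⊞ - + p ⊛ pos₁ μ κ μ+κ≡q ⊞ - + q ⊛ pos₁ ν b eβ ⊞ 1ℤ ⊛ relation)
              (lem₄ (+ i) (+ α) (+ p) (+ β) (+ q) (+ b) (+ μ) (+ ν) (+ κ)))))
      go (no β≮ν) (no α≮μ) = ⊥-elim (ℕₚ.<⇒≱ i<pq (ℕₚ.≤-trans (ℕₚ.m≤m+n (p * q) 1)
        (ℕₚ.≤-trans (ℕₚ.≤-reflexive (sym μp+νq≡))
        (ℕₚ.≤-trans (ℕₚ.+-mono-≤ (ℕₚ.*-monoˡ-≤ p (ℕₚ.≮⇒≥ α≮μ)) (ℕₚ.*-monoˡ-≤ q (ℕₚ.≮⇒≥ β≮ν)))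
                    (ℕₚ.≤-reflexive (sym eq))))))

    -- Here `i = βq − (q − α)p`, so `B i = 0`, and `i − 1 = (α − μ)p + (β − ν)q`. Both coordinates
    -- small is impossible, since then `αp + βq ≤ μp + νq − p − q < pq`.
    view₁ : ∀ i α β → α < q → β < p → i + p * q ≡ α * p + β * q → View i α β
    view₁ i α β α<q β<p eq = go (β ℕ.<? ν) (α ℕ.<? μ)
      where
      eqᶻ = castᶻ′ {i} {α} {β} eq
      lem₁ : ∀ i a p b q m → i -ᶻ (b *ᶻ q -ᶻ m *ᶻ p) ≡ 1ℤ *ᶻ (i +ᶻ p *ᶻ q -ᶻ (a *ᶻ p +ᶻ b *ᶻ q)) +ᶻ p *ᶻ (a +ᶻ m -ᶻ q)
      lem₁ = solve-∀
      Bi : B (+ i) ≡ 0ℤ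
      Bi = let m , eα = gap α<q in B-zero β m (+ i) β<p (linear (+ i) (+ β *ᶻ + q -ᶻ + suc m *ᶻ + p)
             (1ℤ ⊛ eqᶻ ⊞ + p ⊛ pos₁ α (suc m) eα) (lem₁ (+ i) (+ α) (+ p) (+ β) (+ q) (+ suc m)))
      lem₂ : ∀ i a p b q b′ m μ ν → i -ᶻ 1ℤ -ᶻ (b′ *ᶻ q -ᶻ (m +ᶻ μ) *ᶻ p) ≡
             1ℤ *ᶻ (i +ᶻ p *ᶻ q -ᶻ (a *ᶻ p +ᶻ b *ᶻ q)) +ᶻ p *ᶻ (a +ᶻ m -ᶻ q) +ᶻ - q *ᶻ (b′ +ᶻ ν -ᶻ (b +ᶻ p))
             +ᶻ 1ℤ *ᶻ (μ *ᶻ p +ᶻ ν *ᶻ q -ᶻ (p *ᶻ q +ᶻ 1ℤ))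
      lem₂ = solve-∀
      lem₃ : ∀ i a p b q b′ m μ ν → i -ᶻ 1ℤ -ᶻ (b′ *ᶻ q -ᶻ m *ᶻ p) ≡
             1ℤ *ᶻ (i +ᶻ p *ᶻ q -ᶻ (a *ᶻ p +ᶻ b *ᶻ q)) +ᶻ p *ᶻ (a +ᶻ m -ᶻ μ) +ᶻ - q *ᶻ (ν +ᶻ b′ -ᶻ b)
             +ᶻ 1ℤ *ᶻ (μ *ᶻ p +ᶻ ν *ᶻ q -ᶻ (p *ᶻ q +ᶻ 1ℤ))
      lem₃ = solve-∀
      lem₄ : ∀ i a p b q b′ m μ ν → i -ᶻ 1ℤ -ᶻ (b′ *ᶻ q +ᶻ m *ᶻ p) ≡
             1ℤ *ᶻ (i +ᶻ p *ᶻ q -ᶻ (a *ᶻ p +ᶻ b *ᶻ q)) +ᶻ - p *ᶻ (μ +ᶻ m -ᶻ a) +ᶻ - q *ᶻ (ν +ᶻ b′ -ᶻ b)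
             +ᶻ 1ℤ *ᶻ (μ *ᶻ p +ᶻ ν *ᶻ q -ᶻ (p *ᶻ q +ᶻ 1ℤ))
      lem₄ = solve-∀
      b<p : ∀ {b} → ν + b ≡ β → b < p
      b<p {b} eβ = ℕₚ.≤-<-trans (ℕₚ.≤-trans (ℕₚ.m≤n+m b ν) (ℕₚ.≤-reflexive eβ)) β<p
      go : Dec (β < ν) → Dec (α < μ) → View i α β
      go (yes β<ν) (yes α<μ) = ⊥-elim (ℕₚ.<⇒≱ (ℕₚ.<-≤-trans p≥2 (ℕₚ.m≤m+n p q)) (ℕₚ.+-cancelˡ-≤ (p * q) (p + q) 1
        (ℕₚ.≤-trans (ℕₚ.+-monoˡ-≤ (p + q) (ℕₚ.≤-trans (ℕₚ.m≤n+m (p * q) i) (ℕₚ.≤-reflexive eq)))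
        (ℕₚ.≤-trans (ℕₚ.≤-reflexive (shuffle (α * p) (β * q)))
        (ℕₚ.≤-trans (ℕₚ.+-mono-≤ (ℕₚ.*-monoˡ-≤ p α<μ) (ℕₚ.*-monoˡ-≤ q β<ν)) (ℕₚ.≤-reflexive μp+νq≡))))))
        where
        shuffle : ∀ a b → a + b + (p + q) ≡ p + a + (q + b)
        shuffle a b = trans (ℕₚ.+-comm (a + b) (p + q)) (CS.interchange p q a b)
      go (yes β<ν) (no α≮μ) = mixed₂ (ℕₚ.≮⇒≥ α≮μ) β<ν (cong₂ _-ᶻ_ Bi
        (let β′ , β′<p , eβ = wrap β β<ν
             m , eα = gap α<q
         in B-zero β′ (m + μ) (+ i -ᶻ 1ℤ) β′<p (linear (+ i -ᶻ 1ℤ) (+ β′ *ᶻ + q -ᶻ (+ suc m +ᶻ + μ) *ᶻ + p)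
              (1ℤ ⊛ eqᶻ ⊞ + p ⊛ pos₁ α (suc m) eα ⊞ - + q ⊛ pos₂ β′ ν β p eβ ⊞ 1ℤ ⊛ relation)
              (lem₂ (+ i) (+ α) (+ p) (+ β) (+ q) (+ β′) (+ suc m) (+ μ) (+ ν)))))
      go (no β≮ν) (yes α<μ) = mixed₁ α<μ (ℕₚ.≮⇒≥ β≮ν) (cong₂ _-ᶻ_ Bi
        (let b , eβ = diff (ℕₚ.≮⇒≥ β≮ν)
             m , eα = gap α<μ
         in B-zero b m (+ i -ᶻ 1ℤ) (b<p eβ)
              (linear (+ i -ᶻ 1ℤ) (+ b *ᶻ + q -ᶻ + suc m *ᶻ + p)
              (1ℤ ⊛ eqᶻ ⊞ + p ⊛ pos₁ α (suc m) eα ⊞ - + q ⊛ pos₁ ν b eβ ⊞ 1ℤ ⊛ relation)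
              (lem₃ (+ i) (+ α) (+ p) (+ β) (+ q) (+ b) (+ suc m) (+ μ) (+ ν)))))
      go (no β≮ν) (no α≮μ) = high (ℕₚ.≮⇒≥ α≮μ) (ℕₚ.≮⇒≥ β≮ν) eq (cong₂ _-ᶻ_ Bi
        (let b , eβ = diff (ℕₚ.≮⇒≥ β≮ν)
             m , eα = diff (ℕₚ.≮⇒≥ α≮μ)
         in B-one b m (+ i -ᶻ 1ℤ) (b<p eβ)
              (linear (+ i -ᶻ 1ℤ) (+ b *ᶻ + q +ᶻ + m *ᶻ + p)
              (1ℤ ⊛ eqᶻ ⊞ - + p ⊛ pos₁ μ m eα ⊞ - + q ⊛ pos₁ ν b eβ ⊞ 1ℤ ⊛ relation)
              (lem₄ (+ i) (+ α) (+ p) (+ β) (+ q) (+ b) (+ m) (+ μ) (+ ν)))))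

  -- By the Chinese remainder theorem `i` and `αp + βq` agree mod `pq`; since `αp + βq < 2pq`, they
  -- are equal or differ by exactly `pq`.
  view : ∀ i α β → i < p * q → α < q → β < p →
         + q ∣ᶻ + i -ᶻ + α *ᶻ + p → + p ∣ᶻ + i -ᶻ + β *ᶻ + q → View i α β
  view i α β i<pq α<q β<p q∣ p∣ = go (n ℕ.<? p * q)
    where
    n = α * p + β * q
    n<2pq : n < p * q + p * q
    n<2pq = ℕₚ.<-≤-trans (ℕₚ.+-mono-< (ℕₚ.*-monoˡ-< p α<q) (ℕₚ.*-monoˡ-< q β<p))
                         (ℕₚ.≤-reflexive (cong (_+ p * q) (ℕₚ.*-comm q p)))
    lem₁ : ∀ i a b → i -ᶻ a -ᶻ b ≡ i -ᶻ (a +ᶻ b)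
    lem₁ = solve-∀
    lem₂ : ∀ i a b → i -ᶻ b -ᶻ a ≡ i -ᶻ (a +ᶻ b)
    lem₂ = solve-∀
    eqᶻ : + n ≡ + α *ᶻ + p +ᶻ + β *ᶻ + q
    eqᶻ = castᶻ {n} {α} {β} refl
    pq∣ : + (p * q) ∣ᶻ + i -ᶻ + n
    pq∣ = ∣ᶻ-via (cong (+ i -ᶻ_) (sym eqᶻ)) (∣ᶻ-coprime-* p⊥q
      (∣ᶻ-via (lem₂ (+ i) (+ α *ᶻ + p) (+ β *ᶻ + q)) (∣ᶻ.∣m∣n⇒∣m-n p∣ (divides (+ α) refl)))
      (∣ᶻ-via (lem₁ (+ i) (+ α *ᶻ + p) (+ β *ᶻ + q)) (∣ᶻ.∣m∣n⇒∣m-n q∣ (divides (+ β) refl))))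
    go : Dec (n < p * q) → View i α β
    go (yes n<pq) = view₀ i α β i<pq α<q β<p (∣ᶻ-small i<pq n<pq pq∣)
    go (no n≮pq) = let m , e = diff (ℕₚ.≮⇒≥ n≮pq) in
      view₁ i α β α<q β<p (trans (cong (_+ p * q) (∣ᶻ-small i<pq
        (ℕₚ.+-cancelˡ-< (p * q) m (p * q) (subst (_< p * q + p * q) (sym e) n<2pq))
        (∣ᶻ-via (trans (cong (λ z → + i -ᶻ z +ᶻ + (p * q)) (sym (cong +_ e))) (lem₃ (+ i) (+ (p * q)) (+ m)))
          (∣ᶻ.∣m∣n⇒∣m+n pq∣ ∣ᶻ.∣-refl)))) (trans (ℕₚ.+-comm m (p * q)) e))
      where
      lem₃ : ∀ i x m → i -ᶻ (x +ᶻ m) +ᶻ x ≡ i -ᶻ m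
      lem₃ = solve-∀

  residue-α : ∀ i → Σ ℕ λ α → α < q × + q ∣ᶻ + i -ᶻ + α *ᶻ + p
  residue-α i = let α , α<q , q∣ = solve-mod {p} {q} p⊥q (+ i) in
    α , α<q , ∣ᶻ-via (cong (+ i -ᶻ_) (ℤₚ.*-comm (+ p) (+ α))) q∣

  residue-β : ∀ i → Σ ℕ λ β → β < p × + p ∣ᶻ + i -ᶻ + β *ᶻ + q
  residue-β i = let β , β<p , p∣ = solve-mod {q} {p} q⊥p (+ i) in
    β , β<p , ∣ᶻ-via (cong (+ i -ᶻ_) (ℤₚ.*-comm (+ q) (+ β))) p∣

  -- The bound is `(p − 1)(q − 1)`, the degree of Φ*_{pq}. In the case `low` it comes from
  -- `α + 1 ≤ μ` and `β + 1 ≤ ν`, in the case `high` from `α + 1 ≤ q` and `β + 1 ≤ p`.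
  c-support : ∀ i → c (+ i) ≡ 0ℤ ⊎ i + (p + q) ≤ p * q + 1
  c-support i = go (i ℕ.<? p * q)
    where
    interchange : ∀ a b → a + b + (p + q) ≡ p + a + (q + b)
    interchange a b = trans (ℕₚ.+-comm (a + b) (p + q)) (CS.interchange p q a b)
    cases : ∀ α β → α < q → β < p → View i α β → c (+ i) ≡ 0ℤ ⊎ i + (p + q) ≤ p * q + 1
    cases α β α<q β<p (low α<μ β<ν i≡ _) = inj₂ (ℕₚ.≤-trans (ℕₚ.≤-reflexive (trans (cong (λ x → x + (p + q)) i≡) (interchange (α * p) (β * q))))
      (ℕₚ.≤-trans (ℕₚ.+-mono-≤ (ℕₚ.*-monoˡ-≤ p α<μ) (ℕₚ.*-monoˡ-≤ q β<ν)) (ℕₚ.≤-reflexive μp+νq≡)))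
    cases α β α<q β<p (high _ _ i≡ _) = inj₂ (ℕₚ.≤-trans (ℕₚ.+-cancelˡ-≤ (p * q) (i + (p + q)) (p * q)
      (ℕₚ.≤-trans (ℕₚ.≤-reflexive (trans (sym (ℕₚ.+-assoc (p * q) i (p + q))) (trans (cong (λ x → x + (p + q)) (trans (ℕₚ.+-comm (p * q) i) i≡)) (interchange (α * p) (β * q)))))
      (ℕₚ.≤-trans (ℕₚ.+-mono-≤ (ℕₚ.*-monoˡ-≤ p α<q) (ℕₚ.*-monoˡ-≤ q β<p)) (ℕₚ.≤-reflexive (cong (λ x → x + p * q) (ℕₚ.*-comm q p)))))) (ℕₚ.m≤m+n (p * q) 1))
    cases α β α<q β<p (mixed₁ _ _ ci) = inj₁ ci
    cases α β α<q β<p (mixed₂ _ _ ci) = inj₁ ci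
    go : Dec (i < p * q) → c (+ i) ≡ 0ℤ ⊎ i + (p + q) ≤ p * q + 1
    go (no i≮pq)  = inj₁ (c-large i (ℕₚ.≮⇒≥ i≮pq))
    go (yes i<pq) = let α , α<q , q∣ = residue-α i
                        β , β<p , p∣ = residue-β i
                    in cases α β α<q β<p (view i α β i<pq α<q β<p q∣ p∣)

bit-* : ∀ {x y} → Bit x → Bit y → Bit (x *ᶻ y)
bit-* (inj₁ refl) _           = inj₁ refl
bit-* (inj₂ refl) (inj₁ refl) = inj₁ refl
bit-* (inj₂ refl) (inj₂ refl) = inj₂ refl

bit-complement : ∀ {x} → Bit x → Bit (1ℤ -ᶻ x)
bit-complement (inj₁ refl) = inj₂ refl
bit-complement (inj₂ refl) = inj₁ refl

bit-mix : ∀ {x u v} → Bit x → Bit u → Bit v → Bit (x *ᶻ u +ᶻ (1ℤ -ᶻ x) *ᶻ v)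
bit-mix (inj₁ refl) (inj₁ refl) (inj₁ refl) = inj₁ refl
bit-mix (inj₁ refl) (inj₁ refl) (inj₂ refl) = inj₂ refl
bit-mix (inj₁ refl) (inj₂ refl) (inj₁ refl) = inj₁ refl
bit-mix (inj₁ refl) (inj₂ refl) (inj₂ refl) = inj₂ refl
bit-mix (inj₂ refl) (inj₁ refl) (inj₁ refl) = inj₁ refl
bit-mix (inj₂ refl) (inj₁ refl) (inj₂ refl) = inj₁ refl
bit-mix (inj₂ refl) (inj₂ refl) (inj₁ refl) = inj₂ refl
bit-mix (inj₂ refl) (inj₂ refl) (inj₂ refl) = inj₂ refl

⟦⟧-antitone : {P Q : Set} (d : Dec P) (e : Dec Q) → (Q → P) → Bit (⟦ d ⟧ -ᶻ ⟦ e ⟧)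
⟦⟧-antitone (yes _) (yes _) _ = inj₁ refl
⟦⟧-antitone (yes _) (no _)  _ = inj₂ refl
⟦⟧-antitone (no ¬p) (yes q) f = ⊥-elim (¬p (f q))
⟦⟧-antitone (no _)  (no _)  _ = inj₁ refl

-- Neighbouring ternary coefficients

module Ternary (p q r : ℕ) .{{_ : NonZero p}} .{{_ : NonZero q}} (p≥2 : 2 ≤ p) (p⊥q : Coprime p q) (r⊥pq : Coprime r (p * q)) where
  open Binary p q p≥2 p⊥q
  private
    instance
      pq≢0 : NonZero (p * q)
      pq≢0 = ℕₚ.m*n≢0 p q

  -- As `r` is invertible mod `pq`, exactly one `i < pq` has `ri ≡ t`. So `T N t` is really one
  -- number: `c i` if `i < N`, and 0 otherwise.
  T : ℕ → ℤ → ℤ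
  T N t = ∑ N λ i → c (+ i) *ᶻ multiple (p * q) (t -ᶻ + r *ᶻ + i)

  private
    Index : ℤ → ℕ → Set
    Index t i = i < p * q × + (p * q) ∣ᶻ t -ᶻ + r *ᶻ + i

    r-cancel : ∀ {m} {u : ℤ} → Coprime r m → + m ∣ᶻ + r *ᶻ u → + m ∣ᶻ u
    r-cancel {m} {u} r⊥m = coprime-∣ᶻ {m} {r} {u} (λ (d∣m , d∣r) → r⊥m (d∣r , d∣m))

    T-index : ∀ N t i → Index t i → T N t ≡ c (+ i) *ᶻ ⟦ i ℕ.<? N ⟧
    T-index N t i (i<pq , pq∣) = go (i ℕ.<? N)
      where
      lem : ∀ t r i j → t -ᶻ r *ᶻ j -ᶻ (t -ᶻ r *ᶻ i) ≡ r *ᶻ (i -ᶻ j)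
      lem = solve-∀
      others : ∀ j → j ≢ i → c (+ j) *ᶻ multiple (p * q) (t -ᶻ + r *ᶻ + j) ≡ 0ℤ
      others j j≢i = far (j ℕ.<? p * q)
        where
        far : Dec (j < p * q) → c (+ j) *ᶻ multiple (p * q) (t -ᶻ + r *ᶻ + j) ≡ 0ℤ
        far (yes j<pq) = trans (cong (c (+ j) *ᶻ_) (⟦⟧-no (+ (p * q) ∣ᶻ? t -ᶻ + r *ᶻ + j) λ pq∣j → j≢i (sym (∣ᶻ-small i<pq j<pq
          (r-cancel {p * q} {+ i -ᶻ + j} r⊥pq (∣ᶻ-via (lem t (+ r) (+ i) (+ j)) (∣ᶻ.∣m∣n⇒∣m-n pq∣j pq∣)))))))
          (ℤₚ.*-zeroʳ (c (+ j)))
        far (no j≮pq) = trans (cong (_*ᶻ multiple (p * q) (t -ᶻ + r *ᶻ + j)) (c-large j (ℕₚ.≮⇒≥ j≮pq)))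
                              (ℤₚ.*-zeroˡ (multiple (p * q) (t -ᶻ + r *ᶻ + j)))
      go : (d : Dec (i < N)) → T N t ≡ c (+ i) *ᶻ ⟦ d ⟧
      go (yes i<N) = trans (∑-single N i i<N λ j _ → others j)
                           (cong (c (+ i) *ᶻ_) (⟦⟧-yes (+ (p * q) ∣ᶻ? t -ᶻ + r *ᶻ + i) pq∣))
      go (no i≮N)  = trans (∑-zero N λ j j<N → others j λ { refl → i≮N j<N }) (sym (ℤₚ.*-zeroʳ (c (+ i))))

    rect : ℤ → ℤ → ℤ → ℤ → ℤ
    rect x y u v = x *ᶻ y *ᶻ u -ᶻ (1ℤ -ᶻ x) *ᶻ (1ℤ -ᶻ y) *ᶻ v

    -- The truncated coefficient as a function of the coordinates alone. Where `c i = 1` one has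
    -- `i = αp + βq`; where `c i = −1` one has `i = αp + βq − pq`, so the cutoff `i < N` turns into
    -- `αp + βq < N + pq`.
    τ : ℕ → ℕ → ℕ → ℤ
    τ N α β = rect ⟦ α ℕ.<? μ ⟧ ⟦ β ℕ.<? ν ⟧ ⟦ α * p + β * q ℕ.<? N ⟧ ⟦ α * p + β * q ℕ.<? N + p * q ⟧

    rect₁₁ : ∀ u v → 1ℤ *ᶻ 1ℤ *ᶻ u -ᶻ 0ℤ *ᶻ 0ℤ *ᶻ v ≡ 1ℤ *ᶻ u
    rect₁₁ = solve-∀
    rect₀₀ : ∀ u v → 0ℤ *ᶻ 0ℤ *ᶻ u -ᶻ 1ℤ *ᶻ 1ℤ *ᶻ v ≡ - 1ℤ *ᶻ v
    rect₀₀ = solve-∀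
    rect₁₀ : ∀ u v → 1ℤ *ᶻ 0ℤ *ᶻ u -ᶻ 0ℤ *ᶻ 1ℤ *ᶻ v ≡ 0ℤ
    rect₁₀ = solve-∀
    rect₀₁ : ∀ u v → 0ℤ *ᶻ 1ℤ *ᶻ u -ᶻ 1ℤ *ᶻ 0ℤ *ᶻ v ≡ 0ℤ
    rect₀₁ = solve-∀
    rect₁ : ∀ y u v → 1ℤ *ᶻ y *ᶻ u -ᶻ 0ℤ *ᶻ (1ℤ -ᶻ y) *ᶻ v ≡ y *ᶻ u
    rect₁ = solve-∀
    rect₀ : ∀ y u v → 0ℤ *ᶻ y *ᶻ u -ᶻ 1ℤ *ᶻ (1ℤ -ᶻ y) *ᶻ v ≡ - ((1ℤ -ᶻ y) *ᶻ v)
    rect₀ = solve-∀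

    τ-view : ∀ N i α β → View i α β → c (+ i) *ᶻ ⟦ i ℕ.<? N ⟧ ≡ τ N α β
    τ-view N i α β = go
      where
      u = ⟦ α * p + β * q ℕ.<? N ⟧
      v = ⟦ α * p + β * q ℕ.<? N + p * q ⟧
      at : ∀ {x y} → ⟦ α ℕ.<? μ ⟧ ≡ x → ⟦ β ℕ.<? ν ⟧ ≡ y → rect x y u v ≡ τ N α β
      at ex ey = sym (cong₂ (λ x y → rect x y u v) ex ey)
      go : View i α β → c (+ i) *ᶻ ⟦ i ℕ.<? N ⟧ ≡ τ N α β
      go (low α<μ β<ν i≡ ci) = trans (cong₂ _*ᶻ_ ci (⟦⟧-cong (i ℕ.<? N) (α * p + β * q ℕ.<? N) (subst (_< N) i≡) (subst (_< N) (sym i≡))))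
        (trans (sym (rect₁₁ u v)) (at (⟦⟧-yes (α ℕ.<? μ) α<μ) (⟦⟧-yes (β ℕ.<? ν) β<ν)))
      go (high μ≤α ν≤β i≡ ci) = trans (cong₂ _*ᶻ_ ci (⟦⟧-cong (i ℕ.<? N) (α * p + β * q ℕ.<? N + p * q)
          (λ i<N → subst (_< N + p * q) i≡ (ℕₚ.+-monoˡ-< (p * q) i<N))
          (λ n< → ℕₚ.+-cancelʳ-< (p * q) i N (subst (_< N + p * q) (sym i≡) n<))))
        (trans (sym (rect₀₀ u v)) (at (⟦⟧-no (α ℕ.<? μ) (ℕₚ.≤⇒≯ μ≤α)) (⟦⟧-no (β ℕ.<? ν) (ℕₚ.≤⇒≯ ν≤β))))
      go (mixed₁ α<μ ν≤β ci) = trans (cong (_*ᶻ ⟦ i ℕ.<? N ⟧) ci) (trans (ℤₚ.*-zeroˡ ⟦ i ℕ.<? N ⟧)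
        (trans (sym (rect₁₀ u v)) (at (⟦⟧-yes (α ℕ.<? μ) α<μ) (⟦⟧-no (β ℕ.<? ν) (ℕₚ.≤⇒≯ ν≤β)))))
      go (mixed₂ μ≤α β<ν ci) = trans (cong (_*ᶻ ⟦ i ℕ.<? N ⟧) ci) (trans (ℤₚ.*-zeroˡ ⟦ i ℕ.<? N ⟧)
        (trans (sym (rect₀₁ u v)) (at (⟦⟧-no (α ℕ.<? μ) (ℕₚ.≤⇒≯ μ≤α)) (⟦⟧-yes (β ℕ.<? ν) β<ν))))

    c-view : ∀ i α β → View i α β → c (+ i) ≡ ⟦ α ℕ.<? μ ⟧ +ᶻ ⟦ β ℕ.<? ν ⟧ -ᶻ 1ℤ
    c-view i α β = go
      where
      at : ∀ {x y} → ⟦ α ℕ.<? μ ⟧ ≡ x → ⟦ β ℕ.<? ν ⟧ ≡ y → x +ᶻ y -ᶻ 1ℤ ≡ ⟦ α ℕ.<? μ ⟧ +ᶻ ⟦ β ℕ.<? ν ⟧ -ᶻ 1ℤ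
      at refl refl = refl
      go : View i α β → c (+ i) ≡ ⟦ α ℕ.<? μ ⟧ +ᶻ ⟦ β ℕ.<? ν ⟧ -ᶻ 1ℤ
      go (low α<μ β<ν _ ci)  = trans ci (at (⟦⟧-yes (α ℕ.<? μ) α<μ) (⟦⟧-yes (β ℕ.<? ν) β<ν))
      go (high μ≤α ν≤β _ ci) = trans ci (at (⟦⟧-no (α ℕ.<? μ) (ℕₚ.≤⇒≯ μ≤α)) (⟦⟧-no (β ℕ.<? ν) (ℕₚ.≤⇒≯ ν≤β)))
      go (mixed₁ α<μ ν≤β ci) = trans ci (at (⟦⟧-yes (α ℕ.<? μ) α<μ) (⟦⟧-no (β ℕ.<? ν) (ℕₚ.≤⇒≯ ν≤β)))
      go (mixed₂ μ≤α β<ν ci) = trans ci (at (⟦⟧-no (α ℕ.<? μ) (ℕₚ.≤⇒≯ μ≤α)) (⟦⟧-yes (β ℕ.<? ν) β<ν))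

    -- For fixed α₁ and α₂ the sign of τ N α₁ β − τ N α₂ β does not depend on β.
    τ-columns : ∀ N α₁ α₂ → (∀ β → Bit (τ N α₁ β -ᶻ τ N α₂ β)) ⊎ (∀ β → Bit (τ N α₂ β -ᶻ τ N α₁ β))
    τ-columns N α₁ α₂ = go (α₁ ℕ.<? μ) (α₂ ℕ.<? μ) (ℕₚ.≤-total α₁ α₂)
      where
      U V : ℕ → ℕ → ℤ
      U α β = ⟦ α * p + β * q ℕ.<? N ⟧
      V α β = ⟦ α * p + β * q ℕ.<? N + p * q ⟧
      y : ℕ → ℤ
      y β = ⟦ β ℕ.<? ν ⟧
      y-bit : ∀ β → Bit (y β)
      y-bit β = ⟦⟧-bit (β ℕ.<? ν)
      lo : ∀ α β → α < μ → τ N α β ≡ y β *ᶻ U α β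
      lo α β α<μ = trans (cong (λ x → rect x (y β) (U α β) (V α β)) (⟦⟧-yes (α ℕ.<? μ) α<μ)) (rect₁ (y β) (U α β) (V α β))
      hi : ∀ α β → ¬ (α < μ) → τ N α β ≡ - ((1ℤ -ᶻ y β) *ᶻ V α β)
      hi α β α≮μ = trans (cong (λ x → rect x (y β) (U α β) (V α β)) (⟦⟧-no (α ℕ.<? μ) α≮μ)) (rect₀ (y β) (U α β) (V α β))
      less : ∀ {a b M} β → a ≤ b → b * p + β * q < M → a * p + β * q < M
      less β a≤b = ℕₚ.≤-<-trans (ℕₚ.+-monoˡ-≤ (β * q) (ℕₚ.*-monoˡ-≤ p a≤b))
      lem₁ : ∀ y u v → y *ᶻ (u -ᶻ v) ≡ y *ᶻ u -ᶻ y *ᶻ v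
      lem₁ = solve-∀
      lem₂ : ∀ y u v → y *ᶻ (u -ᶻ v) ≡ - (y *ᶻ v) -ᶻ - (y *ᶻ u)
      lem₂ = solve-∀
      lem₃ : ∀ x y → x +ᶻ y ≡ x -ᶻ - y
      lem₃ = solve-∀
      both-low : ∀ a b → a < μ → b < μ → a ≤ b → ∀ β → Bit (τ N a β -ᶻ τ N b β)
      both-low a b a<μ b<μ a≤b β = subst Bit
        (trans (lem₁ (y β) (U a β) (U b β)) (sym (cong₂ _-ᶻ_ (lo a β a<μ) (lo b β b<μ))))
        (bit-* (y-bit β) (⟦⟧-antitone (a * p + β * q ℕ.<? N) (b * p + β * q ℕ.<? N) (less β a≤b)))
      -- The nonzero values are `−1` here, so raising `α` past the cutoff increases `τ`, opposite to
      -- the case of two low columns.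
      both-high : ∀ a b → ¬ (a < μ) → ¬ (b < μ) → a ≤ b → ∀ β → Bit (τ N b β -ᶻ τ N a β)
      both-high a b a≮μ b≮μ a≤b β = subst Bit
        (trans (lem₂ (1ℤ -ᶻ y β) (V a β) (V b β)) (sym (cong₂ _-ᶻ_ (hi b β b≮μ) (hi a β a≮μ))))
        (bit-* (bit-complement (y-bit β))
          (⟦⟧-antitone (a * p + β * q ℕ.<? N + p * q) (b * p + β * q ℕ.<? N + p * q) (less β a≤b)))
      -- At each `β` at most one of the two values is nonzero: the low one needs `β < ν` and is
      -- nonnegative, the high one needs `β ≥ ν` and is nonpositive.
      low-high : ∀ a b → a < μ → ¬ (b < μ) → ∀ β → Bit (τ N a β -ᶻ τ N b β)
      low-high a b a<μ b≮μ β = subst Bit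
        (trans (lem₃ (y β *ᶻ U a β) ((1ℤ -ᶻ y β) *ᶻ V b β)) (sym (cong₂ _-ᶻ_ (lo a β a<μ) (hi b β b≮μ))))
        (bit-mix (y-bit β) (⟦⟧-bit (a * p + β * q ℕ.<? N)) (⟦⟧-bit (b * p + β * q ℕ.<? N + p * q)))
      go : Dec (α₁ < μ) → Dec (α₂ < μ) → α₁ ≤ α₂ ⊎ α₂ ≤ α₁ →
           (∀ β → Bit (τ N α₁ β -ᶻ τ N α₂ β)) ⊎ (∀ β → Bit (τ N α₂ β -ᶻ τ N α₁ β))
      go (yes l₁) (yes l₂) (inj₁ le) = inj₁ (both-low α₁ α₂ l₁ l₂ le)
      go (yes l₁) (yes l₂) (inj₂ le) = inj₂ (both-low α₂ α₁ l₂ l₁ le)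
      go (yes l₁) (no h₂)  _         = inj₁ (low-high α₁ α₂ l₁ h₂)
      go (no h₁)  (yes l₂) _         = inj₂ (low-high α₂ α₁ l₂ h₁)
      go (no h₁)  (no h₂)  (inj₁ le) = inj₂ (both-high α₁ α₂ h₁ h₂ le)
      go (no h₁)  (no h₂)  (inj₂ le) = inj₁ (both-high α₂ α₁ h₂ h₁ le)

    -- Differences along two rows are bits with a common sign, so subtracting one from the other
    -- stays within one of 0.
    τ-rectangle : ∀ N α₁ α₂ β₁ β₂ → Trit (τ N α₁ β₁ -ᶻ τ N α₂ β₁ -ᶻ (τ N α₁ β₂ -ᶻ τ N α₂ β₂))
    τ-rectangle N α₁ α₂ β₁ β₂ = go (τ-columns N α₁ α₂)
      where
      lem : ∀ a b x y → - (b -ᶻ a -ᶻ (y -ᶻ x)) ≡ a -ᶻ b -ᶻ (x -ᶻ y)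
      lem = solve-∀
      go : _ → Trit (τ N α₁ β₁ -ᶻ τ N α₂ β₁ -ᶻ (τ N α₁ β₂ -ᶻ τ N α₂ β₂))
      go (inj₁ bit) = bit-sub (bit β₁) (bit β₂)
      go (inj₂ bit) = subst Trit (lem (τ N α₁ β₁) (τ N α₂ β₁) (τ N α₁ β₂) (τ N α₂ β₂))
        (trit-neg {τ N α₂ β₁ -ᶻ τ N α₁ β₁ -ᶻ (τ N α₂ β₂ -ᶻ τ N α₁ β₂)} (bit-sub (bit β₁) (bit β₂)))

    At : ℤ → ℕ → ℕ → Set
    At t α β = Σ ℕ λ i → Index t i × View i α β

    T-τ : ∀ N t α β → At t α β → T N t ≡ τ N α β
    T-τ N t α β (i , ix , vw) = trans (T-index N t i ix) (τ-view N i α β vw)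

    T-full : ∀ N t α β → p * q ≤ N → At t α β → T N t ≡ ⟦ α ℕ.<? μ ⟧ +ᶻ ⟦ β ℕ.<? ν ⟧ -ᶻ 1ℤ
    T-full N t α β pq≤N (i , ix@(i<pq , _) , vw) = trans (T-index N t i ix)
      (trans (cong (c (+ i) *ᶻ_) (⟦⟧-yes (i ℕ.<? N) (ℕₚ.<-≤-trans i<pq pq≤N)))
      (trans (ℤₚ.*-identityʳ (c (+ i))) (c-view i α β vw)))

  -- Subtracting `p` from `t` is invisible mod `p` and keeps `β`; subtracting `q` keeps `α`. The
  -- corners `t` and `t − p − q` define the four coordinates, and the two mixed corners inherit one
  -- from each.
  record Rectangle (t : ℤ) : Set where
    field
      α₁ α₂ β₁ β₂ : ℕ
      at₁₁ : At t α₁ β₁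
      at₂₁ : At (t -ᶻ + p) α₂ β₁
      at₁₂ : At (t -ᶻ + q) α₁ β₂
      at₂₂ : At (t -ᶻ + p -ᶻ + q) α₂ β₂

  abstract
    rectangle : ∀ t → Rectangle t
    rectangle t =
      let i₁₁ , ix₁₁ = index t
          i₂₁ , ix₂₁ = index (t -ᶻ + p)
          i₁₂ , ix₁₂ = index (t -ᶻ + q)
          i₂₂ , ix₂₂ = index (t -ᶻ + p -ᶻ + q)
          α₁ , α₁<q , a₁ = residue-α i₁₁
          β₁ , β₁<p , b₁ = residue-β i₁₁
          α₂ , α₂<q , a₂ = residue-α i₂₂
          β₂ , β₂<p , b₂ = residue-β i₂₂
      in record
        { α₁ = α₁ ; α₂ = α₂ ; β₁ = β₁ ; β₂ = β₂
        ; at₁₁ = i₁₁ , ix₁₁ , view i₁₁ α₁ β₁ (proj₁ ix₁₁) α₁<q β₁<p a₁ b₁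
        ; at₂₂ = i₂₂ , ix₂₂ , view i₂₂ α₂ β₂ (proj₁ ix₂₂) α₂<q β₂<p a₂ b₂
        ; at₂₁ = i₂₁ , ix₂₁ , view i₂₁ α₂ β₁ (proj₁ ix₂₁) α₂<q β₁<p
            (transfer q (divides (+ p) (ℤₚ.pos-* p q)) r⊥q (t -ᶻ + p -ᶻ + q) (t -ᶻ + p) i₂₂ i₂₁ (+ α₂ *ᶻ + p) ix₂₂ ix₂₁
              (divides (- 1ℤ) (lem₁ (t -ᶻ + p) (+ q))) a₂)
            (transfer p (divides (+ q) (trans (ℤₚ.pos-* p q) (ℤₚ.*-comm (+ p) (+ q)))) r⊥p t (t -ᶻ + p) i₁₁ i₂₁ (+ β₁ *ᶻ + q) ix₁₁ ix₂₁
              (divides 1ℤ (lem₂ t (+ p))) b₁)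
        ; at₁₂ = i₁₂ , ix₁₂ , view i₁₂ α₁ β₂ (proj₁ ix₁₂) α₁<q β₂<p
            (transfer q (divides (+ p) (ℤₚ.pos-* p q)) r⊥q t (t -ᶻ + q) i₁₁ i₁₂ (+ α₁ *ᶻ + p) ix₁₁ ix₁₂
              (divides 1ℤ (lem₂ t (+ q))) a₁)
            (transfer p (divides (+ q) (trans (ℤₚ.pos-* p q) (ℤₚ.*-comm (+ p) (+ q)))) r⊥p (t -ᶻ + p -ᶻ + q) (t -ᶻ + q) i₂₂ i₁₂ (+ β₂ *ᶻ + q) ix₂₂ ix₁₂
              (divides (- 1ℤ) (lem₃ t (+ p) (+ q))) b₂)
        }
      where
      lem₁ : ∀ t q → t -ᶻ q -ᶻ t ≡ - 1ℤ *ᶻ q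
      lem₁ = solve-∀
      lem₂ : ∀ t q → t -ᶻ (t -ᶻ q) ≡ 1ℤ *ᶻ q
      lem₂ = solve-∀
      lem₃ : ∀ t p q → t -ᶻ p -ᶻ q -ᶻ (t -ᶻ q) ≡ - 1ℤ *ᶻ p
      lem₃ = solve-∀
      r⊥p : Coprime r p
      r⊥p (d∣r , d∣p) = r⊥pq (d∣r , ℕ∣.∣-trans d∣p (ℕ∣.m∣m*n q))
      r⊥q : Coprime r q
      r⊥q (d∣r , d∣q) = r⊥pq (d∣r , ℕ∣.∣-trans d∣q (ℕ∣.n∣m*n p))
      index : ∀ t → Σ ℕ (Index t)
      index t = solve-mod {r} {p * q} r⊥pq t
      transfer : ∀ m → + m ∣ᶻ + (p * q) → Coprime r m → ∀ t t′ i j e → Index t i → Index t′ j →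
                 + m ∣ᶻ t -ᶻ t′ → + m ∣ᶻ + i -ᶻ e → + m ∣ᶻ + j -ᶻ e
      transfer m m∣pq r⊥m t t′ i j e (_ , pq∣i) (_ , pq∣j) m∣t m∣i = ∣ᶻ-via (lem₅ (+ i) (+ j) e)
        (∣ᶻ.∣m∣n⇒∣m-n {+ m} {+ i -ᶻ e} {+ i -ᶻ + j} m∣i (r-cancel {m} {+ i -ᶻ + j} r⊥m (∣ᶻ-via (lem₄ t t′ (+ r) (+ i) (+ j))
          (∣ᶻ.∣m∣n⇒∣m-n {+ m} {t -ᶻ t′} {t -ᶻ + r *ᶻ + i -ᶻ (t′ -ᶻ + r *ᶻ + j)} m∣t (∣ᶻ.∣m∣n⇒∣m-n {+ m} {t -ᶻ + r *ᶻ + i} {t′ -ᶻ + r *ᶻ + j} (∣ᶻ.∣-trans m∣pq pq∣i) (∣ᶻ.∣-trans m∣pq pq∣j))))))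
        where
        lem₄ : ∀ t t′ r i j → t -ᶻ t′ -ᶻ (t -ᶻ r *ᶻ i -ᶻ (t′ -ᶻ r *ᶻ j)) ≡ r *ᶻ (i -ᶻ j)
        lem₄ = solve-∀
        lem₅ : ∀ i j e → i -ᶻ e -ᶻ (i -ᶻ j) ≡ j -ᶻ e
        lem₅ = solve-∀

  T-square : ℕ → ℤ → ℤ
  T-square N t = T N t -ᶻ T N (t -ᶻ + p) -ᶻ (T N (t -ᶻ + q) -ᶻ T N (t -ᶻ + p -ᶻ + q))

  T-square-trit : ∀ N t → Trit (T-square N t)
  T-square-trit N t = subst Trit (sym (cong₂ _-ᶻ_
      (cong₂ _-ᶻ_ (T-τ N t α₁ β₁ at₁₁) (T-τ N (t -ᶻ + p) α₂ β₁ at₂₁))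
      (cong₂ _-ᶻ_ (T-τ N (t -ᶻ + q) α₁ β₂ at₁₂) (T-τ N (t -ᶻ + p -ᶻ + q) α₂ β₂ at₂₂))))
    (τ-rectangle N α₁ α₂ β₁ β₂)
    where open Rectangle (rectangle t)

  -- Without cutoff `T` is a function of `α` plus a function of `β`, and the alternating sum of such
  -- a function over a rectangle is 0.
  T-square-full : ∀ N t → p * q ≤ N → T-square N t ≡ 0ℤ
  T-square-full N t pq≤N = trans (cong₂ _-ᶻ_
      (cong₂ _-ᶻ_ (T-full N t α₁ β₁ pq≤N at₁₁) (T-full N (t -ᶻ + p) α₂ β₁ pq≤N at₂₁))
      (cong₂ _-ᶻ_ (T-full N (t -ᶻ + q) α₁ β₂ pq≤N at₁₂) (T-full N (t -ᶻ + p -ᶻ + q) α₂ β₂ pq≤N at₂₂)))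
    (lem ⟦ α₁ ℕ.<? μ ⟧ ⟦ α₂ ℕ.<? μ ⟧ ⟦ β₁ ℕ.<? ν ⟧ ⟦ β₂ ℕ.<? ν ⟧)
    where
    open Rectangle (rectangle t)
    lem : ∀ a b x y → a +ᶻ x -ᶻ 1ℤ -ᶻ (b +ᶻ x -ᶻ 1ℤ) -ᶻ (a +ᶻ y -ᶻ 1ℤ -ᶻ (b +ᶻ y -ᶻ 1ℤ)) ≡ 0ℤ
    lem = solve-∀

-- The periodic window and the truncated sums.

∑-const : ∀ n x → ∑ n (λ _ → x) ≡ + n *ᶻ x
∑-const zero    x = refl
∑-const (suc n) x = trans (cong (_+ᶻ x) (∑-const n x)) (lem (+ n) x)
  where
  lem : ∀ n x → n *ᶻ x +ᶻ x ≡ (1ℤ +ᶻ n) *ᶻ x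
  lem = solve-∀

sub-pos : ∀ n r i u → r * i + u ≡ n → + n -ᶻ + r *ᶻ + i ≡ + u
sub-pos n r i u eq = linear (+ n -ᶻ + r *ᶻ + i) (+ u) (- 1ℤ ⊛ cast ⊞ 1ℤ ⊛ ℤₚ.pos-* r i) (lem (+ n) (+ r *ᶻ + i) (+ u) (+ (r * i)))
  where
  cast : + (r * i) +ᶻ + u ≡ + n
  cast = cong (λ z → + z) eq
  lem : ∀ n ri u x → n -ᶻ ri -ᶻ u ≡ - 1ℤ *ᶻ (x +ᶻ u -ᶻ n) +ᶻ 1ℤ *ᶻ (x -ᶻ ri)
  lem = solve-∀

sub-neg : ∀ n r i u → n + u ≡ r * i → + n -ᶻ + r *ᶻ + i ≡ - + u
sub-neg n r i u eq = linear (+ n -ᶻ + r *ᶻ + i) (- + u) (1ℤ ⊛ cast ⊞ 1ℤ ⊛ ℤₚ.pos-* r i) (lem (+ n) (+ r *ᶻ + i) (+ u) (+ (r * i)))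
  where
  cast : + n +ᶻ + u ≡ + (r * i)
  cast = cong (λ z → + z) eq
  lem : ∀ n ri u x → n -ᶻ ri -ᶻ - u ≡ 1ℤ *ᶻ (n +ᶻ u -ᶻ x) +ᶻ 1ℤ *ᶻ (x -ᶻ ri)
  lem = solve-∀

floor-unique : ∀ n r K .{{_ : NonZero r}} → r * K ≤ n → n < r * suc K → n DM./ r ≡ K
floor-unique n r K rK≤n n<rK = ℕₚ.≤-antisym
  (ℕₚ.≤-pred (DM.m<n*o⇒m/o<n (subst (n <_) (ℕₚ.*-comm r (suc K)) n<rK)))
  (subst (_≤ n DM./ r) (DM.m*n/n≡m K r) (DM./-monoˡ-≤ r (subst (_≤ n) (ℕₚ.*-comm r K) rK≤n)))

floor-≤ : ∀ n r .{{_ : NonZero r}} → r * (n DM./ r) ≤ n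
floor-≤ n r = subst (_≤ n) (ℕₚ.*-comm (n DM./ r) r) (DM.m/n*n≤m n r)

floor-< : ∀ n r .{{_ : NonZero r}} → n < r * suc (n DM./ r)
floor-< n r = ℕₚ.<-≤-trans (subst (_< r + n DM./ r * r) (sym (DM.m≡m%n+[m/n]*n n r)) (ℕₚ.+-monoˡ-< (n DM./ r * r) (DM.m%n<n n r)))
  (ℕₚ.≤-reflexive (trans (cong (λ x → r + x) (ℕₚ.*-comm (n DM./ r) r)) (sym (ℕₚ.*-suc r (n DM./ r)))))

module Window (p q : ℕ) .{{_ : NonZero p}} .{{_ : NonZero q}} (p≥2 : 2 ≤ p) (p<q : p < q) (p⊥q : Coprime p q) where
  open Binary p q p≥2 p⊥q

  p+q<pq : p + q < p * q
  p+q<pq = ℕₚ.<-≤-trans (ℕₚ.+-monoˡ-< q p<q) (ℕₚ.≤-trans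
    (ℕₚ.≤-reflexive (cong (λ x → q + x) (sym (ℕₚ.+-identityʳ q)))) (ℕₚ.*-monoˡ-≤ q p≥2))

  q<pq : q < p * q
  q<pq = ℕₚ.≤-<-trans (ℕₚ.m≤n+m q p) p+q<pq

  D W₁ W : ℤ → ℤ
  D u  = multiple (p * q) u
  W₁ u = ∑ p λ j → D (u -ᶻ + j)
  W u  = W₁ u -ᶻ W₁ (u -ᶻ + q)

  W₁-cong : ∀ u v → + (p * q) ∣ᶻ u -ᶻ v → W₁ u ≡ W₁ v
  W₁-cong u v pq∣ = ∑-cong p λ j _ → multiple-cong (p * q) (u -ᶻ + j) (v -ᶻ + j) (∣ᶻ-via (lem u v (+ j)) pq∣)
    where
    lem : ∀ u v j → u -ᶻ v ≡ u -ᶻ j -ᶻ (v -ᶻ j)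
    lem = solve-∀

  W-cong : ∀ u v → + (p * q) ∣ᶻ u -ᶻ v → W u ≡ W v
  W-cong u v pq∣ = cong₂ _-ᶻ_ (W₁-cong u v pq∣) (W₁-cong (u -ᶻ + q) (v -ᶻ + q) (∣ᶻ-via (lem u v (+ q)) pq∣))
    where
    lem : ∀ u v j → u -ᶻ v ≡ u -ᶻ j -ᶻ (v -ᶻ j)
    lem = solve-∀

  private
    W₁-step : ∀ u → W₁ u -ᶻ W₁ (u -ᶻ 1ℤ) ≡ D u -ᶻ D (u -ᶻ + p)
    W₁-step u = begin
      W₁ u -ᶻ W₁ (u -ᶻ 1ℤ)                                      ≡⟨ ∑-sub p (λ j → D (u -ᶻ + j)) (λ j → D (u -ᶻ 1ℤ -ᶻ + j)) ⟨
      ∑ p (λ j → D (u -ᶻ + j) -ᶻ D (u -ᶻ 1ℤ -ᶻ + j))            ≡⟨ ∑-cong p (λ j _ → lem₁ (D (u -ᶻ + j)) (D (u -ᶻ 1ℤ -ᶻ + j)) (D (u -ᶻ + suc j)) (cong D (lem₂ u (+ j)))) ⟩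
      ∑ p (λ j → - D (u -ᶻ + suc j) -ᶻ - D (u -ᶻ + j))          ≡⟨ ∑-telescope p (λ j → - D (u -ᶻ + j)) ⟩
      - D (u -ᶻ + p) -ᶻ - D (u -ᶻ + 0)                          ≡⟨ lem₃ (D (u -ᶻ + p)) (D (u -ᶻ + 0)) ⟩
      D (u -ᶻ + 0) -ᶻ D (u -ᶻ + p)                              ≡⟨ cong (λ z → D z -ᶻ D (u -ᶻ + p)) (ℤₚ.+-identityʳ u) ⟩
      D u -ᶻ D (u -ᶻ + p)                                       ∎
      where
      lem₀ : ∀ a b → a -ᶻ b ≡ - b -ᶻ - a
      lem₀ = solve-∀
      lem₁ : ∀ a b x → b ≡ x → a -ᶻ b ≡ - x -ᶻ - a
      lem₁ a b .b refl = lem₀ a b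
      lem₂ : ∀ u j → u -ᶻ 1ℤ -ᶻ j ≡ u -ᶻ (1ℤ +ᶻ j)
      lem₂ = solve-∀
      lem₃ : ∀ a b → - a -ᶻ - b ≡ b -ᶻ a
      lem₃ = solve-∀

  -- This is `(1 − x)W = (1 − x^p)(1 − x^q)D`: each block of `p` consecutive shifts of `D`
  -- telescopes.
  W-step : ∀ u → W u -ᶻ W (u -ᶻ 1ℤ) ≡ D u -ᶻ D (u -ᶻ + p) -ᶻ (D (u -ᶻ + q) -ᶻ D (u -ᶻ + p -ᶻ + q))
  W-step u = begin
    W₁ u -ᶻ W₁ (u -ᶻ + q) -ᶻ (W₁ (u -ᶻ 1ℤ) -ᶻ W₁ (u -ᶻ 1ℤ -ᶻ + q))   ≡⟨ lem₁ (W₁ u) (W₁ (u -ᶻ + q)) (W₁ (u -ᶻ 1ℤ)) (W₁ (u -ᶻ 1ℤ -ᶻ + q)) ⟩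
    W₁ u -ᶻ W₁ (u -ᶻ 1ℤ) -ᶻ (W₁ (u -ᶻ + q) -ᶻ W₁ (u -ᶻ 1ℤ -ᶻ + q))   ≡⟨ cong (λ z → W₁ u -ᶻ W₁ (u -ᶻ 1ℤ) -ᶻ (W₁ (u -ᶻ + q) -ᶻ W₁ z)) (lem₂ u 1ℤ (+ q)) ⟩
    W₁ u -ᶻ W₁ (u -ᶻ 1ℤ) -ᶻ (W₁ (u -ᶻ + q) -ᶻ W₁ (u -ᶻ + q -ᶻ 1ℤ))   ≡⟨ cong₂ _-ᶻ_ (W₁-step u) (W₁-step (u -ᶻ + q)) ⟩
    D u -ᶻ D (u -ᶻ + p) -ᶻ (D (u -ᶻ + q) -ᶻ D (u -ᶻ + q -ᶻ + p))     ≡⟨ cong (λ z → D u -ᶻ D (u -ᶻ + p) -ᶻ (D (u -ᶻ + q) -ᶻ D z)) (lem₂ u (+ q) (+ p)) ⟩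
    D u -ᶻ D (u -ᶻ + p) -ᶻ (D (u -ᶻ + q) -ᶻ D (u -ᶻ + p -ᶻ + q))     ∎
    where
    lem₁ : ∀ a b x y → a -ᶻ b -ᶻ (x -ᶻ y) ≡ a -ᶻ x -ᶻ (b -ᶻ y)
    lem₁ = solve-∀
    lem₂ : ∀ u a b → u -ᶻ a -ᶻ b ≡ u -ᶻ b -ᶻ a
    lem₂ = solve-∀

  private
    D-even : ∀ u → D (- u) ≡ D u
    D-even u = ⟦⟧-cong (+ (p * q) ∣ᶻ? - u) (+ (p * q) ∣ᶻ? u) (λ d → ∣ᶻ-via (ℤₚ.neg-involutive u) (∣ᶻ.∣m⇒∣-m d)) ∣ᶻ.∣m⇒∣-m

    W₁-reflect : ∀ u → W₁ (+ p -ᶻ 1ℤ -ᶻ u) ≡ W₁ u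
    W₁-reflect u = trans (∑-reverse p (λ j → D (+ p -ᶻ 1ℤ -ᶻ u -ᶻ + j)))
      (∑-cong p λ j j<p → trans (cong D (point j j<p)) (D-even (u -ᶻ + j)))
      where
      lem : ∀ p u j x → p -ᶻ 1ℤ -ᶻ u -ᶻ x -ᶻ - (u -ᶻ j) ≡ - 1ℤ *ᶻ (x +ᶻ (1ℤ +ᶻ j) -ᶻ p)
      lem = solve-∀
      point : ∀ j → j < p → + p -ᶻ 1ℤ -ᶻ u -ᶻ + (p ∸ suc j) ≡ - (u -ᶻ + j)
      point j j<p = linear (+ p -ᶻ 1ℤ -ᶻ u -ᶻ + (p ∸ suc j)) (- (u -ᶻ + j)) (- 1ℤ ⊛ cast) (lem (+ p) u (+ j) (+ (p ∸ suc j)))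
        where
        cast : + (p ∸ suc j) +ᶻ (1ℤ +ᶻ + j) ≡ + p
        cast = cong (λ z → + z) (ℕₚ.m∸n+n≡m j<p)

  -- Reflecting a window of length p + q exchanges its positive and its negative block.
  W-reflect : ∀ u → W (+ p +ᶻ + q -ᶻ 1ℤ -ᶻ u) ≡ - W u
  W-reflect u = begin
    W₁ (+ p +ᶻ + q -ᶻ 1ℤ -ᶻ u) -ᶻ W₁ (+ p +ᶻ + q -ᶻ 1ℤ -ᶻ u -ᶻ + q)
      ≡⟨ cong₂ (λ y z → W₁ y -ᶻ W₁ z) (lem₁ (+ p) (+ q) u) (lem₂ (+ p) (+ q) u) ⟩
    W₁ (+ p -ᶻ 1ℤ -ᶻ (u -ᶻ + q)) -ᶻ W₁ (+ p -ᶻ 1ℤ -ᶻ u)   ≡⟨ cong₂ _-ᶻ_ (W₁-reflect (u -ᶻ + q)) (W₁-reflect u) ⟩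
    W₁ (u -ᶻ + q) -ᶻ W₁ u                                 ≡⟨ lem₃ (W₁ (u -ᶻ + q)) (W₁ u) ⟩
    - (W₁ u -ᶻ W₁ (u -ᶻ + q))                             ∎
    where
    lem₁ : ∀ p q u → p +ᶻ q -ᶻ 1ℤ -ᶻ u ≡ p -ᶻ 1ℤ -ᶻ (u -ᶻ q)
    lem₁ = solve-∀
    lem₂ : ∀ p q u → p +ᶻ q -ᶻ 1ℤ -ᶻ u -ᶻ q ≡ p -ᶻ 1ℤ -ᶻ u
    lem₂ = solve-∀
    lem₃ : ∀ a b → a -ᶻ b ≡ - (b -ᶻ a)
    lem₃ = solve-∀

  private
    p<pq : p < p * q
    p<pq = ℕₚ.<-trans p<q q<pq

    W₁-val : ∀ k → k < p * q → W₁ (+ k) ≡ ⟦ k ℕ.<? p ⟧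
    W₁-val k k<pq = go (k ℕ.<? p)
      where
      others : ∀ j → j < p → j ≢ k → D (+ k -ᶻ + j) ≡ 0ℤ
      others j j<p j≢k = ⟦⟧-no (+ (p * q) ∣ᶻ? + k -ᶻ + j) λ d → j≢k (sym (∣ᶻ-small k<pq (ℕₚ.<-trans j<p p<pq) d))
      go : (d : Dec (k < p)) → W₁ (+ k) ≡ ⟦ d ⟧
      go (yes k<p) = trans (∑-single p k k<p others)
        (⟦⟧-yes (+ (p * q) ∣ᶻ? + k -ᶻ + k) (divides 0ℤ (ℤₚ.+-inverseʳ (+ k))))
      go (no k≮p)  = ∑-zero p λ j j<p → others j j<p λ { refl → k≮p j<p }

  W-left : ∀ k → k < q → W (+ k) ≡ ⟦ k ℕ.<? p ⟧
  W-left k k<q = trans (cong₂ _-ᶻ_ (W₁-val k (ℕₚ.<-trans k<q q<pq)) zero′) (ℤₚ.+-identityʳ ⟦ k ℕ.<? p ⟧)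
    where
    m = k + (p * q ∸ q)
    m+q : m + q ≡ k + p * q
    m+q = trans (ℕₚ.+-assoc k (p * q ∸ q) q) (cong (λ x → k + x) (ℕₚ.m∸n+n≡m (ℕₚ.<⇒≤ q<pq)))
    cast : + m +ᶻ + q ≡ + k +ᶻ + (p * q)
    cast = cong (λ z → + z) m+q
    m<pq : m < p * q
    m<pq = ℕₚ.+-cancelʳ-< q m (p * q) (ℕₚ.<-≤-trans (subst (_< q + p * q) (sym m+q) (ℕₚ.+-monoˡ-< (p * q) k<q))
             (ℕₚ.≤-reflexive (ℕₚ.+-comm q (p * q))))
    p≤m : p ≤ m
    p≤m = ℕₚ.+-cancelʳ-≤ q p m (ℕₚ.≤-trans (ℕₚ.<⇒≤ p+q<pq) (ℕₚ.≤-trans (ℕₚ.m≤n+m (p * q) k) (ℕₚ.≤-reflexive (sym m+q))))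
    lem : ∀ k q m x → k -ᶻ q -ᶻ m -ᶻ - 1ℤ *ᶻ x ≡ - 1ℤ *ᶻ (m +ᶻ q -ᶻ (k +ᶻ x))
    lem = solve-∀
    -- Mod `pq` the negative argument `k − q` becomes `m = k + pq − q`, which lies in `[p, pq)`
    -- because `p + q < pq`.
    zero′ : W₁ (+ k -ᶻ + q) ≡ 0ℤ
    zero′ = trans (W₁-cong (+ k -ᶻ + q) (+ m) (divides (- 1ℤ) (linear (+ k -ᶻ + q -ᶻ + m) (- 1ℤ *ᶻ + (p * q)) (- 1ℤ ⊛ cast)
              (lem (+ k) (+ q) (+ m) (+ (p * q))))))
            (trans (W₁-val m m<pq) (⟦⟧-no (m ℕ.<? p) (ℕₚ.≤⇒≯ p≤m)))

  W-right : ∀ k → q ≤ k → k < p * q → W (+ k) ≡ - ⟦ k ℕ.<? p + q ⟧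
  W-right k q≤k k<pq = begin
    W₁ (+ k) -ᶻ W₁ (+ k -ᶻ + q)
      ≡⟨ cong₂ _-ᶻ_ (trans (W₁-val k k<pq) (⟦⟧-no (k ℕ.<? p) (ℕₚ.≤⇒≯ (ℕₚ.≤-trans (ℕₚ.<⇒≤ p<q) q≤k))))
                    (cong W₁ (trans (ℤₚ.[+m]-[+n]≡m⊖n k q) (ℤₚ.⊖-≥ q≤k))) ⟩
    0ℤ -ᶻ W₁ (+ (k ∸ q))          ≡⟨ ℤₚ.+-identityˡ (- W₁ (+ (k ∸ q))) ⟩
    - W₁ (+ (k ∸ q))              ≡⟨ cong -_ (trans (W₁-val (k ∸ q) (ℕₚ.≤-<-trans (ℕₚ.m∸n≤m k q) k<pq))
         (⟦⟧-cong (k ∸ q ℕ.<? p) (k ℕ.<? p + q)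
           (λ lt → subst (_< p + q) (ℕₚ.m∸n+n≡m q≤k) (ℕₚ.+-monoˡ-< q lt))
           (λ lt → ℕₚ.+-cancelʳ-< q (k ∸ q) p (subst (_< p + q) (sym (ℕₚ.m∸n+n≡m q≤k)) lt)))) ⟩
    - ⟦ k ℕ.<? p + q ⟧            ∎

  -- Adding `pq` moves `−d` into `[p + q, pq)`, the stretch of each period where both blocks are
  -- absent.
  W-gap : ∀ d → 0 < d → d + (p + q) ≤ p * q → W (- + d) ≡ 0ℤ
  W-gap d 0<d d≤ = trans (W-cong (- + d) (+ m) (divides (- 1ℤ) (linear (- + d -ᶻ + m) (- 1ℤ *ᶻ + (p * q)) (- 1ℤ ⊛ cast) (lem (+ d) (+ m) (+ (p * q))))))
    (trans (W-right m (ℕₚ.≤-trans (ℕₚ.m≤n+m q p) p+q≤m) m<pq) (cong -_ (⟦⟧-no (m ℕ.<? p + q) (ℕₚ.≤⇒≯ p+q≤m))))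
    where
    m = p * q ∸ d
    d+m : d + m ≡ p * q
    d+m = ℕₚ.m+[n∸m]≡n (ℕₚ.≤-trans (ℕₚ.m≤m+n d (p + q)) d≤)
    cast : + d +ᶻ + m ≡ + (p * q)
    cast = cong (λ z → + z) d+m
    p+q≤m : p + q ≤ m
    p+q≤m = ℕₚ.+-cancelˡ-≤ d (p + q) m (subst (d + (p + q) ≤_) (sym d+m) d≤)
    m<pq : m < p * q
    m<pq = subst (m <_) d+m (ℕₚ.m<n+m m 0<d)
    lem : ∀ d m x → - d -ᶻ m -ᶻ - 1ℤ *ᶻ x ≡ - 1ℤ *ᶻ (d +ᶻ m -ᶻ x)
    lem = solve-∀

  -- The sums in Kaplan's formula, cut off at i < N; A depends on ρ and t only mod pq.
  A : ℤ → ℕ → ℤ → ℤ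
  A ρ N t = ∑ N λ i → c (+ i) *ᶻ W (t -ᶻ ρ *ᶻ + i)

  A-cong : ∀ ρ σ N t u → + (p * q) ∣ᶻ ρ -ᶻ σ → + (p * q) ∣ᶻ t -ᶻ u → A ρ N t ≡ A σ N u
  A-cong ρ σ N t u ρ≡σ t≡u = ∑-cong N λ i _ → cong (c (+ i) *ᶻ_) (W-cong (t -ᶻ ρ *ᶻ + i) (u -ᶻ σ *ᶻ + i)
    (∣ᶻ-via (lem t u ρ σ (+ i)) (∣ᶻ.∣m∣n⇒∣m-n t≡u (∣ᶻ.∣m⇒∣m*n (+ i) ρ≡σ))))
    where
    lem : ∀ t u ρ σ i → t -ᶻ u -ᶻ (ρ -ᶻ σ) *ᶻ i ≡ t -ᶻ ρ *ᶻ i -ᶻ (u -ᶻ σ *ᶻ i)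
    lem = solve-∀

  A-reflect : ∀ ρ N t → A (- ρ) N (+ p +ᶻ + q -ᶻ 1ℤ -ᶻ t) ≡ - A ρ N t
  A-reflect ρ N t = trans (∑-cong N λ i _ → trans
      (cong (c (+ i) *ᶻ_) (trans (cong W (lem₁ (+ p) (+ q) t ρ (+ i))) (W-reflect (t -ᶻ ρ *ᶻ + i))))
      (lem₂ (c (+ i)) (W (t -ᶻ ρ *ᶻ + i))))
    (∑-neg N (λ i → c (+ i) *ᶻ W (t -ᶻ ρ *ᶻ + i)))
    where
    lem₁ : ∀ p q t ρ i → p +ᶻ q -ᶻ 1ℤ -ᶻ t -ᶻ - ρ *ᶻ i ≡ p +ᶻ q -ᶻ 1ℤ -ᶻ (t -ᶻ ρ *ᶻ i)
    lem₁ = solve-∀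
    lem₂ : ∀ a b → a *ᶻ - b ≡ - (a *ᶻ b)
    lem₂ = solve-∀

-- The coefficients of Φ*_{pqr} as truncated sums.

module Coefficients (p q r : ℕ) .{{_ : NonZero p}} .{{_ : NonZero q}} .{{_ : NonZero r}}
                    (p≥2 : 2 ≤ p) (p<q : p < q) (p⊥q : Coprime p q) (r⊥pq : Coprime r (p * q)) where
  open Binary p q p≥2 p⊥q
  open Window p q p≥2 p<q p⊥q
  open Ternary p q r p≥2 p⊥q r⊥pq

  A-step : ∀ N t → A (+ r) N t -ᶻ A (+ r) N (t -ᶻ 1ℤ) ≡ T-square N t
  A-step N t = begin
    A (+ r) N t -ᶻ A (+ r) N (t -ᶻ 1ℤ)
      ≡⟨ ∑-sub N (λ i → c (+ i) *ᶻ W (t -ᶻ + r *ᶻ + i)) (λ i → c (+ i) *ᶻ W (t -ᶻ 1ℤ -ᶻ + r *ᶻ + i)) ⟨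
    ∑ N (λ i → c (+ i) *ᶻ W (t -ᶻ + r *ᶻ + i) -ᶻ c (+ i) *ᶻ W (t -ᶻ 1ℤ -ᶻ + r *ᶻ + i))
      ≡⟨ ∑-cong N (λ i _ → term i) ⟩
    ∑ N (λ i → F t i -ᶻ F (t -ᶻ + p) i -ᶻ (F (t -ᶻ + q) i -ᶻ F (t -ᶻ + p -ᶻ + q) i))
      ≡⟨ ∑-sub N (λ i → F t i -ᶻ F (t -ᶻ + p) i) (λ i → F (t -ᶻ + q) i -ᶻ F (t -ᶻ + p -ᶻ + q) i) ⟩
    ∑ N (λ i → F t i -ᶻ F (t -ᶻ + p) i) -ᶻ ∑ N (λ i → F (t -ᶻ + q) i -ᶻ F (t -ᶻ + p -ᶻ + q) i)
      ≡⟨ cong₂ _-ᶻ_ (∑-sub N (F t) (F (t -ᶻ + p))) (∑-sub N (F (t -ᶻ + q)) (F (t -ᶻ + p -ᶻ + q))) ⟩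
    T-square N t ∎
    where
    F : ℤ → ℕ → ℤ
    F u i = c (+ i) *ᶻ D (u -ᶻ + r *ᶻ + i)
    lem₁ : ∀ t x y → t -ᶻ x -ᶻ y ≡ t -ᶻ y -ᶻ x
    lem₁ = solve-∀
    lem₁′ : ∀ t x z y → t -ᶻ x -ᶻ z -ᶻ y ≡ t -ᶻ y -ᶻ x -ᶻ z
    lem₁′ = solve-∀
    lem₂ : ∀ a x y → a *ᶻ x -ᶻ a *ᶻ y ≡ a *ᶻ (x -ᶻ y)
    lem₂ = solve-∀
    lem₃ : ∀ a x y z w → a *ᶻ (x -ᶻ y -ᶻ (z -ᶻ w)) ≡ a *ᶻ x -ᶻ a *ᶻ y -ᶻ (a *ᶻ z -ᶻ a *ᶻ w)
    lem₃ = solve-∀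
    term : ∀ i → c (+ i) *ᶻ W (t -ᶻ + r *ᶻ + i) -ᶻ c (+ i) *ᶻ W (t -ᶻ 1ℤ -ᶻ + r *ᶻ + i)
               ≡ F t i -ᶻ F (t -ᶻ + p) i -ᶻ (F (t -ᶻ + q) i -ᶻ F (t -ᶻ + p -ᶻ + q) i)
    term i = let x = + r *ᶻ + i ; u = t -ᶻ x in begin
      c (+ i) *ᶻ W u -ᶻ c (+ i) *ᶻ W (t -ᶻ 1ℤ -ᶻ x)   ≡⟨ cong (λ z → c (+ i) *ᶻ W u -ᶻ c (+ i) *ᶻ W z) (lem₁ t 1ℤ x) ⟩
      c (+ i) *ᶻ W u -ᶻ c (+ i) *ᶻ W (u -ᶻ 1ℤ)        ≡⟨ lem₂ (c (+ i)) (W u) (W (u -ᶻ 1ℤ)) ⟩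
      c (+ i) *ᶻ (W u -ᶻ W (u -ᶻ 1ℤ))                 ≡⟨ cong (c (+ i) *ᶻ_) (W-step u) ⟩
      c (+ i) *ᶻ (D u -ᶻ D (u -ᶻ + p) -ᶻ (D (u -ᶻ + q) -ᶻ D (u -ᶻ + p -ᶻ + q)))
        ≡⟨ lem₃ (c (+ i)) (D u) (D (u -ᶻ + p)) (D (u -ᶻ + q)) (D (u -ᶻ + p -ᶻ + q)) ⟩
      c (+ i) *ᶻ D u -ᶻ c (+ i) *ᶻ D (u -ᶻ + p) -ᶻ (c (+ i) *ᶻ D (u -ᶻ + q) -ᶻ c (+ i) *ᶻ D (u -ᶻ + p -ᶻ + q))
        ≡⟨ cong₂ (λ y z → F t i -ᶻ c (+ i) *ᶻ D y -ᶻ z) (lem₁ t x (+ p))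
             (cong₂ (λ y z → c (+ i) *ᶻ D y -ᶻ c (+ i) *ᶻ D z) (lem₁ t x (+ q)) (sym (lem₁′ t (+ p) (+ q) x))) ⟩
      F t i -ᶻ F (t -ᶻ + p) i -ᶻ (F (t -ᶻ + q) i -ᶻ F (t -ᶻ + p -ᶻ + q) i) ∎

  -- The full sum does not depend on t, and its sum over an arithmetic progression with difference q telescopes.
  A-full : ∀ N t → p * q ≤ N → A (+ r) N t ≡ 0ℤ
  A-full N t pq≤N = [ (λ p≡0 → ⊥-elim (ℕ.≢-nonZero⁻¹ p (ℤₚ.+-injective p≡0))) , (λ v≡0 → v≡0) ]′ (ℤₚ.i*j≡0⇒i≡0∨j≡0 (+ p) p*v≡0)
    where
    V : ℤ → ℤ
    V u = ∑ N λ i → c (+ i) *ᶻ W₁ (u -ᶻ + r *ᶻ + i)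
    lem₁ : ∀ u x q → u -ᶻ x -ᶻ q ≡ u -ᶻ q -ᶻ x
    lem₁ = solve-∀
    lem₂ : ∀ a x y → a *ᶻ (x -ᶻ y) ≡ a *ᶻ x -ᶻ a *ᶻ y
    lem₂ = solve-∀
    lem₃ : ∀ t k → t -ᶻ (1ℤ +ᶻ k) ≡ t -ᶻ k -ᶻ 1ℤ
    lem₃ = solve-∀
    lem₄ : ∀ t j q → t -ᶻ j *ᶻ q -ᶻ q ≡ t -ᶻ (1ℤ +ᶻ j) *ᶻ q
    lem₄ = solve-∀
    lem₅ : ∀ t q x → t -ᶻ x -ᶻ (t -ᶻ 0ℤ *ᶻ q) ≡ - 1ℤ *ᶻ x
    lem₅ = solve-∀
    lem₆ : ∀ a b → - a -ᶻ - b ≡ b -ᶻ a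
    lem₆ = solve-∀
    A-V : ∀ u → A (+ r) N u ≡ V u -ᶻ V (u -ᶻ + q)
    A-V u = trans (∑-cong N λ i _ → trans (cong (λ z → c (+ i) *ᶻ (W₁ (u -ᶻ + r *ᶻ + i) -ᶻ W₁ z)) (lem₁ u (+ r *ᶻ + i) (+ q)))
                                          (lem₂ (c (+ i)) (W₁ (u -ᶻ + r *ᶻ + i)) (W₁ (u -ᶻ + q -ᶻ + r *ᶻ + i))))
                  (∑-sub N (λ i → c (+ i) *ᶻ W₁ (u -ᶻ + r *ᶻ + i)) (λ i → c (+ i) *ᶻ W₁ (u -ᶻ + q -ᶻ + r *ᶻ + i)))
    V-cong : ∀ u v → + (p * q) ∣ᶻ u -ᶻ v → V u ≡ V v
    V-cong u v d = ∑-cong N λ i _ → cong (c (+ i) *ᶻ_) (W₁-cong (u -ᶻ + r *ᶻ + i) (v -ᶻ + r *ᶻ + i) (∣ᶻ-via (lem u v (+ r *ᶻ + i)) d))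
      where
      lem : ∀ u v x → u -ᶻ v ≡ u -ᶻ x -ᶻ (v -ᶻ x)
      lem = solve-∀
    constant : ∀ k → A (+ r) N (t -ᶻ + k) ≡ A (+ r) N t
    constant zero    = cong (A (+ r) N) (ℤₚ.+-identityʳ t)
    constant (suc k) = trans (cong (A (+ r) N) (lem₃ t (+ k)))
      (trans (sym (ℤₚ.i-j≡0⇒i≡j _ _ (trans (A-step N (t -ᶻ + k)) (T-square-full N (t -ᶻ + k) pq≤N)))) (constant k))
    p*v≡0 : + p *ᶻ A (+ r) N t ≡ 0ℤ
    p*v≡0 = begin
      + p *ᶻ A (+ r) N t                                          ≡⟨ ∑-const p (A (+ r) N t) ⟨
      ∑ p (λ _ → A (+ r) N t)                                     ≡⟨ ∑-cong p (λ j _ → trans (sym (constant (j * q)))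
                                                                        (trans (cong (λ z → A (+ r) N (t -ᶻ z)) (ℤₚ.pos-* j q)) (A-V (t -ᶻ + j *ᶻ + q)))) ⟩
      ∑ p (λ j → V (t -ᶻ + j *ᶻ + q) -ᶻ V (t -ᶻ + j *ᶻ + q -ᶻ + q)) ≡⟨ ∑-cong p (λ j _ → trans (cong (λ z → V (t -ᶻ + j *ᶻ + q) -ᶻ V z) (lem₄ t (+ j) (+ q)))
                                                                        (sym (lem₆ (V (t -ᶻ + suc j *ᶻ + q)) (V (t -ᶻ + j *ᶻ + q))))) ⟩
      ∑ p (λ j → - V (t -ᶻ + suc j *ᶻ + q) -ᶻ - V (t -ᶻ + j *ᶻ + q)) ≡⟨ ∑-telescope p (λ j → - V (t -ᶻ + j *ᶻ + q)) ⟩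
      - V (t -ᶻ + p *ᶻ + q) -ᶻ - V (t -ᶻ + 0 *ᶻ + q)              ≡⟨ cong (λ z → - z -ᶻ - V (t -ᶻ + 0 *ᶻ + q)) (V-cong (t -ᶻ + p *ᶻ + q) (t -ᶻ + 0 *ᶻ + q)
                                                                        (divides (- 1ℤ) (trans (lem₅ t (+ q) (+ p *ᶻ + q)) (cong (- 1ℤ *ᶻ_) (sym (ℤₚ.pos-* p q)))))) ⟩
      - V (t -ᶻ + 0 *ᶻ + q) -ᶻ - V (t -ᶻ + 0 *ᶻ + q)              ≡⟨ ℤₚ.+-inverseʳ (- V (t -ᶻ + 0 *ᶻ + q)) ⟩
      0ℤ                                                          ∎

  -- The coefficient of x^n in Φ*_{pqr}.
  a : ℕ → ℤ
  a n = A (+ r) (suc (n DM./ r)) (+ n)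

  a-floor : ∀ n K → r * K ≤ n → n < r * suc K → a n ≡ A (+ r) (suc K) (+ n)
  a-floor n K lo hi = cong (λ k → A (+ r) (suc k) (+ n)) (floor-unique n r K lo hi)

  A-skip : ∀ k N t → (∀ i → N ≤ i → i < k + N → c (+ i) ≡ 0ℤ ⊎ W (t -ᶻ + r *ᶻ + i) ≡ 0ℤ) → A (+ r) (k + N) t ≡ A (+ r) N t
  A-skip k N t h = ∑-extend N k λ i N≤i i<k+N →
    [ (λ e → trans (cong (_*ᶻ W (t -ᶻ + r *ᶻ + i)) e) (ℤₚ.*-zeroˡ (W (t -ᶻ + r *ᶻ + i))))
    , (λ e → trans (cong (c (+ i) *ᶻ_) e) (ℤₚ.*-zeroʳ (c (+ i)))) ]′ (h i N≤i i<k+N)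

  a-neighbour : ∀ n → Trit (a (suc n) -ᶻ a n)
  a-neighbour n = subst Trit (trans (sym (A-step K (+ suc n))) (cong (a (suc n) -ᶻ_) (previous (K′ ℕ.≟ K)))) (T-square-trit K (+ suc n))
    where
    K = suc (suc n DM./ r)
    K′ = suc (n DM./ r)
    K′≤K : K′ ≤ K
    K′≤K = s≤s (DM./-monoˡ-≤ r (ℕₚ.n≤1+n n))
    previous : Dec (K′ ≡ K) → A (+ r) K (+ suc n -ᶻ 1ℤ) ≡ a n
    previous (yes eq) = cong (λ k → A (+ r) k (+ n)) (sym eq)
    -- The cutoff grows only when `r` divides `n + 1`. Any added index has `ri = n + 1` and meets
    -- `W (−1) = 0`, so `a n` may be computed with the cutoff of `a (n + 1)`.
    previous (no neq) = trans (cong (λ k → A (+ r) k (+ n)) (sym (ℕₚ.m∸n+n≡m K′≤K)))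
      (A-skip (K ∸ K′) K′ (+ n) λ i K′≤i i<K → inj₂ (trans
        (cong W (sub-neg n r i 1 (trans (ℕₚ.+-comm n 1) (ℕₚ.≤-antisym
          (ℕₚ.<-≤-trans (floor-< n r) (ℕₚ.*-monoʳ-≤ r K′≤i))
          (ℕₚ.≤-trans (ℕₚ.*-monoʳ-≤ r (ℕₚ.≤-pred (subst (i <_) (ℕₚ.m∸n+n≡m K′≤K) i<K))) (floor-≤ (suc n) r))))))
        (W-gap 1 (s≤s z≤n) p+q<pq)))

  -- The hypothesis places `n` above the degree `(p − 1)(q − 1)(r − 1)`. Raising the cutoff by `pq`
  -- then changes nothing: an added index `i ≤ (p − 1)(q − 1)` has `n − ri` negative but at least
  -- `p + q − pq`, inside the gap of `W`, and a larger one has `c i = 0`. What results is a full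
  -- sum.
  a-vanish : ∀ n → p + q + r + p * q * r ≤ n + (p * q + p * r + q * r) → a n ≡ 0ℤ
  a-vanish n big = trans (sym (A-skip (p * q) K (+ n) skip)) (A-full (p * q + K) (+ n) (ℕₚ.m≤m+n (p * q) K))
    where
    K = suc (n DM./ r)
    skip : ∀ i → K ≤ i → i < p * q + K → c (+ i) ≡ 0ℤ ⊎ W (+ n -ᶻ + r *ᶻ + i) ≡ 0ℤ
    skip i K≤i _ = [ inj₁ , (λ i≤ → inj₂ (far i≤)) ]′ (c-support i)
      where
      n<ri : n < r * i
      n<ri = ℕₚ.<-≤-trans (floor-< n r) (ℕₚ.*-monoʳ-≤ r K≤i)
      d = r * i ∸ n
      n+d : n + d ≡ r * i
      n+d = ℕₚ.m+[n∸m]≡n (ℕₚ.<⇒≤ n<ri)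
      rearrange₁ : ∀ x → d + (p + q) + (n + x) ≡ p + q + (n + d + x)
      rearrange₁ x = trans (cong (λ z → z + (n + x)) (ℕₚ.+-comm d (p + q))) (trans (ℕₚ.+-assoc (p + q) d (n + x))
        (cong (λ z → p + q + z) (trans (sym (ℕₚ.+-assoc d n x)) (cong (λ z → z + x) (ℕₚ.+-comm d n)))))
      bound : i + (p + q) ≤ p * q + 1 → r * i + (p * r + q * r) ≤ p * q * r + r
      bound i≤ = ℕₚ.≤-trans (ℕₚ.≤-reflexive e₁) (ℕₚ.≤-trans (ℕₚ.*-monoˡ-≤ r i≤) (ℕₚ.≤-reflexive e₂))
        where
        e₁ : r * i + (p * r + q * r) ≡ (i + (p + q)) * r
        e₁ = trans (cong₂ _+_ (ℕₚ.*-comm r i) (sym (ℕₚ.*-distribʳ-+ r p q))) (sym (ℕₚ.*-distribʳ-+ r i (p + q)))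
        e₂ : (p * q + 1) * r ≡ p * q * r + r
        e₂ = trans (ℕₚ.*-distribʳ-+ r (p * q) 1) (cong (λ z → p * q * r + z) (ℕₚ.*-identityˡ r))
      far : i + (p + q) ≤ p * q + 1 → W (+ n -ᶻ + r *ᶻ + i) ≡ 0ℤ
      far i≤ = trans (cong W (sub-neg n r i d n+d)) (W-gap d (ℕₚ.m<n⇒0<n∸m n<ri)
        (ℕₚ.+-cancelʳ-≤ (n + (p * r + q * r)) (d + (p + q)) (p * q) (ℕₚ.≤-trans (ℕₚ.≤-reflexive
          (trans (rearrange₁ (p * r + q * r)) (cong (λ z → p + q + (z + (p * r + q * r))) n+d)))
          (ℕₚ.≤-trans (ℕₚ.+-monoʳ-≤ (p + q) (bound i≤)) (ℕₚ.≤-trans (ℕₚ.≤-reflexive e₃) (ℕₚ.≤-trans big (ℕₚ.≤-reflexive e₄)))))))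
        where
        e₃ : p + q + (p * q * r + r) ≡ p + q + r + p * q * r
        e₃ = trans (cong (λ z → p + q + z) (ℕₚ.+-comm (p * q * r) r)) (sym (ℕₚ.+-assoc (p + q) r (p * q * r)))
        e₄ : n + (p * q + p * r + q * r) ≡ p * q + (n + (p * r + q * r))
        e₄ = trans (cong (λ z → n + z) (ℕₚ.+-assoc (p * q) (p * r) (q * r))) (CS.x∙yz≈y∙xz n (p * q) (p * r + q * r))

-- The generating function of Φ*_{pqr}.

∇-swap : ∀ a b d e (g : ℤ → ℤ) n → ∇ a (∇ b (∇ d (∇ e g))) n ≡ ∇ d (∇ e (∇ a (∇ b g))) n
∇-swap a b d e g n = begin
  ∇ a (∇ b (∇ d (∇ e g))) n ≡⟨ ∇-cong a (∇-comm b d (∇ e g)) n ⟩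
  ∇ a (∇ d (∇ b (∇ e g))) n ≡⟨ ∇-comm a d (∇ b (∇ e g)) n ⟩
  ∇ d (∇ a (∇ b (∇ e g))) n ≡⟨ ∇-cong d (∇-cong a (∇-comm b e g)) n ⟩
  ∇ d (∇ a (∇ e (∇ b g))) n ≡⟨ ∇-cong d (∇-comm a e (∇ b g)) n ⟩
  ∇ d (∇ e (∇ a (∇ b g))) n ∎

module Series (p q r : ℕ) .{{_ : NonZero p}} .{{_ : NonZero q}} .{{_ : NonZero r}}
              (p≥2 : 2 ≤ p) (p<q : p < q) (p⊥q : Coprime p q) (r⊥pq : Coprime r (p * q)) where
  open Binary p q p≥2 p⊥q
  open Window p q p≥2 p<q p⊥q
  open Coefficients p q r p≥2 p<q p⊥q r⊥pq
  private
    instance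
      pq≢0 : NonZero (p * q)
      pq≢0 = ℕₚ.m*n≢0 p q

    M : ℤ → ℤ
    M = multiple⁺ (p * q)

    -- W⁺ is the series (1 − x^p)(1 − x^q) / ((1 − x)(1 − x^{pq})), which agrees with W on nonnegative arguments.
    W₁⁺ W⁺ : ℤ → ℤ
    W₁⁺ u = ∑ p λ j → M (u -ᶻ + j)
    W⁺ u  = W₁⁺ u -ᶻ W₁⁺ (u -ᶻ + q)

    Z : ℤ → ℤ
    Z u = ∑ p λ j → δ (u -ᶻ + j)

    ∇W₁⁺ : ∀ u → ∇ (p * q) W₁⁺ u ≡ - Z u
    ∇W₁⁺ u = begin
      W₁⁺ (u -ᶻ + (p * q)) -ᶻ W₁⁺ u                             ≡⟨ ∑-sub p (λ j → M (u -ᶻ + (p * q) -ᶻ + j)) (λ j → M (u -ᶻ + j)) ⟨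
      ∑ p (λ j → M (u -ᶻ + (p * q) -ᶻ + j) -ᶻ M (u -ᶻ + j))     ≡⟨ ∑-cong p (λ j _ → trans (cong (λ z → M z -ᶻ M (u -ᶻ + j)) (lem u (+ (p * q)) (+ j)))
                                                                     (∇-multiple⁺ (p * q) (u -ᶻ + j))) ⟩
      ∑ p (λ j → - δ (u -ᶻ + j))                                ≡⟨ ∑-neg p (λ j → δ (u -ᶻ + j)) ⟩
      - Z u                                                     ∎
      where
      lem : ∀ u x y → u -ᶻ x -ᶻ y ≡ u -ᶻ y -ᶻ x
      lem = solve-∀

    ∇Z : ∀ u → ∇ 1 Z u ≡ ∇ p δ u
    ∇Z u = begin
      Z (u -ᶻ 1ℤ) -ᶻ Z u                                   ≡⟨ ∑-sub p (λ j → δ (u -ᶻ 1ℤ -ᶻ + j)) (λ j → δ (u -ᶻ + j)) ⟨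
      ∑ p (λ j → δ (u -ᶻ 1ℤ -ᶻ + j) -ᶻ δ (u -ᶻ + j))       ≡⟨ ∑-cong p (λ j _ → cong (λ z → δ z -ᶻ δ (u -ᶻ + j)) (lem u (+ j))) ⟩
      ∑ p (λ j → δ (u -ᶻ + suc j) -ᶻ δ (u -ᶻ + j))         ≡⟨ ∑-telescope p (λ j → δ (u -ᶻ + j)) ⟩
      δ (u -ᶻ + p) -ᶻ δ (u -ᶻ + 0)                         ≡⟨ cong (λ z → δ (u -ᶻ + p) -ᶻ δ z) (ℤₚ.+-identityʳ u) ⟩
      δ (u -ᶻ + p) -ᶻ δ u                                  ∎
      where
      lem : ∀ u j → u -ᶻ 1ℤ -ᶻ j ≡ u -ᶻ (1ℤ +ᶻ j)
      lem = solve-∀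

    W⁺-∇ : ∀ u → W⁺ u ≡ - ∇ q W₁⁺ u
    W⁺-∇ u = lem (W₁⁺ u) (W₁⁺ (u -ᶻ + q))
      where
      lem : ∀ a b → a -ᶻ b ≡ - (b -ᶻ a)
      lem = solve-∀

    ∇∇W⁺ : ∀ u → ∇ 1 (∇ (p * q) W⁺) u ≡ ∇ p (∇ q δ) u
    ∇∇W⁺ u = begin
      ∇ 1 (∇ (p * q) W⁺) u                        ≡⟨ ∇-cong 1 (∇-cong (p * q) W⁺-∇) u ⟩
      ∇ 1 (∇ (p * q) (λ m → - ∇ q W₁⁺ m)) u       ≡⟨ ∇-cong 1 (∇-neg (p * q) (∇ q W₁⁺)) u ⟩
      ∇ 1 (λ m → - ∇ (p * q) (∇ q W₁⁺) m) u       ≡⟨ ∇-neg 1 (∇ (p * q) (∇ q W₁⁺)) u ⟩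
      - ∇ 1 (∇ (p * q) (∇ q W₁⁺)) u               ≡⟨ cong -_ (∇-cong 1 (∇-comm (p * q) q W₁⁺) u) ⟩
      - ∇ 1 (∇ q (∇ (p * q) W₁⁺)) u               ≡⟨ cong -_ (∇-cong 1 (∇-cong q ∇W₁⁺) u) ⟩
      - ∇ 1 (∇ q (λ m → - Z m)) u                 ≡⟨ cong -_ (∇-cong 1 (∇-neg q Z) u) ⟩
      - ∇ 1 (λ m → - ∇ q Z m) u                   ≡⟨ cong -_ (∇-neg 1 (∇ q Z) u) ⟩
      - - ∇ 1 (∇ q Z) u                           ≡⟨ ℤₚ.neg-involutive _ ⟩
      ∇ 1 (∇ q Z) u                               ≡⟨ ∇-comm 1 q Z u ⟩
      ∇ q (∇ 1 Z) u                               ≡⟨ ∇-cong q ∇Z u ⟩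
      ∇ q (∇ p δ) u                               ≡⟨ ∇-comm q p δ u ⟩
      ∇ p (∇ q δ) u                               ∎

    -- The coefficients of Φ*_{pq}(x^r) g(x).
    conv : (ℤ → ℤ) → ℤ → ℤ
    conv g n = ∑ (p * q) λ i → c (+ i) *ᶻ g (n -ᶻ + r *ᶻ + i)

    conv-cong : ∀ {g h : ℤ → ℤ} → (∀ n → g n ≡ h n) → ∀ n → conv g n ≡ conv h n
    conv-cong e n = ∑-cong (p * q) λ i _ → cong (c (+ i) *ᶻ_) (e (n -ᶻ + r *ᶻ + i))

    conv-∇ : ∀ d g n → ∇ d (conv g) n ≡ conv (∇ d g) n
    conv-∇ d g n = trans (sym (∑-sub (p * q) (λ i → c (+ i) *ᶻ g (n -ᶻ + d -ᶻ + r *ᶻ + i)) (λ i → c (+ i) *ᶻ g (n -ᶻ + r *ᶻ + i))))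
      (∑-cong (p * q) λ i _ → trans (cong (λ z → c (+ i) *ᶻ g z -ᶻ c (+ i) *ᶻ g (n -ᶻ + r *ᶻ + i)) (lem₁ n (+ d) (+ r *ᶻ + i)))
        (lem₂ (c (+ i)) (g (n -ᶻ + r *ᶻ + i -ᶻ + d)) (g (n -ᶻ + r *ᶻ + i))))
      where
      lem₁ : ∀ n d x → n -ᶻ d -ᶻ x ≡ n -ᶻ x -ᶻ d
      lem₁ = solve-∀
      lem₂ : ∀ a x y → a *ᶻ x -ᶻ a *ᶻ y ≡ a *ᶻ (x -ᶻ y)
      lem₂ = solve-∀

    -- `conv δ` is the coefficient sequence of Φ*_{pq}(x^r); it reproduces `c` on the multiples of
    -- `r`.
    inflate-multiple : ∀ n m → n ≡ m *ᶻ + r → conv δ n ≡ c m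
    inflate-multiple n m n≡ = trans (∑-cong (p * q) λ i _ → cong (c (+ i) *ᶻ_) (point i)) (go m)
      where
      lem₁ : ∀ n m r i → n -ᶻ r *ᶻ i -ᶻ r *ᶻ (m -ᶻ i) ≡ 1ℤ *ᶻ (n -ᶻ m *ᶻ r)
      lem₁ = solve-∀
      scaled : ∀ i → n -ᶻ + r *ᶻ + i ≡ + r *ᶻ (m -ᶻ + i)
      scaled i = linear (n -ᶻ + r *ᶻ + i) (+ r *ᶻ (m -ᶻ + i)) (1ℤ ⊛ n≡) (lem₁ n m (+ r) (+ i))
      point : ∀ i → δ (n -ᶻ + r *ᶻ + i) ≡ δ (m -ᶻ + i)
      point i = δ-cong (n -ᶻ + r *ᶻ + i) (m -ᶻ + i)
        (λ e → [ (λ r≡0 → ⊥-elim (ℕ.≢-nonZero⁻¹ r (ℤₚ.+-injective r≡0))) , (λ z → z) ]′ (ℤₚ.i*j≡0⇒i≡0∨j≡0 (+ r) (trans (sym (scaled i)) e)))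
        (λ e → trans (scaled i) (trans (cong (+ r *ᶻ_) e) (ℤₚ.*-zeroʳ (+ r))))
      off : ∀ m i → m ≢ + i → c (+ i) *ᶻ δ (m -ᶻ + i) ≡ 0ℤ
      off m i m≢i = trans (cong (c (+ i) *ᶻ_) (⟦⟧-no (m -ᶻ + i ℤ.≟ 0ℤ) λ e → m≢i (ℤₚ.i-j≡0⇒i≡j m (+ i) e))) (ℤₚ.*-zeroʳ (c (+ i)))
      inside : ∀ k → Dec (k < p * q) → ∑ (p * q) (λ i → c (+ i) *ᶻ δ (+ k -ᶻ + i)) ≡ c (+ k)
      inside k (yes k<pq) = trans (∑-single (p * q) k k<pq λ i _ i≢k → off (+ k) i λ e → i≢k (sym (ℤₚ.+-injective e)))
        (trans (cong (c (+ k) *ᶻ_) (⟦⟧-yes (+ k -ᶻ + k ℤ.≟ 0ℤ) (ℤₚ.+-inverseʳ (+ k)))) (ℤₚ.*-identityʳ (c (+ k))))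
      inside k (no k≮pq)  = trans (∑-zero (p * q) λ i i<pq → off (+ k) i λ { refl → k≮pq i<pq }) (sym (c-large k (ℕₚ.≮⇒≥ k≮pq)))
      go : ∀ m → ∑ (p * q) (λ i → c (+ i) *ᶻ δ (m -ᶻ + i)) ≡ c m
      go (+ k)      = inside k (k ℕ.<? p * q)
      go -[1+ k ]   = trans (∑-zero (p * q) λ i _ → off -[1+ k ] i λ ()) (sym (c-negative k))

    inflate-other : ∀ n → ¬ (+ r ∣ᶻ n) → conv δ n ≡ 0ℤ
    inflate-other n r∤n = ∑-zero (p * q) λ i _ → trans (cong (c (+ i) *ᶻ_) (⟦⟧-no (n -ᶻ + r *ᶻ + i ℤ.≟ 0ℤ) λ e →
      r∤n (divides (+ i) (trans (ℤₚ.i-j≡0⇒i≡j n (+ r *ᶻ + i) e) (ℤₚ.*-comm (+ r) (+ i)))))) (ℤₚ.*-zeroʳ (c (+ i)))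

    -- The identity `∇∇c` after the substitution of `x^r` for `x`. All shifts are multiples of `r`,
    -- so it is `∇∇c` again on multiples of `r`, and elsewhere both sides vanish.
    ∇∇-inflate : ∀ n → ∇ (p * r) (∇ (q * r) (conv δ)) n ≡ ∇ r (∇ (p * q * r) δ) n
    ∇∇-inflate n = go (+ r ∣ᶻ? n)
      where
      shift : ∀ n k d → + r ∣ᶻ n -ᶻ + k → + k ≡ d *ᶻ + r → + r ∣ᶻ n
      shift n k d r∣ k≡ = ∣ᶻ-via (lem n (+ k)) (∣ᶻ.∣m∣n⇒∣m+n r∣ (divides d k≡))
        where
        lem : ∀ n k → n -ᶻ k +ᶻ k ≡ n
        lem = solve-∀
      vanish : ∀ (g : ℤ → ℤ) → (∀ n → ¬ (+ r ∣ᶻ n) → g n ≡ 0ℤ) → ∀ n k l d e → ¬ (+ r ∣ᶻ n) → + k ≡ d *ᶻ + r → + l ≡ e *ᶻ + r →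
               ∇ k (∇ l g) n ≡ 0ℤ
      vanish g g0 n k l d e r∤n k≡ l≡ = cong₂ _-ᶻ_
        (cong₂ _-ᶻ_ (g0 _ λ z → r∤n (shift n k d (shift (n -ᶻ + k) l e z l≡) k≡)) (g0 _ λ z → r∤n (shift n k d z k≡)))
        (cong₂ _-ᶻ_ (g0 _ λ z → r∤n (shift n l e z l≡)) (g0 _ r∤n))
      δ-other : ∀ n → ¬ (+ r ∣ᶻ n) → δ n ≡ 0ℤ
      δ-other n r∤n = ⟦⟧-no (n ℤ.≟ 0ℤ) λ { refl → r∤n (divides 0ℤ refl) }
      sub : ∀ n m k d → n ≡ m *ᶻ + r → + k ≡ d *ᶻ + r → n -ᶻ + k ≡ (m -ᶻ d) *ᶻ + r
      sub n m k d n≡ k≡ = linear (n -ᶻ + k) ((m -ᶻ d) *ᶻ + r) (1ℤ ⊛ n≡ ⊞ - 1ℤ ⊛ k≡) (lem n m (+ k) d (+ r))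
        where
        lem : ∀ n m k d r → n -ᶻ k -ᶻ (m -ᶻ d) *ᶻ r ≡ 1ℤ *ᶻ (n -ᶻ m *ᶻ r) +ᶻ - 1ℤ *ᶻ (k -ᶻ d *ᶻ r)
        lem = solve-∀
      δ-multiple : ∀ n m → n ≡ m *ᶻ + r → δ n ≡ δ m
      δ-multiple n m n≡ = δ-cong n m
        (λ e → [ (λ z → z) , (λ r≡0 → ⊥-elim (ℕ.≢-nonZero⁻¹ r (ℤₚ.+-injective r≡0))) ]′ (ℤₚ.i*j≡0⇒i≡0∨j≡0 m (trans (sym n≡) e)))
        (λ e → trans n≡ (trans (cong (_*ᶻ + r) e) (ℤₚ.*-zeroˡ (+ r))))
      deflate : ∀ (g h : ℤ → ℤ) → (∀ n m → n ≡ m *ᶻ + r → g n ≡ h m) → ∀ n m k l d e → n ≡ m *ᶻ + r → + k ≡ + d *ᶻ + r → + l ≡ + e *ᶻ + r →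
                ∇ k (∇ l g) n ≡ ∇ d (∇ e h) m
      deflate g h gh n m k l d e n≡ k≡ l≡ = cong₂ _-ᶻ_
        (cong₂ _-ᶻ_ (gh (n -ᶻ + k -ᶻ + l) (m -ᶻ + d -ᶻ + e) (sub (n -ᶻ + k) (m -ᶻ + d) l (+ e) nk≡ l≡)) (gh (n -ᶻ + k) (m -ᶻ + d) nk≡))
        (cong₂ _-ᶻ_ (gh (n -ᶻ + l) (m -ᶻ + e) (sub n m l (+ e) n≡ l≡)) (gh n m n≡))
        where
        nk≡ : n -ᶻ + k ≡ (m -ᶻ + d) *ᶻ + r
        nk≡ = sub n m k (+ d) n≡ k≡
      r≡ : + r ≡ 1ℤ *ᶻ + r
      r≡ = sym (ℤₚ.*-identityˡ (+ r))
      go : Dec (+ r ∣ᶻ n) → ∇ (p * r) (∇ (q * r) (conv δ)) n ≡ ∇ r (∇ (p * q * r) δ) n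
      go (no r∤n) = trans (vanish (conv δ) inflate-other n (p * r) (q * r) (+ p) (+ q) r∤n (ℤₚ.pos-* p r) (ℤₚ.pos-* q r))
        (sym (vanish δ δ-other n r (p * q * r) 1ℤ (+ (p * q)) r∤n r≡ (ℤₚ.pos-* (p * q) r)))
      go (yes (divides m n≡)) = trans (deflate (conv δ) c inflate-multiple n m (p * r) (q * r) p q n≡ (ℤₚ.pos-* p r) (ℤₚ.pos-* q r))
        (trans (∇∇c m) (sym (deflate δ δ δ-multiple n m r (p * q * r) 1 (p * q) n≡ r≡ (ℤₚ.pos-* (p * q) r))))

  series : ℤ → ℤ
  series = conv W⁺

  -- The two factors of the product are cleared separately: the shifts `1` and `pq` act on `W⁺`, the
  -- shifts `pr` and `qr` on Φ*_{pq}(x^r).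
  series-equation : ∀ n → ∇ 1 (∇ (p * q) (∇ (p * r) (∇ (q * r) series))) n ≡ ∇ p (∇ q (∇ r (∇ (p * q * r) δ))) n
  series-equation n = begin
    ∇ 1 (∇ (p * q) (∇ (p * r) (∇ (q * r) series))) n ≡⟨ ∇-swap 1 (p * q) (p * r) (q * r) series n ⟩
    ∇ (p * r) (∇ (q * r) (∇ 1 (∇ (p * q) series))) n ≡⟨ ∇-cong (p * r) (∇-cong (q * r) inner) n ⟩
    ∇ (p * r) (∇ (q * r) (∇ p (∇ q (conv δ)))) n     ≡⟨ ∇-swap (p * r) (q * r) p q (conv δ) n ⟩
    ∇ p (∇ q (∇ (p * r) (∇ (q * r) (conv δ)))) n     ≡⟨ ∇-cong p (∇-cong q ∇∇-inflate) n ⟩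
    ∇ p (∇ q (∇ r (∇ (p * q * r) δ))) n              ∎
    where
    inner : ∀ n → ∇ 1 (∇ (p * q) series) n ≡ ∇ p (∇ q (conv δ)) n
    inner n = begin
      ∇ 1 (∇ (p * q) (conv W⁺)) n ≡⟨ ∇-cong 1 (conv-∇ (p * q) W⁺) n ⟩
      ∇ 1 (conv (∇ (p * q) W⁺)) n ≡⟨ conv-∇ 1 (∇ (p * q) W⁺) n ⟩
      conv (∇ 1 (∇ (p * q) W⁺)) n ≡⟨ conv-cong ∇∇W⁺ n ⟩
      conv (∇ p (∇ q δ)) n        ≡⟨ conv-∇ p (∇ q δ) n ⟨
      ∇ p (conv (∇ q δ)) n        ≡⟨ ∇-cong p (conv-∇ q δ) n ⟨
      ∇ p (∇ q (conv δ)) n        ∎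

  private
    negative-sub : ∀ (g : ℤ → ℤ) → (∀ n → g -[1+ n ] ≡ 0ℤ) → ∀ n k → g (-[1+ n ] -ᶻ + k) ≡ 0ℤ
    negative-sub g g0 n zero    = g0 n
    negative-sub g g0 n (suc k) = g0 (suc (n + k))

    W₁⁺-negative : ∀ n → W₁⁺ -[1+ n ] ≡ 0ℤ
    W₁⁺-negative n = ∑-zero p λ j _ → negative-sub M (λ _ → refl) n j

    W⁺-negative : ∀ n → W⁺ -[1+ n ] ≡ 0ℤ
    W⁺-negative n = cong₂ _-ᶻ_ (W₁⁺-negative n) (negative-sub W₁⁺ W₁⁺-negative n q)

    M-D : ∀ m k → k < p * q → M (+ m -ᶻ + k) ≡ D (+ m -ᶻ + k)
    M-D m k k<pq = go (k ℕ.≤? m)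
      where
      go : Dec (k ≤ m) → M (+ m -ᶻ + k) ≡ D (+ m -ᶻ + k)
      go (yes k≤m) = trans (cong M e) (sym (cong D e))
        where
        e : + m -ᶻ + k ≡ + (m ∸ k)
        e = trans (ℤₚ.[+m]-[+n]≡m⊖n m k) (ℤₚ.⊖-≥ k≤m)
      go (no k≰m) = trans (negative (+ m -ᶻ + k) (trans (ℤₚ.[+m]-[+n]≡m⊖n m k) (ℤₚ.⊖-≰ k≰m)) (ℕₚ.m<n⇒0<n∸m m<k))
        (sym (⟦⟧-no (+ (p * q) ∣ᶻ? + m -ᶻ + k) λ d → ℕₚ.<⇒≢ m<k (∣ᶻ-small (ℕₚ.<-trans m<k k<pq) k<pq d)))
        where
        m<k = ℕₚ.≰⇒> k≰m
        negative : ∀ z {d} → z ≡ - + d → 0 < d → M z ≡ 0ℤ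
        negative _ {suc d} refl _ = refl

    W⁺-W : ∀ n → W⁺ (+ n) ≡ W (+ n)
    W⁺-W n = cong₂ _-ᶻ_ (∑-cong p λ j j<p → M-D n j (ℕₚ.<-trans j<p (ℕₚ.<-trans p<q q<pq)))
      (∑-cong p λ j j<p → trans (cong M (lem (+ n) (+ q) (+ j))) (trans (M-D n (q + j)
        (ℕₚ.<-trans (ℕₚ.+-monoʳ-< q j<p) (subst (_< p * q) (ℕₚ.+-comm p q) p+q<pq))) (sym (cong D (lem (+ n) (+ q) (+ j))))))
      where
      lem : ∀ n q j → n -ᶻ q -ᶻ j ≡ n -ᶻ (q +ᶻ j)
      lem = solve-∀

  series-negative : ∀ n → series -[1+ n ] ≡ 0ℤ
  series-negative n = ∑-zero (p * q) λ i _ → trans (cong (c (+ i) *ᶻ_)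
    (trans (cong (λ z → W⁺ (-[1+ n ] -ᶻ z)) (sym (ℤₚ.pos-* r i))) (negative-sub W⁺ W⁺-negative n (r * i)))) (ℤₚ.*-zeroʳ (c (+ i)))

  -- The cutoff in `a` originates here: `W⁺` vanishes for `ri > n` and agrees with `W` for `ri ≤ n`.
  series-a : ∀ n → series (+ n) ≡ a n
  series-a n = begin
    ∑ (p * q) F       ≡⟨ ∑-extend (p * q) K (λ i pq≤i _ → trans (cong (_*ᶻ W⁺ (+ n -ᶻ + r *ᶻ + i)) (c-large i pq≤i)) (ℤₚ.*-zeroˡ (W⁺ (+ n -ᶻ + r *ᶻ + i)))) ⟨
    ∑ (K + p * q) F   ≡⟨ cong (λ m → ∑ m F) (ℕₚ.+-comm K (p * q)) ⟩
    ∑ (p * q + K) F   ≡⟨ ∑-extend K (p * q) (λ i K≤i _ → trans (cong (c (+ i) *ᶻ_) (beyond i K≤i)) (ℤₚ.*-zeroʳ (c (+ i)))) ⟩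
    ∑ K F             ≡⟨ ∑-cong K (λ i i<K → cong (c (+ i) *ᶻ_) (within i i<K)) ⟩
    a n               ∎
    where
    K = suc (n DM./ r)
    F : ℕ → ℤ
    F i = c (+ i) *ᶻ W⁺ (+ n -ᶻ + r *ᶻ + i)
    beyond : ∀ i → K ≤ i → W⁺ (+ n -ᶻ + r *ᶻ + i) ≡ 0ℤ
    beyond i K≤i = go (r * i ∸ n) (ℕₚ.m+[n∸m]≡n (ℕₚ.<⇒≤ n<ri)) (ℕₚ.m<n⇒0<n∸m n<ri)
      where
      n<ri : n < r * i
      n<ri = ℕₚ.<-≤-trans (floor-< n r) (ℕₚ.*-monoʳ-≤ r K≤i)
      go : ∀ d → n + d ≡ r * i → 0 < d → W⁺ (+ n -ᶻ + r *ᶻ + i) ≡ 0ℤ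
      go (suc d) e _ = trans (cong W⁺ (sub-neg n r i (suc d) e)) (W⁺-negative d)
    within : ∀ i → i < K → W⁺ (+ n -ᶻ + r *ᶻ + i) ≡ W (+ n -ᶻ + r *ᶻ + i)
    within i i<K = trans (cong W⁺ e) (trans (W⁺-W (n ∸ r * i)) (sym (cong W e)))
      where
      ri≤n : r * i ≤ n
      ri≤n = ℕₚ.≤-trans (ℕₚ.*-monoʳ-≤ r (ℕₚ.≤-pred i<K)) (floor-≤ n r)
      e : + n -ᶻ + r *ᶻ + i ≡ + (n ∸ r * i)
      e = sub-pos n r i (n ∸ r * i) (ℕₚ.m+[n∸m]≡n ri≤n)

-- Values attained by the coefficients

trit-≤1 : ∀ x → Trit x → x ℤ.≤ 1ℤ
trit-≤1 (+ n)    n≤1 = ℤ.+≤+ n≤1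
trit-≤1 -[1+ n ] _   = ℤ.-≤+

bit-≥0 : ∀ {x} → Bit x → 0ℤ ℤ.≤ x
bit-≥0 (inj₁ refl) = ℤ.+≤+ z≤n
bit-≥0 (inj₂ refl) = ℤ.+≤+ z≤n

-- Upward steps of at most 1 cannot jump over an integer; downward steps do no harm, since the
-- search goes on from the next index.
rising : ∀ (f : ℕ → ℤ) → (∀ n → f (suc n) -ᶻ f n ℤ.≤ 1ℤ) → ∀ k n v → f n ℤ.≤ v → v ℤ.≤ f (k + n) → Σ ℕ λ j → j ≤ k + n × f j ≡ v
rising f step zero    n v lo hi = n , ℕₚ.≤-refl , ℤₚ.≤-antisym lo hi
rising f step (suc k) n v lo hi = go (f n ℤ.≟ v)
  where
  go : Dec (f n ≡ v) → Σ ℕ λ j → j ≤ suc k + n × f j ≡ v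
  go (yes e)  = n , ℕₚ.m≤n+m n (suc k) , e
  go (no neq) = let j , j≤ , e = rising f step k (suc n) v next (subst (λ m → v ℤ.≤ f m) (sym (ℕₚ.+-suc k n)) hi)
                in j , ℕₚ.≤-trans j≤ (ℕₚ.≤-reflexive (ℕₚ.+-suc k n)) , e
    where
    lem : ∀ x y → x -ᶻ y +ᶻ y ≡ x
    lem = solve-∀
    next : f (suc n) ℤ.≤ v
    next = ℤₚ.≤-trans (ℤₚ.≤-reflexive (sym (lem (f (suc n)) (f n))))
           (ℤₚ.≤-trans (ℤₚ.+-monoˡ-≤ (f n) (step n)) (ℤₚ.i<j⇒suc[i]≤j (ℤₚ.≤∧≢⇒< lo neq)))

-- The bound on `j` matters: between two indices within the degree the value is found within the
-- degree. A descent is an ascent of `−f`.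
intermediate : ∀ (f : ℕ → ℤ) → (∀ n → Trit (f (suc n) -ᶻ f n)) → ∀ m n v → f m ℤ.≤ v → v ℤ.≤ f n → Σ ℕ λ j → j ≤ m ℕ.⊔ n × f j ≡ v
intermediate f step m n v lo hi = go (ℕₚ.≤-total m n)
  where
  lem : ∀ x y → - x -ᶻ - y ≡ - (x -ᶻ y)
  lem = solve-∀
  go : m ≤ n ⊎ n ≤ m → Σ ℕ λ j → j ≤ m ℕ.⊔ n × f j ≡ v
  go (inj₁ m≤n) = let j , j≤ , e = rising f (λ i → trit-≤1 _ (step i)) (n ∸ m) m v lo (subst (λ k → v ℤ.≤ f k) (sym (ℕₚ.m∸n+n≡m m≤n)) hi)
                  in j , ℕₚ.≤-trans j≤ (ℕₚ.≤-trans (ℕₚ.≤-reflexive (ℕₚ.m∸n+n≡m m≤n)) (ℕₚ.m≤n⊔m m n)) , e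
  go (inj₂ n≤m) = let j , j≤ , e = rising (λ i → - f i) (λ i → trit-≤1 _ (subst Trit (sym (lem (f (suc i)) (f i))) (trit-neg {f (suc i) -ᶻ f i} (step i))))
                                     (m ∸ n) n (- v) (ℤₚ.neg-mono-≤ hi) (subst (λ k → - v ℤ.≤ - f k) (sym (ℕₚ.m∸n+n≡m n≤m)) (ℤₚ.neg-mono-≤ lo))
                  in j , ℕₚ.≤-trans j≤ (ℕₚ.≤-trans (ℕₚ.≤-reflexive (ℕₚ.m∸n+n≡m n≤m)) (ℕₚ.m≤m⊔n m n)) , ℤₚ.neg-injective e

module Attained (p q r : ℕ) .{{_ : NonZero p}} .{{_ : NonZero q}} .{{_ : NonZero r}}
                (p≥2 : 2 ≤ p) (p<q : p < q) (p⊥q : Coprime p q) (r⊥pq : Coprime r (p * q)) where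
  open Binary p q p≥2 p⊥q
  open Window p q p≥2 p<q p⊥q
  open Coefficients p q r p≥2 p<q p⊥q r⊥pq
  private
    instance
      pq≢0 : NonZero (p * q)
      pq≢0 = ℕₚ.m*n≢0 p q

    -- Replacing `t` by `rN + u` makes `u` the argument at which the term of index `N` reads `W`.
    Offset : ℕ → ℤ → Set
    Offset N t = Σ ℕ λ u → u < p * q × + (p * q) ∣ᶻ t -ᶻ + (r * N + u)

    offset : ∀ N t → Offset N t
    offset N t = x %ℕ (p * q) , n%ℕd<d x (p * q) , divides (x /ℕ (p * q))
      (linear (t -ᶻ + (r * N + x %ℕ (p * q))) ((x /ℕ (p * q)) *ᶻ + (p * q)) (1ℤ ⊛ a≡a%ℕn+[a/ℕn]*n x (p * q)) (lem t (+ (r * N)) (+ (x %ℕ (p * q))) ((x /ℕ (p * q)) *ᶻ + (p * q))))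
      where
      x = t -ᶻ + (r * N)
      lem : ∀ t m u z → t -ᶻ (m +ᶻ u) -ᶻ z ≡ 1ℤ *ᶻ (t -ᶻ m -ᶻ (u +ᶻ z))
      lem = solve-∀

    A-shift : ∀ N t n → + (p * q) ∣ᶻ t -ᶻ + n → A (+ r) N t ≡ A (+ r) N (+ n)
    A-shift N t n = A-cong (+ r) (+ r) N t (+ n) (divides 0ℤ (ℤₚ.+-inverseʳ (+ r)))

  -- Induction on the cutoff, with `t` moved to `n = rK + u`. If `u < r`, then `a n` has precisely
  -- this cutoff. If `u ≥ p + q`, the last term is zero and the induction hypothesis applies. The
  -- remaining case `r ≤ u < p + q` is settled by an intermediate value.
  attained : q < r → ∀ N t → Σ ℕ λ n → a n ≡ A (+ r) N t
  -- The empty sum is 0, the value of `a` at an index beyond the degree.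
  attained q<r zero t = p + q + r + p * q * r , a-vanish (p + q + r + p * q * r) (ℕₚ.m≤m+n (p + q + r + p * q * r) (p * q + p * r + q * r))
  attained q<r (suc K) t = go (offset K t)
    where
    go : Offset K t → Σ ℕ λ n → a n ≡ A (+ r) (suc K) t
    go (u , u<pq , pq∣) = near (u ℕ.<? r)
      where
      n = r * K + u
      rK≤n : r * K ≤ n
      rK≤n = ℕₚ.m≤m+n (r * K) u
      W-n : W (+ n -ᶻ + r *ᶻ + K) ≡ W (+ u)
      W-n = cong W (sub-pos n r K u refl)
      near : Dec (u < r) → Σ ℕ λ n → a n ≡ A (+ r) (suc K) t
      near (yes u<r) = n , trans
        (a-floor n K rK≤n (ℕₚ.<-≤-trans (ℕₚ.+-monoʳ-< (r * K) u<r) (ℕₚ.≤-reflexive (trans (ℕₚ.+-comm (r * K) r) (sym (ℕₚ.*-suc r K))))))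
        (sym (A-shift (suc K) t n pq∣))
      near (no u≮r) = wide (u ℕ.<? p + q)
        where
        r≤u = ℕₚ.≮⇒≥ u≮r
        W-u : W (+ n -ᶻ + r *ᶻ + K) ≡ - ⟦ u ℕ.<? p + q ⟧
        W-u = trans W-n (W-right u (ℕₚ.≤-trans (ℕₚ.<⇒≤ q<r) r≤u) u<pq)
        wide : Dec (u < p + q) → Σ ℕ λ n → a n ≡ A (+ r) (suc K) t
        wide (no u≮) = let m , e = attained q<r K t in m , trans e (trans (A-shift K t n pq∣) (trans (sym (ℤₚ.+-identityʳ _))
          (trans (cong (A (+ r) K (+ n) +ᶻ_) (sym (trans (cong (c (+ K) *ᶻ_) (trans W-u (cong -_ (⟦⟧-no (u ℕ.<? p + q) u≮)))) (ℤₚ.*-zeroʳ (c (+ K))))))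
                 (sym (A-shift (suc K) t n pq∣)))))
        wide (yes u<) = between (B-bit (+ K))
          where
          -- Since `q < r ≤ u < p + q`, the argument of the next term is `w < p`: index `K` meets
          -- the negative block and index `K + 1` the positive one.
          w = u ∸ r
          w<p : w < p
          w<p = ℕₚ.+-cancelʳ-< r w p (subst (_< p + r) (sym (ℕₚ.m∸n+n≡m r≤u)) (ℕₚ.<-trans u< (ℕₚ.+-monoʳ-< p q<r)))
          n≡ : r * suc K + w ≡ n
          n≡ = trans (cong (_+ w) (trans (ℕₚ.*-suc r K) (ℕₚ.+-comm r (r * K)))) (trans (ℕₚ.+-assoc (r * K) r w) (cong (λ x → r * K + x) (ℕₚ.m+[n∸m]≡n r≤u)))
          m = proj₁ (attained q<r K t)
          x y z : ℤ
          x = A (+ r) K (+ n)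
          y = A (+ r) (suc K) (+ n)
          z = A (+ r) (suc (suc K)) (+ n)
          am : a m ≡ x
          am = trans (proj₂ (attained q<r K t)) (A-shift K t n pq∣)
          an : a n ≡ z
          an = a-floor n (suc K) (subst (r * suc K ≤_) n≡ (ℕₚ.m≤m+n (r * suc K) w))
            (subst (_< r * suc (suc K)) n≡ (ℕₚ.<-≤-trans (ℕₚ.+-monoʳ-< (r * suc K) (ℕₚ.<-trans w<p (ℕₚ.<-trans p<q q<r)))
              (ℕₚ.≤-reflexive (trans (ℕₚ.+-comm (r * suc K) r) (sym (ℕₚ.*-suc r (suc K)))))))
          b₀ b₁ b₂ : ℤ
          b₀ = B (+ K -ᶻ 1ℤ)
          b₁ = B (+ K)
          b₂ = B (+ suc K)
          lem₁ : ∀ a b x → x +ᶻ (b -ᶻ a) *ᶻ - 1ℤ ≡ x +ᶻ (a -ᶻ b)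
          lem₁ = solve-∀
          y≡ : y ≡ x +ᶻ (b₀ -ᶻ b₁)
          y≡ = trans (cong (λ e → x +ᶻ c (+ K) *ᶻ e) (trans W-u (cong -_ (⟦⟧-yes (u ℕ.<? p + q) u<)))) (lem₁ b₀ b₁ x)
          z≡ : z ≡ y +ᶻ (b₂ -ᶻ b₁)
          z≡ = cong (λ e → y +ᶻ e) (trans (cong (c (+ suc K) *ᶻ_) (trans (cong W (sub-pos n r (suc K) w n≡))
                 (trans (W-left w (ℕₚ.<-trans w<p p<q)) (⟦⟧-yes (w ℕ.<? p) w<p)))) (ℤₚ.*-identityʳ (c (+ suc K))))
          up : ∀ {v e} → 0ℤ ℤ.≤ e → v ℤ.≤ v +ᶻ e
          up {v} {e} 0≤e = subst (ℤ._≤ v +ᶻ e) (ℤₚ.+-identityʳ v) (ℤₚ.+-monoʳ-≤ v 0≤e)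
          down : ∀ {v e} → e ℤ.≤ 0ℤ → v +ᶻ e ℤ.≤ v
          down {v} {e} e≤0 = subst (v +ᶻ e ℤ.≤_) (ℤₚ.+-identityʳ v) (ℤₚ.+-monoʳ-≤ v e≤0)
          nonneg : ∀ {b} → Bit b → ∀ {e} → e ≡ 0ℤ → 0ℤ ℤ.≤ b -ᶻ e
          nonneg {b} bit refl = subst (0ℤ ℤ.≤_) (sym (ℤₚ.+-identityʳ b)) (bit-≥0 bit)
          nonpos : ∀ {b} → Bit b → ∀ {e} → e ≡ 1ℤ → b -ᶻ e ℤ.≤ 0ℤ
          nonpos (inj₁ refl) refl = ℤ.-≤+
          nonpos (inj₂ refl) refl = ℤ.+≤+ z≤n
          -- B(K−1) − B(K) and B(K+1) − B(K) have the same sign, so y lies between the attained values x and z.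
          between : Bit b₁ → Σ ℕ λ n → a n ≡ A (+ r) (suc K) t
          between (inj₁ e) = let j , _ , aj = intermediate a a-neighbour m n y
                                     (subst₂ ℤ._≤_ (sym am) (sym y≡) (up (nonneg (B-bit (+ K -ᶻ 1ℤ)) e)))
                                     (subst (y ℤ.≤_) (sym (trans an z≡)) (up (nonneg (B-bit (+ suc K)) e)))
                             in j , trans aj (sym (A-shift (suc K) t n pq∣))
          between (inj₂ e) = let j , _ , aj = intermediate a a-neighbour n m y
                                     (subst (ℤ._≤ y) (sym (trans an z≡)) (down (nonpos (B-bit (+ suc K)) e)))
                                     (subst₂ ℤ._≤_ (sym y≡) (sym am) (down (nonpos (B-bit (+ K -ᶻ 1ℤ)) e)))
                             in j , trans aj (sym (A-shift (suc K) t n pq∣))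

  private
    -- Cut off by a monotone indicator, a block of c still telescopes to a difference of two values of B.
    module Block (w : ℕ → ℤ) (w-bit : ∀ i → Bit (w i)) (w-mono : ∀ i → w i ≡ 1ℤ → w (suc i) ≡ 1ℤ) (N : ℕ) where
      S : ℕ → ℤ
      S k = ∑ (k + N) (λ i → c (+ i) *ᶻ w i) -ᶻ ∑ N (λ i → c (+ i) *ᶻ w i)

      Partial : ℕ → Set
      Partial k = S k ≡ 0ℤ ⊎ (w (k + N) ≡ 1ℤ × Σ ℤ λ z → S k ≡ B (+ (k + N) -ᶻ 1ℤ) -ᶻ B z)

      S-suc : ∀ k → S (suc k) ≡ S k +ᶻ c (+ (k + N)) *ᶻ w (k + N)
      S-suc k = lem (∑ (k + N) (λ i → c (+ i) *ᶻ w i)) (∑ N (λ i → c (+ i) *ᶻ w i)) (c (+ (k + N)) *ᶻ w (k + N))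
        where
        lem : ∀ a b x → a +ᶻ x -ᶻ b ≡ a -ᶻ b +ᶻ x
        lem = solve-∀

      partial : ∀ k → Partial k
      partial zero    = inj₁ (ℤₚ.+-inverseʳ (∑ N (λ i → c (+ i) *ᶻ w i)))
      partial (suc k) = go (partial k) (w-bit (k + N))
        where
        lem₀ : ∀ a b → 0ℤ +ᶻ (a -ᶻ b) *ᶻ 1ℤ ≡ a -ᶻ b
        lem₀ = solve-∀
        lem₁ : ∀ a b z → b -ᶻ z +ᶻ (a -ᶻ b) *ᶻ 1ℤ ≡ a -ᶻ z
        lem₁ = solve-∀
        go : Partial k → Bit (w (k + N)) → Partial (suc k)
        go (inj₁ s) (inj₁ e) = inj₁ (trans (S-suc k) (cong₂ _+ᶻ_ s (trans (cong (c (+ (k + N)) *ᶻ_) e) (ℤₚ.*-zeroʳ (c (+ (k + N)))))))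
        go (inj₁ s) (inj₂ e) = inj₂ (w-mono (k + N) e , + (k + N) -ᶻ 1ℤ ,
          trans (S-suc k) (trans (cong₂ (λ y z → y +ᶻ c (+ (k + N)) *ᶻ z) s e) (lem₀ (B (+ (k + N))) (B (+ (k + N) -ᶻ 1ℤ)))))
        go (inj₂ (e , z , s)) _ = inj₂ (w-mono (k + N) e , z ,
          trans (S-suc k) (trans (cong₂ (λ y z → y +ᶻ c (+ (k + N)) *ᶻ z) s e) (lem₁ (B (+ (k + N))) (B (+ (k + N) -ᶻ 1ℤ)) (B z))))

      block-trit : ∀ k → Trit (S k)
      block-trit k = go (partial k)
        where
        go : Partial k → Trit (S k)
        go (inj₁ s)           = subst Trit (sym s) z≤n
        go (inj₂ (_ , z , s)) = subst Trit (sym s) (bit-sub (B-bit (+ (k + N) -ᶻ 1ℤ)) (B-bit z))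

    ∑-diff-cong : ∀ k N {f g : ℕ → ℤ} → (∀ i → N ≤ i → i < k + N → f i ≡ g i) → ∑ (k + N) f -ᶻ ∑ N f ≡ ∑ (k + N) g -ᶻ ∑ N g
    ∑-diff-cong zero    N {f} {g} h = trans (ℤₚ.+-inverseʳ (∑ N f)) (sym (ℤₚ.+-inverseʳ (∑ N g)))
    ∑-diff-cong (suc k) N {f} {g} h = trans (lem (∑ (k + N) f) (∑ N f) (f (k + N)))
      (trans (cong₂ _+ᶻ_ (∑-diff-cong k N {f} {g} λ i N≤i i< → h i N≤i (ℕₚ.m<n⇒m<1+n i<)) (h (k + N) (ℕₚ.m≤n+m N k) ℕₚ.≤-refl))
             (sym (lem (∑ (k + N) g) (∑ N g) (g (k + N)))))
      where
      lem : ∀ a b x → a +ᶻ x -ᶻ b ≡ a -ᶻ b +ᶻ x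
      lem = solve-∀

    threshold : ∀ n e → (∀ i → Bit ⟦ n ℕ.<? e + r * i ⟧) × (∀ i → ⟦ n ℕ.<? e + r * i ⟧ ≡ 1ℤ → ⟦ n ℕ.<? e + r * suc i ⟧ ≡ 1ℤ)
    threshold n e = (λ i → ⟦⟧-bit (n ℕ.<? e + r * i)) , λ i → mono i (n ℕ.<? e + r * i)
      where
      mono : ∀ i (d : Dec (n < e + r * i)) → ⟦ d ⟧ ≡ 1ℤ → ⟦ n ℕ.<? e + r * suc i ⟧ ≡ 1ℤ
      mono i (yes lt) _ = ⟦⟧-yes (n ℕ.<? e + r * suc i) (ℕₚ.<-≤-trans lt (ℕₚ.+-monoʳ-≤ e (ℕₚ.*-monoʳ-≤ r (ℕₚ.n≤1+n i))))
      mono i (no _) ()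

    gap-<-iff : ∀ n e i → r * i ≤ n → ⟦ n ∸ r * i ℕ.<? e ⟧ ≡ ⟦ n ℕ.<? e + r * i ⟧
    gap-<-iff n e i ri≤n = ⟦⟧-cong (n ∸ r * i ℕ.<? e) (n ℕ.<? e + r * i)
      (λ lt → subst (_< e + r * i) (ℕₚ.m∸n+n≡m ri≤n) (ℕₚ.+-monoˡ-< (r * i) lt))
      (λ lt → ℕₚ.+-cancelʳ-< (r * i) (n ∸ r * i) e (subst (_< e + r * i) (sym (ℕₚ.m∸n+n≡m ri≤n)) lt))

    -- The added indices have `n − ri` in `[0, q)`, where `W` is the indicator of `n < p + ri`,
    -- monotone in `i`.
    A-left : ∀ n N k → n < r * N + q → r * (k + N) ≤ n + r → Trit (A (+ r) (k + N) (+ n) -ᶻ A (+ r) N (+ n))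
    A-left n N k n<rN+q hi = subst Trit (sym (∑-diff-cong k N λ i N≤i i<k+N → cong (c (+ i) *ᶻ_) (value i N≤i i<k+N))) (block-trit k)
      where
      open Block (λ i → ⟦ n ℕ.<? p + r * i ⟧) (proj₁ (threshold n p)) (proj₂ (threshold n p)) N
      value : ∀ i → N ≤ i → i < k + N → W (+ n -ᶻ + r *ᶻ + i) ≡ ⟦ n ℕ.<? p + r * i ⟧
      value i N≤i i<k+N = trans (cong W (sub-pos n r i (n ∸ r * i) (ℕₚ.m+[n∸m]≡n ri≤n)))
        (trans (W-left (n ∸ r * i) (ℕₚ.+-cancelʳ-< (r * i) (n ∸ r * i) q (subst (_< q + r * i) (sym (ℕₚ.m∸n+n≡m ri≤n))
                 (ℕₚ.<-≤-trans n<rN+q (ℕₚ.≤-trans (ℕₚ.+-monoˡ-≤ q (ℕₚ.*-monoʳ-≤ r N≤i)) (ℕₚ.≤-reflexive (ℕₚ.+-comm (r * i) q)))))))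
               (gap-<-iff n p i ri≤n))
        where
        ri≤n : r * i ≤ n
        ri≤n = ℕₚ.+-cancelʳ-≤ r (r * i) n (ℕₚ.≤-trans (ℕₚ.≤-reflexive (trans (ℕₚ.+-comm (r * i) r) (sym (ℕₚ.*-suc r i)))) (ℕₚ.≤-trans (ℕₚ.*-monoʳ-≤ r i<k+N) hi))

    -- The added indices have `n − ri` in `[q, pq)`, where `−W` is the indicator of
    -- `n < p + q + ri`, monotone in `i`.
    A-right : ∀ n N k → n < r * N + p * q → r * (k + N) + q ≤ n + r → Trit (A (+ r) (k + N) (+ n) -ᶻ A (+ r) N (+ n))
    A-right n N k n<rN+pq hi = subst Trit (sym (trans (∑-diff-cong k N λ i N≤i i<k+N → trans (cong (c (+ i) *ᶻ_) (value i N≤i i<k+N)) (lem (c (+ i)) ⟦ n ℕ.<? p + q + r * i ⟧))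
        (trans (cong₂ _-ᶻ_ (∑-neg (k + N) F) (∑-neg N F)) (lem₂ (∑ (k + N) F) (∑ N F)))))
      (trit-neg {S k} (block-trit k))
      where
      open Block (λ i → ⟦ n ℕ.<? p + q + r * i ⟧) (proj₁ (threshold n (p + q))) (proj₂ (threshold n (p + q))) N
      F : ℕ → ℤ
      F i = c (+ i) *ᶻ ⟦ n ℕ.<? p + q + r * i ⟧
      lem : ∀ a b → a *ᶻ - b ≡ - (a *ᶻ b)
      lem = solve-∀
      lem₂ : ∀ a b → - a -ᶻ - b ≡ - (a -ᶻ b)
      lem₂ = solve-∀
      value : ∀ i → N ≤ i → i < k + N → W (+ n -ᶻ + r *ᶻ + i) ≡ - ⟦ n ℕ.<? p + q + r * i ⟧
      value i N≤i i<k+N = trans (cong W (sub-pos n r i (n ∸ r * i) (ℕₚ.m+[n∸m]≡n ri≤n)))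
        (trans (W-right (n ∸ r * i)
                 (ℕₚ.+-cancelˡ-≤ (r * i) q (n ∸ r * i) (ℕₚ.≤-trans ri+q≤n (ℕₚ.≤-reflexive (sym (ℕₚ.m+[n∸m]≡n ri≤n)))))
                 (ℕₚ.+-cancelʳ-< (r * i) (n ∸ r * i) (p * q) (subst (_< p * q + r * i) (sym (ℕₚ.m∸n+n≡m ri≤n))
                 (ℕₚ.<-≤-trans n<rN+pq (ℕₚ.≤-trans (ℕₚ.+-monoˡ-≤ (p * q) (ℕₚ.*-monoʳ-≤ r N≤i)) (ℕₚ.≤-reflexive (ℕₚ.+-comm (r * i) (p * q))))))))
               (cong -_ (gap-<-iff n (p + q) i ri≤n)))
        where
        ri+q≤n : r * i + q ≤ n
        ri+q≤n = ℕₚ.+-cancelʳ-≤ r (r * i + q) n (ℕₚ.≤-trans (ℕₚ.≤-reflexive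
          (trans (ℕₚ.+-comm (r * i + q) r) (trans (sym (ℕₚ.+-assoc r (r * i) q)) (cong (_+ q) (sym (ℕₚ.*-suc r i))))))
          (ℕₚ.≤-trans (ℕₚ.+-monoˡ-≤ q (ℕₚ.*-monoʳ-≤ r i<k+N)) hi))
        ri≤n : r * i ≤ n
        ri≤n = ℕₚ.≤-trans (ℕₚ.m≤m+n (r * i) q) ri+q≤n

    abs-near : ∀ x y → Trit (x -ᶻ y) → ∣ x ∣ ≤ ∣ y ∣ + 1
    abs-near x y tr = ℕₚ.≤-trans (ℕₚ.≤-reflexive (cong ∣_∣ (lem x y))) (ℕₚ.≤-trans (ℤₚ.∣i+j∣≤∣i∣+∣j∣ y (x -ᶻ y)) (ℕₚ.+-monoʳ-≤ ∣ y ∣ tr))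
      where
      lem : ∀ x y → x ≡ y +ᶻ (x -ᶻ y)
      lem = solve-∀

    trit-flip : ∀ x y → Trit (x -ᶻ y) → Trit (y -ᶻ x)
    trit-flip x y tr = ℕₚ.≤-trans (ℕₚ.≤-reflexive (ℤₚ.∣i-j∣≡∣j-i∣ y x)) tr

  -- The windows met between two consecutive n with the same residue mod pq are first negative, then positive,
  -- so A r N t differs by a single block from its value at one of the two ends.
  nearly-attained : ∀ N t → Σ ℕ λ n → ∣ A (+ r) N t ∣ ≤ ∣ a n ∣ + 1
  nearly-attained N t = go (offset N t)
    where
    go : Offset N t → Σ ℕ λ n → ∣ A (+ r) N t ∣ ≤ ∣ a n ∣ + 1
    go (u , u<pq , pq∣) = side (u ℕ.<? q)
      where
      n = r * N + u
      conclude : ∀ m x → Trit (A (+ r) N (+ n) -ᶻ x) → ∣ x ∣ ≤ ∣ a m ∣ → Σ ℕ λ n → ∣ A (+ r) N t ∣ ≤ ∣ a n ∣ + 1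
      conclude m x tr x≤ = m , subst (λ z → ∣ z ∣ ≤ ∣ a m ∣ + 1) (sym (A-shift N t n pq∣))
        (ℕₚ.≤-trans (abs-near (A (+ r) N (+ n)) x tr) (ℕₚ.+-monoˡ-≤ 1 x≤))
      side : Dec (u < q) → Σ ℕ λ n → ∣ A (+ r) N t ∣ ≤ ∣ a n ∣ + 1
      -- The sum is lengthened to the cutoff of `a n`; the indices on the way have
      -- `0 ≤ n − ri ≤ u < q`.
      side (yes u<q) = conclude n (a n) (trit-flip (a n) (A (+ r) N (+ n)) (subst (λ k → Trit (A (+ r) k (+ n) -ᶻ A (+ r) N (+ n))) K≡
          (A-left n N (K ∸ N) (ℕₚ.+-monoʳ-< (r * N) u<q) (ℕₚ.≤-trans (ℕₚ.≤-reflexive (cong (r *_) K≡))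
            (ℕₚ.≤-trans (ℕₚ.≤-reflexive (ℕₚ.*-suc r (n DM./ r))) (ℕₚ.≤-trans (ℕₚ.+-monoʳ-≤ r (floor-≤ n r)) (ℕₚ.≤-reflexive (ℕₚ.+-comm r n)))))))) ℕₚ.≤-refl
        where
        K = suc (n DM./ r)
        N≤K : N ≤ K
        N≤K = ℕₚ.<⇒≤ (ℕₚ.*-cancelˡ-< r N K (ℕₚ.≤-<-trans (ℕₚ.m≤m+n (r * N) u) (floor-< n r)))
        K≡ : K ∸ N + N ≡ K
        K≡ = ℕₚ.m∸n+n≡m N≤K
      side (no u≮q) = early (p * q ℕ.≤? n)
        where
        q≤u = ℕₚ.≮⇒≥ u≮q
        hi : r * N + q ≤ n + r
        hi = ℕₚ.≤-trans (ℕₚ.+-monoʳ-≤ (r * N) q≤u) (ℕₚ.m≤m+n n r)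
        early : Dec (p * q ≤ n) → Σ ℕ λ n → ∣ A (+ r) N t ∣ ≤ ∣ a n ∣ + 1
        -- There is no smaller natural number in the residue class, so the comparison is with the
        -- empty sum; the index 0 is arbitrary, as 0 is bounded by any absolute value.
        early (no pq≰n) = conclude 0 0ℤ (subst (λ k → Trit (A (+ r) k (+ n) -ᶻ 0ℤ)) (ℕₚ.+-identityʳ N)
          (A-right n 0 N (ℕₚ.<-≤-trans (ℕₚ.≰⇒> pq≰n) (ℕₚ.m≤n+m (p * q) (r * 0))) (ℕₚ.≤-trans (ℕₚ.≤-reflexive (cong (λ k → r * k + q) (ℕₚ.+-identityʳ N))) hi))) z≤n
        -- The sum is shortened to the cutoff of `m = n − pq`; the indices on the way have
        -- `q ≤ n − ri < pq`.
        early (yes pq≤n) = conclude m (A (+ r) K (+ n)) (subst (λ k → Trit (A (+ r) k (+ n) -ᶻ A (+ r) K (+ n))) N≡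
            (A-right n K (N ∸ K) n<rK+pq (ℕₚ.≤-trans (ℕₚ.≤-reflexive (cong (λ k → r * k + q) N≡)) hi)))
            (ℕₚ.≤-reflexive (cong ∣_∣ (A-shift K (+ n) m (divides 1ℤ (linear (+ n -ᶻ + m) (1ℤ *ᶻ + (p * q)) (- 1ℤ ⊛ cast) (lem (+ n) (+ m) (+ (p * q))))))))
          where
          m = n ∸ p * q
          K = suc (m DM./ r)
          cast : + m +ᶻ + (p * q) ≡ + n
          cast = cong (λ z → + z) (ℕₚ.m∸n+n≡m pq≤n)
          lem : ∀ n m x → n -ᶻ m -ᶻ 1ℤ *ᶻ x ≡ - 1ℤ *ᶻ (m +ᶻ x -ᶻ n)
          lem = solve-∀
          m<rN : m < r * N
          m<rN = ℕₚ.+-cancelʳ-< (p * q) m (r * N) (subst (_< r * N + p * q) (sym (ℕₚ.m∸n+n≡m pq≤n)) (ℕₚ.+-monoʳ-< (r * N) u<pq))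
          K≤N : K ≤ N
          K≤N = ℕₚ.*-cancelˡ-< r (m DM./ r) N (ℕₚ.≤-<-trans (floor-≤ m r) m<rN)
          N≡ : N ∸ K + K ≡ N
          N≡ = ℕₚ.m∸n+n≡m K≤N
          n<rK+pq : n < r * K + p * q
          n<rK+pq = subst (_< r * K + p * q) (ℕₚ.m∸n+n≡m pq≤n) (ℕₚ.+-monoˡ-< (p * q) (floor-< m r))

-- Coefficient lists

coeff-map-upTo : ∀ (g : ℕ → ℤ) n j → j < n → coeff (map g (upTo n)) j ≡ g j
coeff-map-upTo g n = go n (λ i → i)
  where
  go : ∀ n (f : ℕ → ℕ) j → j < n → coeff (map g (applyUpTo f n)) j ≡ g (f j)
  go (suc n) f zero    _   = refl
  go (suc n) f (suc j) j<n = go n (f ∘ suc) j (ℕₚ.≤-pred j<n)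

sumℤ-map-upTo : ∀ (g : ℕ → ℤ) n → sumℤ (map g (upTo n)) ≡ ∑ n g
sumℤ-map-upTo g n = go n (λ i → i)
  where
  go : ∀ n (f : ℕ → ℕ) → sumℤ (map g (applyUpTo f n)) ≡ ∑ n (g ∘ f)
  go zero    f = refl
  go (suc n) f = trans (cong (g (f 0) +ᶻ_) (go n (f ∘ suc))) (sym (∑-head n (g ∘ f)))

length-map-upTo : ∀ (g : ℕ → ℤ) n → length (map g (upTo n)) ≡ n
length-map-upTo g n = trans (L.length-map g (upTo n)) (L.length-upTo n)

coeff-overflow : ∀ f j → length f ≤ j → coeff f j ≡ 0ℤ
coeff-overflow []      j       _   = refl
coeff-overflow (x ∷ f) (suc j) f≤j = coeff-overflow f j (ℕₚ.≤-pred f≤j)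

∈⇒coeff : ∀ {f v} → v ∈ f → Σ ℕ λ j → j < length f × coeff f j ≡ v
∈⇒coeff (here refl) = 0 , s≤s z≤n , refl
∈⇒coeff (there v∈f) = let j , j< , e = ∈⇒coeff v∈f in suc j , s≤s j< , e

coeff⇒∈ : ∀ f j → j < length f → coeff f j ∈ f
coeff⇒∈ (x ∷ f) zero    _  = here refl
coeff⇒∈ (x ∷ f) (suc j) j< = there (coeff⇒∈ f j (ℕₚ.≤-pred j<))

∣coeff∣≤H : ∀ f j → ∣ coeff f j ∣ ≤ H f
∣coeff∣≤H []      j       = z≤n
∣coeff∣≤H (x ∷ f) zero    = ℕₚ.m≤m⊔n ∣ x ∣ (H f)
∣coeff∣≤H (x ∷ f) (suc j) = ℕₚ.≤-trans (∣coeff∣≤H f j) (ℕₚ.m≤n⊔m ∣ x ∣ (H f))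

H-least : ∀ f h → (∀ j → ∣ coeff f j ∣ ≤ h) → H f ≤ h
H-least []      h _  = z≤n
H-least (x ∷ f) h le = ℕₚ.⊔-lub (le 0) (H-least f h (le ∘ suc))

coeff-normalize : ∀ f j → coeff (normalize f) j ≡ coeff f j
coeff-normalize f j = sym (trans (cong (λ g → coeff g j) split) (strip (normalize f) (reverse zs) j (Permₚ.All-resp-↭ (Perm.↭-sym (Permₚ.↭-reverse zs)) (Allₚ.all-takeWhile (ℤ._≟ 0ℤ) (reverse f)))))
  where
  zs = takeWhile (ℤ._≟ 0ℤ) (reverse f)
  split : f ≡ normalize f ++ reverse zs
  split = trans (sym (L.reverse-involutive f)) (trans (cong reverse (sym (L.takeWhile++dropWhile (ℤ._≟ 0ℤ) (reverse f))))
    (L.reverse-++ zs (dropWhile (ℤ._≟ 0ℤ) (reverse f))))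
  zeros : ∀ ys j → All (_≡ 0ℤ) ys → coeff ys j ≡ 0ℤ
  zeros []       j       _          = refl
  zeros (y ∷ ys) zero    (y≡0 ∷ _)  = y≡0
  zeros (y ∷ ys) (suc j) (_ ∷ ys≡0) = zeros ys j ys≡0
  strip : ∀ xs ys j → All (_≡ 0ℤ) ys → coeff (xs ++ ys) j ≡ coeff xs j
  strip []       ys j       ys≡0 = zeros ys j ys≡0
  strip (x ∷ xs) ys zero    ys≡0 = refl
  strip (x ∷ xs) ys (suc j) ys≡0 = strip xs ys j ys≡0

seq : Poly → ℤ → ℤ
seq f (+ n)    = coeff f n
seq f -[1+ n ] = 0ℤ

seq-sub : ∀ f k d → k < d → seq f (+ k -ᶻ + d) ≡ 0ℤ
seq-sub f k d k<d = go (d ∸ k) (ℕₚ.m<n⇒0<n∸m k<d) (trans (ℤₚ.[+m]-[+n]≡m⊖n k d) (ℤₚ.⊖-< k<d))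
  where
  go : ∀ x {z} → 0 < x → z ≡ - + x → seq f z ≡ 0ℤ
  go (suc x) _ refl = refl

seq-sub′ : ∀ f k d → d ≤ k → seq f (+ k -ᶻ + d) ≡ coeff f (k ∸ d)
seq-sub′ f k d d≤k = cong (seq f) (trans (ℤₚ.[+m]-[+n]≡m⊖n k d) (ℤₚ.⊖-≥ d≤k))

private
  monomial : ℕ → Poly
  monomial e = replicate e 0ℤ ++ [ 1ℤ ]

  length-monomial : ∀ e → length (monomial e) ≡ suc e
  length-monomial zero    = refl
  length-monomial (suc e) = cong suc (length-monomial e)

  coeff-monomial : ∀ e i → coeff (monomial e) i ≡ ⟦ i ℕ.≟ e ⟧
  coeff-monomial zero    zero    = refl
  coeff-monomial zero    (suc i) = sym (⟦⟧-no (suc i ℕ.≟ 0) λ ())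
  coeff-monomial (suc e) zero    = refl
  coeff-monomial (suc e) (suc i) = trans (coeff-monomial e i) (⟦⟧-cong (i ℕ.≟ e) (suc i ℕ.≟ suc e) (cong suc) ℕₚ.suc-injective)

  -- Only the constant term `−1` and the leading term `1` of `xPow-1 (suc e)` contribute.
  convolution : ∀ e f k → ∑ (suc k) (λ i → coeff (xPow-1 (suc e)) i *ᶻ coeff f (k ∸ i)) ≡ ∇ (suc e) (seq f) (+ k)
  convolution e f k = trans (∑-head k (λ i → coeff (xPow-1 (suc e)) i *ᶻ coeff f (k ∸ i)))
    (trans (cong (- 1ℤ *ᶻ coeff f k +ᶻ_) (tail (e ℕ.<? k))) (lem (coeff f k) (seq f (+ k -ᶻ + suc e))))
    where
    lem : ∀ x y → - 1ℤ *ᶻ x +ᶻ y ≡ y -ᶻ x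
    lem = solve-∀
    F : ℕ → ℤ
    F i = coeff (monomial e) i *ᶻ coeff f (k ∸ suc i)
    other : ∀ i → i ≢ e → F i ≡ 0ℤ
    other i i≢e = trans (cong (_*ᶻ coeff f (k ∸ suc i)) (trans (coeff-monomial e i) (⟦⟧-no (i ℕ.≟ e) i≢e))) (ℤₚ.*-zeroˡ (coeff f (k ∸ suc i)))
    tail : Dec (e < k) → ∑ k F ≡ seq f (+ k -ᶻ + suc e)
    tail (yes e<k) = trans (∑-single k e e<k λ i _ → other i)
      (trans (cong (_*ᶻ coeff f (k ∸ suc e)) (trans (coeff-monomial e e) (⟦⟧-yes (e ℕ.≟ e) refl)))
      (trans (ℤₚ.*-identityˡ (coeff f (k ∸ suc e))) (sym (seq-sub′ f k (suc e) e<k))))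
    tail (no e≮k)  = trans (∑-zero k λ i i<k → other i λ { refl → e≮k i<k }) (sym (seq-sub f k (suc e) (s≤s (ℕₚ.≮⇒≥ e≮k))))

length-xPow-1· : ∀ e f → 0 < length f → length (xPow-1 (suc e) · f) ≡ suc e + length f
length-xPow-1· e f@(x ∷ xs) _ = trans (length-map-upTo _ (suc (length (monomial e)) + length f ∸ 1)) (cong (_+ length f) (length-monomial e))

seq-xPow-1· : ∀ e f → 0 < length f → ∀ n → seq (xPow-1 (suc e) · f) n ≡ ∇ (suc e) (seq f) n
seq-xPow-1· e f          0<f -[1+ n ] = refl
seq-xPow-1· e f@(x ∷ xs) 0<f (+ k)    = go (k ℕ.<? length g)
  where
  g = xPow-1 (suc e) · f
  value : ℕ → ℤ
  value k = sumℤ (map (λ i → coeff (xPow-1 (suc e)) i *ᶻ coeff f (k ∸ i)) (upTo (suc k)))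
  go : Dec (k < length g) → coeff g k ≡ ∇ (suc e) (seq f) (+ k)
  go (yes k<g) = trans (coeff-map-upTo value (suc (length (monomial e)) + length f ∸ 1) k (subst (k <_) (length-map-upTo value (suc (length (monomial e)) + length f ∸ 1)) k<g))
    (trans (sumℤ-map-upTo (λ i → coeff (xPow-1 (suc e)) i *ᶻ coeff f (k ∸ i)) (suc k)) (convolution e f k))
  go (no k≮g)  = trans (coeff-overflow g k (ℕₚ.≮⇒≥ k≮g)) (sym (cong₂ _-ᶻ_
      (trans (seq-sub′ f k (suc e) (ℕₚ.m+n≤o⇒m≤o (suc e) big)) (coeff-overflow f (k ∸ suc e) (ℕₚ.m+n≤o⇒m≤o∸n (length f) (subst (_≤ k) (ℕₚ.+-comm (suc e) (length f)) big))))
      (coeff-overflow f k (ℕₚ.≤-trans (ℕₚ.m≤n+m (length f) (suc e)) big))))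
    where
    big : suc e + length f ≤ k
    big = subst (_≤ k) (length-xPow-1· e f 0<f) (ℕₚ.≮⇒≥ k≮g)

-- Products of the factors x^d - 1 and exact division by them.

∇* : List ℕ → (ℤ → ℤ) → ℤ → ℤ
∇* []       g = g
∇* (d ∷ ds) g = ∇ d (∇* ds g)

∇*-↭ : ∀ {ds es} → ds ↭ es → ∀ (g : ℤ → ℤ) n → ∇* ds g n ≡ ∇* es g n
∇*-↭ Perm.refl              g n = refl
∇*-↭ (Perm.prep d ds↭es)    g n = ∇-cong d (∇*-↭ ds↭es g) n
∇*-↭ (Perm.swap {xs = ds} d e ds↭es) g n = trans (∇-comm d e (∇* ds g) n) (∇-cong e (∇-cong d (∇*-↭ ds↭es g)) n)
∇*-↭ (Perm.trans ds↭ fs↭es) g n = trans (∇*-↭ ds↭ g n) (∇*-↭ fs↭es g n)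

Causal : (ℤ → ℤ) → Set
Causal g = ∀ n → g -[1+ n ] ≡ 0ℤ

∇-causal : ∀ d {g} → Causal g → Causal (∇ d g)
∇-causal zero    {g} g0 n = cong₂ _-ᶻ_ (g0 n) (g0 n)
∇-causal (suc d) {g} g0 n = cong₂ _-ᶻ_ (g0 (suc (n + d))) (g0 n)

∇*-causal : ∀ ds {g} → Causal g → Causal (∇* ds g)
∇*-causal []       g0 = g0
∇*-causal (d ∷ ds) {g} g0 = ∇-causal d {∇* ds g} (∇*-causal ds g0)

numerator : List ℕ → Poly
numerator = foldr (λ d f → xPow-1 d · f) [ 1ℤ ]

length-numerator : ∀ {ds} → All (1 ≤_) ds → length (numerator ds) ≡ sum ds + 1
length-numerator []                            = refl
length-numerator {suc e ∷ ds} (s≤s z≤n ∷ ds≥1) = trans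
  (length-xPow-1· e (numerator ds) (subst (0 <_) (sym (length-numerator ds≥1)) (ℕₚ.m≤n+m 1 (sum ds))))
  (trans (cong (λ k → suc e + k) (length-numerator ds≥1)) (sym (ℕₚ.+-assoc (suc e) (sum ds) 1)))

seq-numerator : ∀ {ds} → All (1 ≤_) ds → ∀ n → seq (numerator ds) n ≡ ∇* ds δ n
seq-numerator [] (+ zero)     = refl
seq-numerator [] (+ suc n)    = refl
seq-numerator [] -[1+ n ]     = refl
seq-numerator {suc e ∷ ds} (s≤s z≤n ∷ ds≥1) n = trans
  (seq-xPow-1· e (numerator ds) (subst (0 <_) (sym (length-numerator ds≥1)) (ℕₚ.m≤n+m 1 (sum ds))) n)
  (∇-cong (suc e) (seq-numerator ds≥1) n)

-- Agreement is asked only below the length, because each division shortens the list and says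
-- nothing about later coefficients.
_≈_ : Poly → (ℤ → ℤ) → Set
f ≈ g = ∀ j → j < length f → coeff f j ≡ g (+ j)

length-divXPow-1 : ∀ f e → length (divXPow-1 f e) ≡ length f ∸ suc e
length-divXPow-1 f e = length-map-upTo _ (length f ∸ suc e)

-- With `f = ∇ d g` the sum of the `f (j − td)` telescopes. Its far end is `g` at a negative
-- argument, where causality gives 0.
divXPow-1-≈ : ∀ f e (g : ℤ → ℤ) → Causal g → f ≈ ∇ (suc e) g → divXPow-1 f e ≈ g
divXPow-1-≈ f e g g0 f≈ j j< = begin
  coeff (divXPow-1 f e) j                              ≡⟨ coeff-map-upTo value (length f ∸ d) j j<′ ⟩
  - sumℤ (map (λ t → coeff f (j ∸ t * d)) (upTo (suc K))) ≡⟨ cong -_ (sumℤ-map-upTo (λ t → coeff f (j ∸ t * d)) (suc K)) ⟩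
  - ∑ (suc K) (λ t → coeff f (j ∸ t * d))              ≡⟨ cong -_ (∑-cong (suc K) term) ⟩
  - ∑ (suc K) (λ t → F (suc t) -ᶻ F t)                 ≡⟨ cong -_ (∑-telescope (suc K) F) ⟩
  - (F (suc K) -ᶻ F 0)                                 ≡⟨ cong₂ (λ x y → - (x -ᶻ g y)) beyond (ℤₚ.+-identityʳ (+ j)) ⟩
  - (0ℤ -ᶻ g (+ j))                                    ≡⟨ lem (g (+ j)) ⟩
  g (+ j)                                              ∎
  where
  d = suc e
  K = j DM./ d
  value : ℕ → ℤ
  value j = - sumℤ (map (λ t → coeff f (j ∸ t * d)) (upTo (suc (j DM./ d))))
  j<′ : j < length f ∸ d
  j<′ = subst (j <_) (length-divXPow-1 f e) j<
  lem : ∀ x → - (0ℤ -ᶻ x) ≡ x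
  lem = solve-∀
  F : ℕ → ℤ
  F t = g (+ j -ᶻ + (t * d))
  beyond : F (suc K) ≡ 0ℤ
  beyond = go (suc K * d ∸ j) (ℕₚ.m<n⇒0<n∸m j<K) (trans (ℤₚ.[+m]-[+n]≡m⊖n j (suc K * d)) (ℤₚ.⊖-< j<K))
    where
    j<K : j < suc K * d
    j<K = ℕₚ.<-≤-trans (subst (_< d + K * d) (sym (DM.m≡m%n+[m/n]*n j d)) (ℕₚ.+-monoˡ-< (K * d) (DM.m%n<n j d))) ℕₚ.≤-refl
    go : ∀ x {z} → 0 < x → z ≡ - + x → g z ≡ 0ℤ
    go (suc x) _ refl = g0 x
  lem₂ : ∀ j d x → j -ᶻ x -ᶻ d ≡ j -ᶻ (d +ᶻ x)
  lem₂ = solve-∀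
  term : ∀ t → t < suc K → coeff f (j ∸ t * d) ≡ F (suc t) -ᶻ F t
  term t t≤K = trans (f≈ (j ∸ t * d) (ℕₚ.≤-<-trans (ℕₚ.m∸n≤m j (t * d)) (ℕₚ.<-≤-trans j<′ (ℕₚ.m∸n≤m (length f) d))))
    (cong₂ (λ x y → g x -ᶻ g y) (trans (cong (_-ᶻ + d) e₁) (lem₂ (+ j) (+ d) (+ (t * d)))) e₁)
    where
    e₁ : + (j ∸ t * d) ≡ + j -ᶻ + (t * d)
    e₁ = sym (trans (ℤₚ.[+m]-[+n]≡m⊖n j (t * d)) (ℤₚ.⊖-≥ (ℕₚ.≤-trans (ℕₚ.*-monoˡ-≤ d (ℕₚ.≤-pred t≤K)) (DM.m/n*n≤m j d))))

quotient : Poly → List ℕ → Poly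
quotient = foldl (λ f d → divXPow-1 f (d ∸ 1))

length-quotient : ∀ f {ds} → All (1 ≤_) ds → length (quotient f ds) ≡ length f ∸ sum ds
length-quotient f []                            = refl
length-quotient f {suc e ∷ ds} (s≤s z≤n ∷ ds≥1) = trans (length-quotient (divXPow-1 f e) ds≥1)
  (trans (cong (_∸ sum ds) (length-divXPow-1 f e)) (ℕₚ.∸-+-assoc (length f) (suc e) (sum ds)))

quotient-≈ : ∀ f {ds} → All (1 ≤_) ds → (g : ℤ → ℤ) → Causal g → f ≈ ∇* ds g → quotient f ds ≈ g
quotient-≈ f []                            g g0 f≈ = f≈
quotient-≈ f {suc e ∷ ds} (s≤s z≤n ∷ ds≥1) g g0 f≈ = quotient-≈ (divXPow-1 f e) ds≥1 g g0
  (divXPow-1-≈ f e (∇* ds g) (∇*-causal ds g0) f≈)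

-- Unitary divisors

unique-↭ : {xs ys : List ℕ} → Unique xs → Unique ys → (∀ {x} → x ∈ xs → x ∈ ys) → (∀ {x} → x ∈ ys → x ∈ xs) → xs ↭ ys
unique-↭ ux uy f g = ∼bag⇒↭ (unique∧set⇒bag ux uy (mk⇔ f g))

⌊⌋-true : {P : Set} (d : Dec P) → P → ⌊ d ⌋ ≡ true
⌊⌋-true (yes _) _ = refl
⌊⌋-true (no ¬p) p = ⊥-elim (¬p p)

⌊⌋-true⁻ : {P : Set} (d : Dec P) → ⌊ d ⌋ ≡ true → P
⌊⌋-true⁻ (yes p) _ = p
⌊⌋-true⁻ (no _) ()

coprime-*ˡ : ∀ {a b d} → Coprime a d → Coprime b d → Coprime (a * b) d
coprime-*ˡ {a} a⊥d b⊥d {x} (x∣ab , x∣d) = b⊥d (coprime-divisor {x} {a} (λ (y∣x , y∣a) → a⊥d (y∣a , ℕ∣.∣-trans y∣x x∣d)) x∣ab , x∣d)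

coprime-sym : ∀ {a b} → Coprime a b → Coprime b a
coprime-sym a⊥b (d∣b , d∣a) = a⊥b (d∣a , d∣b)

prime∤1 : ∀ {ℓ} → Prime ℓ → ¬ (ℓ ℕ∣.∣ 1)
prime∤1 pℓ ℓ∣1 = ℕ.nonTrivial⇒≢1 {{prime⇒nonTrivial pℓ}} (ℕ∣.∣1⇒≡1 ℓ∣1)

prime∣prime : ∀ {x ℓ} → Prime x → Prime ℓ → x ℕ∣.∣ ℓ → x ≡ ℓ
prime∣prime px pℓ x∣ℓ = [ (λ { refl → ⊥-elim (prime∤1 px (ℕ∣.∣-refl)) }) , (λ e → e) ]′ (prime⇒irreducible pℓ x∣ℓ)

prime∣power : ∀ {x ℓ} k → Prime x → Prime ℓ → x ℕ∣.∣ ℓ ℕ.^ k → x ≡ ℓ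
prime∣power zero    px pℓ x∣1 = ⊥-elim (prime∤1 px x∣1)
prime∣power {x} {ℓ} (suc k) px pℓ x∣  = [ prime∣prime px pℓ , prime∣power k px pℓ ]′ (euclidsLemma ℓ (ℓ ℕ.^ k) px x∣)

coprime-power : ∀ {ℓ d} k → Prime ℓ → ¬ (ℓ ℕ∣.∣ d) → Coprime (ℓ ℕ.^ k) d
coprime-power zero    pℓ ℓ∤d (x∣1 , _) = ℕ∣.∣1⇒≡1 x∣1
coprime-power (suc k) pℓ ℓ∤d = coprime-*ˡ
  (λ (x∣ℓ , x∣d) → [ (λ e → e) , (λ { refl → ⊥-elim (ℓ∤d x∣d) }) ]′ (prime⇒irreducible pℓ x∣ℓ)) (coprime-power k pℓ ℓ∤d)

-- The underlying prime divides at most one of the coprime factors, so the power is coprime to the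
-- other and passes entirely into one of them.
power∣coprime-product : ∀ {p d e} → IsPrimePower p → Coprime d e → p ℕ∣.∣ d * e → p ℕ∣.∣ d ⊎ p ℕ∣.∣ e
power∣coprime-product {p} {d} {e} (ℓ , k , pℓ , _ , p≡) d⊥e p∣de = go (ℓ ℕ∣.∣? d)
  where
  coprime : ∀ {x} → ¬ (ℓ ℕ∣.∣ x) → Coprime p x
  coprime {x} ℓ∤x = subst (λ m → Coprime m x) (sym p≡) (coprime-power k pℓ ℓ∤x)
  go : Dec (ℓ ℕ∣.∣ d) → p ℕ∣.∣ d ⊎ p ℕ∣.∣ e
  go (yes ℓ∣d) = inj₁ (coprime-divisor (coprime λ ℓ∣e → prime∤1 pℓ (ℕ∣.∣-reflexive (d⊥e (ℓ∣d , ℓ∣e)))) (subst (p ℕ∣.∣_) (ℕₚ.*-comm d e) p∣de))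
  go (no ℓ∤d)  = inj₂ (coprime-divisor (coprime ℓ∤d) p∣de)

-- The primes of `pm` are those of `m` and the one new prime `ℓ`.
ω-* : ∀ p m .{{_ : NonZero p}} .{{_ : NonZero m}} → IsPrimePower p → Coprime p m → ω (p * m) ≡ suc (ω m)
ω-* p m (ℓ , suc k , pℓ , _ , p≡) p⊥m = Permₚ.↭-length (unique-↭
  (Uniqueₚ.filter⁺ (divisor? (p * m)) (Uniqueₚ.upTo⁺ (suc (p * m))))
  (All.tabulate (λ x∈ ℓ≡x → ℓ∉ (subst (_∈ primes m) (sym ℓ≡x) x∈)) ∷ Uniqueₚ.filter⁺ (divisor? m) (Uniqueₚ.upTo⁺ (suc m)))
  to from)
  where
  divisor? : ∀ n ℓ → Dec (Prime ℓ × ℓ ℕ∣.∣ n)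
  divisor? n ℓ = prime? ℓ ×-dec (ℓ ℕ∣.∣? n)
  primes : ℕ → List ℕ
  primes n = filter (divisor? n) (upTo (suc n))
  ∈-primes : ∀ {n x} .{{_ : NonZero n}} → Prime x → x ℕ∣.∣ n → x ∈ primes n
  ∈-primes {n} px x∣n = ∈ₚ.∈-filter⁺ (divisor? n) (∈ₚ.∈-upTo⁺ (s≤s (ℕ∣.∣⇒≤ x∣n))) (px , x∣n)
  ∈-primes⁻ : ∀ {n x} → x ∈ primes n → Prime x × x ℕ∣.∣ n
  ∈-primes⁻ {n} x∈ = proj₂ (∈ₚ.∈-filter⁻ (divisor? n) {xs = upTo (suc n)} x∈)
  ℓ∣p : ℓ ℕ∣.∣ p
  ℓ∣p = subst (ℓ ℕ∣.∣_) (sym p≡) (ℕ∣.m∣m*n (ℓ ℕ.^ k))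
  ℓ∉ : ℓ ∉ primes m
  ℓ∉ ℓ∈ = prime∤1 pℓ (ℕ∣.∣-reflexive (p⊥m (ℓ∣p , proj₂ (∈-primes⁻ {m} ℓ∈))))
  instance
    pm≢0 : NonZero (p * m)
    pm≢0 = ℕₚ.m*n≢0 p m
  to : ∀ {x} → x ∈ primes (p * m) → x ∈ ℓ ∷ primes m
  to {x} x∈ = let px , x∣pm = ∈-primes⁻ {p * m} x∈ in
    [ (λ x∣p → here (prime∣power (suc k) px pℓ (subst (x ℕ∣.∣_) p≡ x∣p))) , (λ x∣m → there (∈-primes px x∣m)) ]′ (euclidsLemma p m px x∣pm)
  from : ∀ {x} → x ∈ ℓ ∷ primes m → x ∈ primes (p * m)
  from (here refl) = ∈-primes pℓ (ℕ∣.∣-trans ℓ∣p (ℕ∣.m∣m*n m))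
  from (there x∈)  = let px , x∣m = ∈-primes⁻ {m} x∈ in ∈-primes px (ℕ∣.∣-trans x∣m (ℕ∣.n∣m*n p))

even-suc : ∀ k → ⌊ suc k DM.% 2 ℕ.≟ 0 ⌋ ≡ not ⌊ k DM.% 2 ℕ.≟ 0 ⌋
even-suc zero          = refl
even-suc (suc zero)    = refl
even-suc (suc (suc k)) = even-suc k

μ*-* : ∀ p m .{{_ : NonZero p}} .{{_ : NonZero m}} → IsPrimePower p → Coprime p m → μ*IsPlus (p * m) ≡ not (μ*IsPlus m)
μ*-* p m pp p⊥m = trans (cong (λ k → ⌊ k DM.% 2 ℕ.≟ 0 ⌋) (ω-* p m pp p⊥m)) (even-suc (ω m))

-- d ‖ n with μ*(n/d) = 1 if b is true and μ*(n/d) = −1 otherwise.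
UnitaryDivisor : Bool → ℕ → ℕ → Set
UnitaryDivisor b n d = Σ ℕ λ e → d * e ≡ n × Coprime d e × μ*IsPlus e ≡ b

-- These conditions fix each list up to permutation, which suffices: the iterated differences and
-- the sum of the divisors ignore the order.
record Signed (n : ℕ) (ds : Bool → List ℕ) : Set where
  field
    unique   : ∀ b → Unique (ds b)
    sound    : ∀ b {d} → d ∈ ds b → UnitaryDivisor b n d
    complete : ∀ b {d} → UnitaryDivisor b n d → d ∈ ds b

-- A unitary divisor of `pm` either absorbs `p`, leaving the cofactor and its sign alone, or leaves
-- `p` to the cofactor, which flips the sign.
extend : ℕ → (Bool → List ℕ) → Bool → List ℕ
extend p ds b = map (p *_) (ds b) ++ ds (not b)

one : Bool → List ℕ
one true  = [ 1 ]
one false = []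

signed-1 : Signed 1 one
signed-1 = record { unique = unique ; sound = sound ; complete = complete }
  where
  unique : ∀ b → Unique (one b)
  unique true  = [] ∷ []
  unique false = []
  sound : ∀ b {d} → d ∈ one b → UnitaryDivisor b 1 d
  sound true (here refl) = 1 , refl , (λ (x∣1 , _) → ℕ∣.∣1⇒≡1 x∣1) , refl
  complete : ∀ b {d} → UnitaryDivisor b 1 d → d ∈ one b
  complete b {d} (e , de≡1 , _ , sign) = go (ℕₚ.m*n≡1⇒m≡1 d e de≡1) (ℕₚ.m*n≡1⇒n≡1 d e de≡1) b sign
    where
    go : ∀ {d e} → d ≡ 1 → e ≡ 1 → ∀ b → μ*IsPlus e ≡ b → d ∈ one b
    go refl refl true _ = here refl

signed-* : ∀ p m {ds} → 2 ≤ p → .{{_ : NonZero m}} → IsPrimePower p → Coprime p m → Signed m ds → Signed (p * m) (extend p ds)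
signed-* p m {ds} p≥2 pp p⊥m S = record { unique = unique′ ; sound = sound′ ; complete = complete′ }
  where
  open Signed S
  instance
    p≢0 : NonZero p
    p≢0 = ℕ.>-nonZero (ℕₚ.<⇒≤ p≥2)
  p≢1 : p ≢ 1
  p≢1 refl = ℕₚ.<-irrefl refl p≥2
  divisor : ∀ b {d} → d ∈ ds b → d ℕ∣.∣ m
  divisor b {d} d∈ = let e , de≡m , _ = sound b d∈ in ℕ∣.divides e (trans (sym de≡m) (ℕₚ.*-comm d e))
  unique′ : ∀ b → Unique (extend p ds b)
  unique′ b = Uniqueₚ.++⁺ (Uniqueₚ.map⁺ (ℕₚ.*-cancelˡ-≡ _ _ p) (unique b)) (unique (not b)) disjoint
    where
    disjoint : ∀ {x} → ¬ (x ∈ map (p *_) (ds b) × x ∈ ds (not b))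
    disjoint (x∈ , x∈′) = let y , _ , x≡py = ∈ₚ.∈-map⁻ (p *_) x∈ in
      p≢1 (p⊥m (ℕ∣.∣-refl , ℕ∣.∣-trans (subst (p ℕ∣.∣_) (sym x≡py) (ℕ∣.m∣m*n y)) (divisor (not b) x∈′)))
  nonZero : ∀ d e → d * e ≡ m → NonZero e
  nonZero d zero    de≡m = ⊥-elim (ℕ.≢-nonZero⁻¹ m (trans (sym de≡m) (ℕₚ.*-zeroʳ d)))
  nonZero d (suc e) _    = _
  sign-* : ∀ e → NonZero e → Coprime p e → μ*IsPlus (p * e) ≡ not (μ*IsPlus e)
  sign-* e e≢0 = μ*-* p e {{p≢0}} {{e≢0}} pp
  sound′ : ∀ b {d} → d ∈ extend p ds b → UnitaryDivisor b (p * m) d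
  sound′ b {d} d∈ = [ scaled , kept ]′ (∈ₚ.∈-++⁻ (map (p *_) (ds b)) d∈)
    where
    scaled : d ∈ map (p *_) (ds b) → UnitaryDivisor b (p * m) d
    scaled d∈ = let y , y∈ , d≡py = ∈ₚ.∈-map⁻ (p *_) d∈
                    e , ye≡m , y⊥e , sign = sound b y∈
                in e , trans (cong (_* e) d≡py) (trans (ℕₚ.*-assoc p y e) (cong (p *_) ye≡m))
                     , subst (λ z → Coprime z e) (sym d≡py) (coprime-*ˡ (λ (x∣p , x∣e) → p⊥m (x∣p , subst (_ ℕ∣.∣_) ye≡m (ℕ∣.∣-trans x∣e (ℕ∣.n∣m*n y)))) y⊥e)
                     , sign
    kept : d ∈ ds (not b) → UnitaryDivisor b (p * m) d
    kept d∈ = let e , de≡m , d⊥e , sign = sound (not b) d∈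
                  p⊥ : ∀ z → z ℕ∣.∣ m → Coprime p z
                  p⊥ z z∣m = λ (x∣p , x∣z) → p⊥m (x∣p , ℕ∣.∣-trans x∣z z∣m)
              in p * e , trans (CS*.x∙yz≈y∙xz d p e) (cong (p *_) de≡m)
                   , coprime-sym (coprime-*ˡ (p⊥ d (divisor (not b) d∈)) (coprime-sym d⊥e))
                   , trans (sign-* e (nonZero d e de≡m) (p⊥ e (ℕ∣.divides d (sym de≡m)))) (trans (cong not sign) (Boolₚ.not-involutive b))
  complete′ : ∀ b {d} → UnitaryDivisor b (p * m) d → d ∈ extend p ds b
  complete′ b {d} (e , de≡pm , d⊥e , sign) = [ left , right ]′ (power∣coprime-product pp d⊥e (subst (p ℕ∣.∣_) (sym de≡pm) (ℕ∣.m∣m*n m)))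
    where
    left : p ℕ∣.∣ d → d ∈ extend p ds b
    left (ℕ∣.divides x d≡xp) = ∈ₚ.∈-++⁺ˡ (subst (_∈ map (p *_) (ds b)) (sym d≡px) (∈ₚ.∈-map⁺ (p *_) (complete b
      ( e , ℕₚ.*-cancelˡ-≡ (x * e) m p (trans (sym (ℕₚ.*-assoc p x e)) (trans (cong (_* e) (sym d≡px)) de≡pm))
      , (λ (y∣x , y∣e) → d⊥e (subst (_ ℕ∣.∣_) (sym d≡xp) (ℕ∣.∣-trans y∣x (ℕ∣.m∣m*n p)) , y∣e)) , sign))))
      where
      d≡px = trans d≡xp (ℕₚ.*-comm x p)
    right : p ℕ∣.∣ e → d ∈ extend p ds b
    right (ℕ∣.divides x e≡xp) = ∈ₚ.∈-++⁺ʳ (map (p *_) (ds b)) (complete (not b)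
      ( x , dx≡m
      , (λ (y∣d , y∣x) → d⊥e (y∣d , subst (_ ℕ∣.∣_) (sym e≡xp) (ℕ∣.∣-trans y∣x (ℕ∣.m∣m*n p))))
      , trans (sym (Boolₚ.not-involutive (μ*IsPlus x))) (cong not (trans (sym (sign-* x (nonZero d x dx≡m) p⊥x)) (trans (cong μ*IsPlus (sym e≡px)) sign)))))
      where
      e≡px : e ≡ p * x
      e≡px = trans e≡xp (ℕₚ.*-comm x p)
      dx≡m : d * x ≡ m
      dx≡m = ℕₚ.*-cancelˡ-≡ (d * x) m p (trans (CS*.x∙yz≈y∙xz p d x) (trans (cong (d *_) (sym e≡px)) de≡pm))
      p⊥x : Coprime p x
      p⊥x (y∣p , y∣x) = p⊥m (y∣p , subst (_ ℕ∣.∣_) dx≡m (ℕ∣.∣-trans y∣x (ℕ∣.n∣m*n d)))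

-- By definition this is `plusDivs` at `true` and `minusDivs` at `false`, so one argument serves
-- both.
signedDivs : Bool → ℕ → List ℕ
signedDivs b n = filter (λ d → μ*IsPlus (n DM./ suc (d ∸ 1)) Bool.≟ b) (unitaryDivisors n)

signedDivs-↭ : ∀ {n ds} .{{_ : NonZero n}} → Signed n ds → ∀ b → signedDivs b n ↭ ds b
signedDivs-↭ {n} {ds} S b = unique-↭
  (Uniqueₚ.filter⁺ sign? (Uniqueₚ.map⁺ ℕₚ.suc-injective (Uniqueₚ.filter⁺ unitary? (Uniqueₚ.upTo⁺ n))))
  (unique b) to from
  where
  open Signed S
  sign? : ∀ d → Dec (μ*IsPlus (n DM./ suc (d ∸ 1)) ≡ b)
  sign? d = μ*IsPlus (n DM./ suc (d ∸ 1)) Bool.≟ b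
  unitary? : ∀ i → Dec (isUnitary n i ≡ true)
  unitary? i = isUnitary n i Bool.≟ true
  dec : ∀ i → Dec (suc i ℕ∣.∣ n × gcd (suc i) (n DM./ suc i) ≡ 1)
  dec i = (suc i ℕ∣.∣? n) ×-dec (gcd (suc i) (n DM./ suc i) ℕ.≟ 1)
  to : ∀ {d} → d ∈ signedDivs b n → d ∈ ds b
  to d∈ = let d∈U , sign = ∈ₚ.∈-filter⁻ sign? {xs = unitaryDivisors n} d∈
              i , i∈ , d≡ = ∈ₚ.∈-map⁻ suc d∈U
              _ , u = ∈ₚ.∈-filter⁻ unitary? {xs = upTo n} i∈
              i∣n , g≡1 = ⌊⌋-true⁻ (dec i) u
          in member d≡ sign i∣n g≡1
    where
    member : ∀ {d i} → d ≡ suc i → μ*IsPlus (n DM./ suc (d ∸ 1)) ≡ b → suc i ℕ∣.∣ n → gcd (suc i) (n DM./ suc i) ≡ 1 → d ∈ ds b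
    member {i = i} refl sign i∣n g≡1 = complete b (n DM./ suc i , trans (ℕₚ.*-comm (suc i) (n DM./ suc i)) (DM.m/n*n≡m i∣n) , gcd≡1⇒coprime g≡1 , sign)
  from : ∀ {d} → d ∈ ds b → d ∈ signedDivs b n
  from {d} d∈ = let e , de≡n , d⊥e , sign = sound b d∈ in member d e de≡n d⊥e sign
    where
    member : ∀ d e → d * e ≡ n → Coprime d e → μ*IsPlus e ≡ b → d ∈ signedDivs b n
    member zero    e 0≡n _ _ = ⊥-elim (ℕ.≢-nonZero⁻¹ n (sym 0≡n))
    member (suc i) e de≡n d⊥e sign = ∈ₚ.∈-filter⁺ sign? (∈ₚ.∈-map⁺ suc (∈ₚ.∈-filter⁺ unitary? (∈ₚ.∈-upTo⁺ (ℕ∣.∣⇒≤ i∣n))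
        (⌊⌋-true (dec i) (i∣n , trans (cong (gcd (suc i)) n/≡e) (coprime⇒gcd≡1 d⊥e)))))
      (trans (cong μ*IsPlus n/≡e) sign)
      where
      n≡ed : n ≡ e * suc i
      n≡ed = trans (sym de≡n) (ℕₚ.*-comm (suc i) e)
      i∣n : suc i ℕ∣.∣ n
      i∣n = ℕ∣.divides e n≡ed
      n/≡e : n DM./ suc i ≡ e
      n/≡e = trans (cong (λ x → x DM./ suc i) n≡ed) (DM.m*n/n≡m e (suc i))

-- The statements for p < q.

module Ordered (p q : ℕ) (pp : IsPrimePower p) (pq : IsPrimePower q) (p≥3 : 3 ≤ p) (q≥3 : 3 ≤ q) (p<q : p < q) (p⊥q : Coprime p q) where
  private
    p≥2 : 2 ≤ p
    p≥2 = ℕₚ.<⇒≤ p≥3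
    instance
      p≢0 : NonZero p
      p≢0 = ℕ.>-nonZero (ℕₚ.<⇒≤ p≥2)
      q≢0 : NonZero q
      q≢0 = ℕ.>-nonZero (ℕₚ.<⇒≤ (ℕₚ.<⇒≤ q≥3))

  open Binary p q p≥2 p⊥q using (c; B-one; B-negative)
  open Window p q p≥2 p<q p⊥q using (W; W-left; W-right; A; A-cong; A-reflect; q<pq)

  record Third (r : ℕ) : Set where
    field
      prime-power : IsPrimePower r
      r≥3         : 3 ≤ r
      p⊥r         : Coprime p r
      q⊥r         : Coprime q r

  module Polynomial {r : ℕ} (R : Third r) where
    open Third R
    private
      instance
        r≢0 : NonZero r
        r≢0 = ℕ.>-nonZero (ℕₚ.<⇒≤ (ℕₚ.<⇒≤ r≥3))
        pq≢0 : NonZero (p * q)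
        pq≢0 = ℕₚ.m*n≢0 p q
        pqr≢0 : NonZero (p * q * r)
        pqr≢0 = ℕₚ.m*n≢0 (p * q) r
        pr≢0 : NonZero (p * r)
        pr≢0 = ℕₚ.m*n≢0 p r
        qr≢0 : NonZero (q * r)
        qr≢0 = ℕₚ.m*n≢0 q r
      r⊥pq : Coprime r (p * q)
      r⊥pq = coprime-sym (coprime-*ˡ p⊥r q⊥r)

    open Coefficients p q r p≥2 p<q p⊥q r⊥pq using (a; a-floor; a-neighbour; a-vanish) public
    open Attained p q r p≥2 p<q p⊥q r⊥pq using (attained; nearly-attained) public
    open Series p q r p≥2 p<q p⊥q r⊥pq

    private
      n = p * q * r

      plus minus : List ℕ
      plus  = n ∷ p ∷ q ∷ r ∷ []
      minus = p * q ∷ p * r ∷ q * r ∷ 1 ∷ []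

      signed : Signed n (extend p (extend q (extend r one)))
      signed = subst (λ m → Signed m (extend p (extend q (extend r one)))) n≡
        (signed-* p (q * (r * 1)) p≥2 pp (coprime-sym (coprime-*ˡ (coprime-sym p⊥q) (coprime-*ˡ (coprime-sym p⊥r) (1⊥ p))))
        (signed-* q (r * 1) (ℕₚ.<⇒≤ q≥3) pq (coprime-sym (coprime-*ˡ (coprime-sym q⊥r) (1⊥ q)))
        (signed-* r 1 (ℕₚ.<⇒≤ r≥3) prime-power (coprime-sym (1⊥ r)) signed-1)))
        where
        instance
          r1≢0 : NonZero (r * 1)
          r1≢0 = ℕₚ.m*n≢0 r 1
          qr1≢0 : NonZero (q * (r * 1))
          qr1≢0 = ℕₚ.m*n≢0 q (r * 1)
        1⊥ : ∀ x → Coprime 1 x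
        1⊥ x (d∣1 , _) = ℕ∣.∣1⇒≡1 d∣1
        n≡ : p * (q * (r * 1)) ≡ n
        n≡ = trans (cong (λ x → p * (q * x)) (ℕₚ.*-identityʳ r)) (sym (ℕₚ.*-assoc p q r))

      plusDivs-↭ : plusDivs n ↭ plus
      plusDivs-↭ = Perm.↭-trans (signedDivs-↭ signed true) (Perm.↭-reflexive
        (cong₂ _∷_ (trans (cong (λ x → p * (q * x)) (ℕₚ.*-identityʳ r)) (sym (ℕₚ.*-assoc p q r)))
        (cong₂ _∷_ (ℕₚ.*-identityʳ p) (cong₂ _∷_ (ℕₚ.*-identityʳ q) (cong₂ _∷_ (ℕₚ.*-identityʳ r) refl)))))

      minusDivs-↭ : minusDivs n ↭ minus
      minusDivs-↭ = Perm.↭-trans (signedDivs-↭ signed false) (Perm.↭-reflexive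
        (cong₂ _∷_ (cong (p *_) (ℕₚ.*-identityʳ q)) (cong₂ _∷_ (cong (p *_) (ℕₚ.*-identityʳ r))
        (cong₂ _∷_ (cong (q *_) (ℕₚ.*-identityʳ r)) refl))))

      positive : ∀ {ds es} → ds ↭ es → All NonZero es → All (1 ≤_) ds
      positive ds↭es es≢0 = Permₚ.All-resp-↭ (Perm.↭-sym ds↭es) (All.map (λ {x} x≢0 → ℕ.>-nonZero⁻¹ x {{x≢0}}) es≢0)

      plus≥1 : All (1 ≤_) (plusDivs n)
      plus≥1 = positive plusDivs-↭ (pqr≢0 ∷ p≢0 ∷ q≢0 ∷ r≢0 ∷ [])

      minus≥1 : All (1 ≤_) (minusDivs n)
      minus≥1 = positive minusDivs-↭ (pq≢0 ∷ pr≢0 ∷ qr≢0 ∷ _ ∷ [])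

      equation : ∀ m → ∇* (plusDivs n) δ m ≡ ∇* (minusDivs n) series m
      equation m = begin
        ∇* (plusDivs n) δ m                     ≡⟨ ∇*-↭ (Perm.↭-trans plusDivs-↭ (Permₚ.++-comm (n ∷ []) (p ∷ q ∷ r ∷ []))) δ m ⟩
        ∇* (p ∷ q ∷ r ∷ n ∷ []) δ m             ≡⟨ series-equation m ⟨
        ∇* (1 ∷ p * q ∷ p * r ∷ q * r ∷ []) series m
          ≡⟨ ∇*-↭ (Perm.↭-trans minusDivs-↭ (Permₚ.++-comm (p * q ∷ p * r ∷ q * r ∷ []) (1 ∷ []))) series m ⟨
        ∇* (minusDivs n) series m               ∎

      num Q : Poly
      num = numerator (plusDivs n)
      Q   = quotient num (minusDivs n)

      Q≈ : Q ≈ series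
      Q≈ = quotient-≈ num minus≥1 series series-negative λ j _ → trans (seq-numerator plus≥1 (+ j)) (equation (+ j))

      length-Q : length Q ≡ sum plus + 1 ∸ sum minus
      length-Q = trans (length-quotient num minus≥1) (cong₂ _∸_
        (trans (length-numerator plus≥1) (cong (_+ 1) (sum-↭ plusDivs-↭))) (sum-↭ minusDivs-↭))

    coeff-a : ∀ j → coeff (Φ* n) j ≡ a j
    coeff-a j = trans (coeff-normalize Q j) (go (j ℕ.<? length Q))
      where
      go : Dec (j < length Q) → coeff Q j ≡ a j
      go (yes j<) = trans (Q≈ j j<) (series-a j)
      -- `length Q` is `(p − 1)(q − 1)(r − 1) + 1`, exactly where `a-vanish` begins to apply.
      go (no j≮)  = trans (coeff-overflow Q j (ℕₚ.≮⇒≥ j≮)) (sym (a-vanish j (ℕₚ.+-cancelʳ-≤ 1 (p + q + r + n) (j + (p * q + p * r + q * r))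
        (ℕₚ.≤-trans (ℕₚ.≤-reflexive e₁) (ℕₚ.≤-trans (ℕₚ.m≤n+m∸n (sum plus + 1) (sum minus))
          (ℕₚ.≤-trans (ℕₚ.+-monoʳ-≤ (sum minus) (ℕₚ.≤-trans (ℕₚ.≤-reflexive (sym length-Q)) (ℕₚ.≮⇒≥ j≮))) (ℕₚ.≤-reflexive e₂)))))))
        where
        e₁ : p + q + r + n + 1 ≡ sum plus + 1
        e₁ = cong (_+ 1) (trans (ℕₚ.+-comm (p + q + r) n) (cong (λ x → n + x) (trans (ℕₚ.+-assoc p q r) (cong (λ x → p + (q + x)) (sym (ℕₚ.+-identityʳ r))))))
        e₂ : sum minus + j ≡ j + (p * q + p * r + q * r) + 1
        e₂ = trans (ℕₚ.+-comm (sum minus) j) (trans (cong (λ x → j + x) (trans (cong (λ x → p * q + x) (sym (ℕₚ.+-assoc (p * r) (q * r) 1)))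
          (trans (sym (ℕₚ.+-assoc (p * q) (p * r + q * r) 1)) (cong (_+ 1) (sym (ℕₚ.+-assoc (p * q) (p * r) (q * r)))))))
          (sym (ℕₚ.+-assoc j (p * q + p * r + q * r) 1)))

    private
      Φ : Poly
      Φ = normalize (Φ* n)

      coeff-Φ : ∀ j → coeff Φ j ≡ a j
      coeff-Φ j = trans (coeff-normalize (Φ* n) j) (coeff-a j)

      inside : ∀ {v} j → j < length Φ → a j ≡ v → v ∈C Φ* n
      inside j j< e = subst (_∈ Φ) (trans (coeff-Φ j) e) (coeff⇒∈ Φ j j<)

    value : ∀ {v} → v ∈C Φ* n → Σ ℕ λ j → j < length Φ × a j ≡ v
    value v∈ = let j , j< , e = ∈⇒coeff v∈ in j , j< , trans (sym (coeff-Φ j)) e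

    consecutive : Consecutive (Φ* n)
    consecutive u v w u∈ v∈ u≤w w≤v =
      let i , i< , ai = value u∈
          j , j< , aj = value v∈
          k , k≤ , ak = intermediate a a-neighbour i j w (subst (ℤ._≤ w) (sym ai) u≤w) (subst (w ℤ.≤_) (sym aj) w≤v)
      in inside k (ℕₚ.≤-<-trans k≤ (ℕₚ.⊔-pres-<m i< j<)) ak

    private
      nonzero : ∀ {v} j → a j ≡ v → v ≢ 0ℤ → v ∈C Φ* n
      nonzero j e v≢0 = go (j ℕ.<? length Φ)
        where
        go : Dec (j < length Φ) → _ ∈C Φ* n
        go (yes j<) = inside j j< e
        go (no j≮)  = ⊥-elim (v≢0 (trans (sym e) (trans (sym (coeff-Φ j)) (coeff-overflow Φ j (ℕₚ.≮⇒≥ j≮)))))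

      c-0 : c 0ℤ ≡ 1ℤ
      c-0 = cong₂ _-ᶻ_ (B-one 0 0 0ℤ (ℕₚ.<⇒≤ p≥2) (sym zeros)) (B-negative 0)
        where
        lem : ∀ x y → 0ℤ *ᶻ x +ᶻ 0ℤ *ᶻ y ≡ 0ℤ
        lem = solve-∀
        zeros : + 0 *ᶻ + q +ᶻ + 0 *ᶻ + p ≡ 0ℤ
        zeros = lem (+ q) (+ p)

      a-small : ∀ m → m < r → a m ≡ W (+ m)
      a-small m m<r = trans (a-floor m 0 (ℕₚ.≤-trans (ℕₚ.≤-reflexive (ℕₚ.*-zeroʳ r)) z≤n) (ℕₚ.<-≤-trans m<r (ℕₚ.≤-reflexive (sym (ℕₚ.*-identityʳ r)))))
        (trans (ℤₚ.+-identityˡ _) (trans (cong₂ _*ᶻ_ c-0 (cong W (trans (cong (+ m -ᶻ_) (ℤₚ.*-zeroʳ (+ r))) (ℤₚ.+-identityʳ (+ m))))) (ℤₚ.*-identityˡ (W (+ m)))))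

      -- Zeros beyond the degree do not count as coefficients. For `r > q` the coefficients at 0 and
      -- at `q` are `W 0 = 1` and `W q = −1`, and 0 lies between them.
      zero∈ : q < r → 0ℤ ∈C Φ* n
      zero∈ q<r = consecutive (- 1ℤ) 1ℤ 0ℤ
        (nonzero q (trans (a-small q q<r) (trans (W-right q ℕₚ.≤-refl q<pq) (cong -_ (⟦⟧-yes (q ℕ.<? p + q) (ℕₚ.m<n+m q (ℕₚ.<⇒≤ p≥2)))))) λ ())
        (nonzero 0 (trans (a-small 0 (ℕₚ.<⇒≤ (ℕₚ.<⇒≤ r≥3))) (trans (W-left 0 (ℕₚ.<⇒≤ (ℕₚ.<⇒≤ q≥3))) (⟦⟧-yes (0 ℕ.<? p) (ℕₚ.<⇒≤ p≥2)))) λ ())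
        ℤ.-≤+ (ℤ.+≤+ z≤n)

    -- `attained` may return an index beyond the degree, but a nonzero value cannot occur there; the
    -- value 0 is treated apart.
    A-∈ : q < r → ∀ {v} N t → A (+ r) N t ≡ v → v ∈C Φ* n
    A-∈ q<r {v} N t e = go (v ℤ.≟ 0ℤ)
      where
      go : Dec (v ≡ 0ℤ) → v ∈C Φ* n
      go (yes v≡0) = subst (_∈C Φ* n) (sym v≡0) (zero∈ q<r)
      go (no v≢0)  = let j , aj = attained q<r N t in nonzero j (trans aj e) v≢0

    a-A : ∀ j → Σ ℕ λ N → a j ≡ A (+ r) N (+ j)
    a-A j = suc (j DM./ r) , refl

    ∈-A : ∀ {v} → v ∈C Φ* n → Σ ℕ λ N → Σ ℤ λ t → A (+ r) N t ≡ v
    ∈-A v∈ = let j , _ , aj = value v∈ in suc (j DM./ r) , + j , aj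

  private
    reflect : ∀ r s → + (p * q) ∣ᶻ + r +ᶻ + s → ∀ N t → A (+ s) N (+ p +ᶻ + q -ᶻ 1ℤ -ᶻ t) ≡ - A (+ r) N t
    reflect r s r≡-s N t = trans
      (A-cong (+ s) (- + r) N t′ t′ (∣ᶻ-via (lem (+ r) (+ s)) r≡-s) (divides 0ℤ (ℤₚ.+-inverseʳ t′))) (A-reflect (+ r) N t)
      where
      t′ : ℤ
      t′ = + p +ᶻ + q -ᶻ 1ℤ -ᶻ t
      lem : ∀ r s → r +ᶻ s ≡ s -ᶻ - r
      lem = solve-∀

    A-∣∣ : ∀ r s → + (p * q) ∣ᶻ + r -ᶻ + s ⊎ + (p * q) ∣ᶻ + r +ᶻ + s → ∀ N t → Σ ℤ λ u → ∣ A (+ r) N t ∣ ≡ ∣ A (+ s) N u ∣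
    A-∣∣ r s (inj₁ r≡s)  N t = t , cong ∣_∣ (A-cong (+ r) (+ s) N t t r≡s (divides 0ℤ (ℤₚ.+-inverseʳ t)))
    A-∣∣ r s (inj₂ r≡-s) N t = + p +ᶻ + q -ᶻ 1ℤ -ᶻ t , sym (trans (cong ∣_∣ (reflect r s r≡-s N t)) (ℤₚ.∣-i∣≡∣i∣ (A (+ r) N t)))

  module _ {r s : ℕ} (R : Third r) (S : Third s) where
    private
      module 𝓡 = Polynomial R
      module 𝓢 = Polynomial S

    same : + (p * q) ∣ᶻ + r -ᶻ + s → q < r → q < s → SameCoeffs (Φ* (p * q * r)) (Φ* (p * q * s))
    same r≡s q<r q<s v =
      (λ v∈ → let N , t , e = 𝓡.∈-A v∈ in 𝓢.A-∈ q<s N t (trans (sym (A-cong (+ r) (+ s) N t t r≡s (t≡t t))) e)) ,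
      (λ v∈ → let N , t , e = 𝓢.∈-A v∈ in 𝓡.A-∈ q<r N t (trans (A-cong (+ r) (+ s) N t t r≡s (t≡t t)) e))
      where
      t≡t : ∀ t → + (p * q) ∣ᶻ t -ᶻ t
      t≡t t = divides 0ℤ (ℤₚ.+-inverseʳ t)

    opposite : + (p * q) ∣ᶻ + r +ᶻ + s → q < r → q < s → NegCoeffs (Φ* (p * q * r)) (Φ* (p * q * s))
    opposite r≡-s q<r q<s v =
      (λ v∈ → let N , t , e = 𝓡.∈-A v∈ in 𝓢.A-∈ q<s N (+ p +ᶻ + q -ᶻ 1ℤ -ᶻ t) (trans (reflect r s r≡-s N t) (cong -_ e))) ,
      (λ v∈ → let N , t , e = 𝓢.∈-A v∈ in 𝓡.A-∈ q<r N (+ p +ᶻ + q -ᶻ 1ℤ -ᶻ t)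
        (trans (reflect s r (∣ᶻ-via (ℤₚ.+-comm (+ r) (+ s)) r≡-s) N t) (trans (cong -_ e) (ℤₚ.neg-involutive v))))

    -- Up to sign, a coefficient for `s` is a truncated sum for `r`, and these are attained because
    -- `q < r`. Conversely, a coefficient for `r` is up to sign a truncated sum for `s`, which
    -- exceeds some coefficient for `s` by at most one in absolute value.
    heights : + (p * q) ∣ᶻ + r -ᶻ + s ⊎ + (p * q) ∣ᶻ + r +ᶻ + s → q < r →
              H (Φ* (p * q * s)) ≤ H (Φ* (p * q * r)) × H (Φ* (p * q * r)) ≤ H (Φ* (p * q * s)) + 1
    heights r≡±s q<r = H-least (Φ* (p * q * s)) _ lower , H-least (Φ* (p * q * r)) _ upper
      where
      lem : ∀ r s → - (r -ᶻ s) ≡ s -ᶻ r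
      lem = solve-∀
      s≡±r : + (p * q) ∣ᶻ + s -ᶻ + r ⊎ + (p * q) ∣ᶻ + s +ᶻ + r
      s≡±r = [ (λ d → inj₁ (∣ᶻ-via (lem (+ r) (+ s)) (∣ᶻ.∣m⇒∣-m d))) , (λ d → inj₂ (∣ᶻ-via (ℤₚ.+-comm (+ r) (+ s)) d)) ]′ r≡±s
      𝓡-bound : ∀ j → ∣ 𝓡.a j ∣ ≤ H (Φ* (p * q * r))
      𝓡-bound j = subst (λ x → ∣ x ∣ ≤ H (Φ* (p * q * r))) (𝓡.coeff-a j) (∣coeff∣≤H (Φ* (p * q * r)) j)
      𝓢-bound : ∀ j → ∣ 𝓢.a j ∣ ≤ H (Φ* (p * q * s))
      𝓢-bound j = subst (λ x → ∣ x ∣ ≤ H (Φ* (p * q * s))) (𝓢.coeff-a j) (∣coeff∣≤H (Φ* (p * q * s)) j)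
      lower : ∀ j → ∣ coeff (Φ* (p * q * s)) j ∣ ≤ H (Φ* (p * q * r))
      lower j = let N , aj = 𝓢.a-A j
                    u , e = A-∣∣ s r s≡±r N (+ j)
                    m , am = 𝓡.attained q<r N u
                in ℕₚ.≤-trans (ℕₚ.≤-reflexive (trans (cong ∣_∣ (trans (𝓢.coeff-a j) aj)) (trans e (cong ∣_∣ (sym am))))) (𝓡-bound m)
      upper : ∀ j → ∣ coeff (Φ* (p * q * r)) j ∣ ≤ H (Φ* (p * q * s)) + 1
      upper j = let N , aj = 𝓡.a-A j
                    u , e = A-∣∣ r s r≡±s N (+ j)
                    m , am = 𝓢.nearly-attained N u
                in ℕₚ.≤-trans (ℕₚ.≤-reflexive (trans (cong ∣_∣ (trans (𝓡.coeff-a j) aj)) e)) (ℕₚ.≤-trans am (ℕₚ.+-monoˡ-≤ 1 (𝓢-bound m)))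

-- Removing the order of p and q.

-- Only `pq` and `max(p, q)` enter, so exchanging `p` and `q` is a transport along two commutativity
-- laws.
Claim : (N m r s : ℕ) → Set
Claim N m r s =
  Consecutive (Φ* (N * r))
  × ((m < r → m < s →
       ((+ N ∣ (+ r ℤ.- + s)) → SameCoeffs (Φ* (N * r)) (Φ* (N * s)))
       × ((+ N ∣ (+ r ℤ.+ + s)) → NegCoeffs (Φ* (N * r)) (Φ* (N * s)))))
  × (((+ N ∣ (+ r ℤ.- + s)) ⊎ (+ N ∣ (+ r ℤ.+ + s))) →
       m < r → s < m →
       H (Φ* (N * s)) ≤ H (Φ* (N * r))
       × H (Φ* (N * r)) ≤ H (Φ* (N * s)) + 1)

claim : (p q r s : ℕ) →
  IsPrimePower p → IsPrimePower q → IsPrimePower r → IsPrimePower s →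
  3 ≤ p → 3 ≤ q → 3 ≤ r → 3 ≤ s →
  Coprime p q → Coprime p r → Coprime p s → Coprime q r → Coprime q s →
  p < q → Claim (p * q) (p ⊔ q) r s
claim p q r s pp pq pr ps p≥3 q≥3 r≥3 s≥3 p⊥q p⊥r p⊥s q⊥r q⊥s p<q =
    Polynomial.consecutive R
  , (λ m<r m<s → (λ d → same R S (∣ᶻ.∣ᵤ⇒∣ d) (above m<r) (above m<s)) , (λ d → opposite R S (∣ᶻ.∣ᵤ⇒∣ d) (above m<r) (above m<s)))
  , (λ d m<r _ → heights R S ([ (λ d → inj₁ (∣ᶻ.∣ᵤ⇒∣ d)) , (λ d → inj₂ (∣ᶻ.∣ᵤ⇒∣ d)) ]′ d) (above m<r))
  where
  open Ordered p q pp pq p≥3 q≥3 p<q p⊥q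
  R : Third r
  R = record { prime-power = pr ; r≥3 = r≥3 ; p⊥r = p⊥r ; q⊥r = q⊥r }
  S : Third s
  S = record { prime-power = ps ; r≥3 = s≥3 ; p⊥r = p⊥s ; q⊥r = q⊥s }
  above : ∀ {x} → p ⊔ q < x → q < x
  above = ℕₚ.≤-<-trans (ℕₚ.m≤n⊔m p q)

theorem9 : (p q r s : ℕ) →
    IsPrimePower p → IsPrimePower q → IsPrimePower r → IsPrimePower s →
    3 ≤ p → 3 ≤ q → 3 ≤ r → 3 ≤ s →
    Coprime p q → Coprime p r → Coprime p s →
    Coprime q r → Coprime q s → Coprime r s →
    Consecutive (Φ* (p * q * r))
    × ((p ⊔ q < r → p ⊔ q < s →
    ((+ (p * q) ∣ (+ r ℤ.- + s)) → SameCoeffs (Φ* (p * q * r)) (Φ* (p * q * s)))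
    × ((+ (p * q) ∣ (+ r ℤ.+ + s)) → NegCoeffs (Φ* (p * q * r)) (Φ* (p * q * s)))))
    × (((+ (p * q) ∣ (+ r ℤ.- + s)) ⊎ (+ (p * q) ∣ (+ r ℤ.+ + s))) →
    p ⊔ q < r → s < p ⊔ q →
    H (Φ* (p * q * s)) ≤ H (Φ* (p * q * r))
    × H (Φ* (p * q * r)) ≤ H (Φ* (p * q * s)) + 1)
theorem9 p q r s pp pq pr ps p≥3 q≥3 r≥3 s≥3 p⊥q p⊥r p⊥s q⊥r q⊥s _ = go (ℕₚ.<-cmp p q)
  where
  go : Tri (p < q) (p ≡ q) (q < p) → Claim (p * q) (p ⊔ q) r s
  go (tri< p<q _ _) = claim p q r s pp pq pr ps p≥3 q≥3 r≥3 s≥3 p⊥q p⊥r p⊥s q⊥r q⊥s p<q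
  go (tri> _ _ q<p) = subst₂ (λ N m → Claim N m r s) (ℕₚ.*-comm q p) (ℕₚ.⊔-comm q p)
    (claim q p r s pq pp pr ps q≥3 p≥3 r≥3 s≥3 (coprime-sym p⊥q) q⊥r q⊥s p⊥r p⊥s q<p)
  -- A number coprime to itself is 1.
  go (tri≈ _ refl _) = ⊥-elim (ℕₚ.<⇒≢ (ℕₚ.<⇒≤ p≥3) (sym (p⊥q (ℕ∣.∣-refl , ℕ∣.∣-refl))))
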